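{- There exists a (dynamic programming) algorithm that, for any single-block instance $\mathcal C=\{\mu_1,\dots,\mu_n\}$ of $\varepsilon$-Consensus-Halving with maximum value $M$ and maximum intersection $d$, computes a set of cuts that define a solution, i.e. at most $n$ cuts together with a labeling of the resulting intervals by $+/-$ such that $|\mu_j(I^+)-\mu_j(I^-)|\le\varepsilon$ for all $j\in\{1,\dots,n\}$. The running time of the algorithm is $$O\left(\left(\frac{2M}{\varepsilon}\right)^{d+2} n\,(n+d)\right).$$
   Context: **Consensus-Halving.** An instance of $\varepsilon$-Consensus-Halving consists of $\varepsilon>0$ and $n$ continuous probability measures (valuations) $\mu_1,\dots,\mu_n$ on $[0,1]$, given by their density functions $f_1,\dots,f_n$. The goal is to partition $[0,1]$ into two (not necessarily connected) pieces $I^+$ and $I^-$ using at most $n$ cuts, such that $|\mu_j(I^+)-\mu_j(I^-)|\le\varepsilon$ for all $j$. Here cuts are points of $[0,1]$, each interval between consecutive cuts gets a label "$+$" or "$-$", and $I^+$, $I^-$ are the unions of the intervals with the respective label. **Single-block instance.** Every valuation $\mu_i$ is single-block: there are $a_i<b_i$ in $[0,1]$ such that the density $f_i$ is a positive constant (namely $1/(b_i-a_i)$) on the interval with endpoints $a_i,b_i$ and is $0$ everywhere else. The valuations are given explicitly in the input by endpoints and heights of the blocks. **Parameters.** A single-block instance has maximum intersection $d$ if for every $x\in[0,1]$ the set $\mathcal R(x)=\{i\in[n] \mid f_i(x)>0\}$ has cardinality at most $d$. It has maximum value $M$ if $f_i(x)\le M$ for every $i\in[n]$ and every $x\in[0,1]$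 (equivalently, $b_i-a_i\ge 1/M$ for all $i$).
   Formalization: The block endpoints and heights, ε, the maximum value M and the computed cuts are rational numbers; running time is counted in unit-cost steps with exact arithmetic. -}

module Defs where

open import Data.Bool.Base using (Bool; true; false; if_then_else_; _∧_; not)
open import Data.Fin.Base using (Fin; toℕ; fromℕ<)
open import Data.Fin.Subset using (Subset) renaming (∣_∣ to card)
open import Data.Integer.Base using (+_)
open import Data.Nat.Base as ℕ using (ℕ; zero; suc)
import Data.Nat.Properties as ℕ
open import Data.Product.Base using (_×_; _,_)
open import Data.Rational.Base
open import Data.Rational.Properties using (_<?_; _≤?_; _≟_; pos⇒nonZero; +-inverseʳ; +-monoˡ-<)
open import Data.Sign.Base as Sign using (Sign)
open import Data.Vec.Base using (Vec; []; _∷_; tabulate)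
open import Data.Vec.Relation.Unary.All using (All)
open import Data.Vec.Relation.Unary.Linked using (Linked)
open import Relation.Binary.PropositionalEquality.Core using (_≡_; subst)
open import Relation.Nullary.Decidable.Core using (does; yes; no)
open import Algebra.Definitions.RawSemiring +-*-rawSemiring using (_^_)

fromℕ : ℕ → ℚ
fromℕ n = + n / 1

InUnit : ℚ → Set
InUnit x = 0ℚ ≤ x × x ≤ 1ℚ

------------------------------------------------------------------------
-- Single-block instances of Consensus-Halving

record SingleBlock (n : ℕ) : Set where
  field
    left right : Fin n → ℚ
    0≤left     : ∀ i → 0ℚ ≤ left i
    left<right : ∀ i → left i < right i
    right≤1    : ∀ i → right i ≤ 1ℚ

  length-positive : ∀ i → Positive (right i - left i)
  length-positive i = positive
    (subst (_< right i - left i) (+-inverseʳ (left i)) (+-monoˡ-< (- left i) (left<right i)))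

  height : Fin n → ℚ
  height i = (1/ (right i - left i)) {{pos⇒nonZero (right i - left i) {{length-positive i}}}}

  -- The values at the two endpoints do not affect the measures.  Blocks are
  -- taken open: any other convention has the same maximum value and an at
  -- least as large maximum intersection, hence a weaker running time bound.
  density : Fin n → ℚ → ℚ
  density i x = if does (left i <? x) ∧ does (x <? right i) then height i else 0ℚ

  support : ℚ → Subset n
  support x = tabulate λ i → does (0ℚ <? density i x)

  -- ∫ₚ^q density i, for p ≤ q: the height of the block times the length of
  -- [left i , right i] ∩ [p , q].
  mass : Fin n → ℚ × ℚ → ℚ
  mass i (p , q) = height i * (0ℚ ⊔ ((right i ⊓ q) - (left i ⊔ p)))

  -- Endpoints of blocks are rational, so the densities take on rational
  -- points of [0,1] every combination of values they take on real points.
  MaximumValue : ℚ → Set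
  MaximumValue M = ∀ i x → InUnit x → density i x ≤ M

  MaximumIntersection : ℕ → Set
  MaximumIntersection d = ∀ x → InUnit x → card (support x) ℕ.≤ d

open SingleBlock public

------------------------------------------------------------------------
-- Cuts and labels

record Cutting : Set where
  constructor cutting
  field
    {#cuts} : ℕ
    cuts    : Vec ℚ #cuts
    labels  : Vec Sign (suc #cuts)

open Cutting public

-- The intervals into which the cuts divide [p , 1].
intervalsFrom : ∀ {k} → ℚ → Vec ℚ k → Vec (ℚ × ℚ) (suc k)
intervalsFrom p []       = (p , 1ℚ) ∷ []
intervalsFrom p (x ∷ xs) = (p , x) ∷ intervalsFrom x xs

sumLabelled : ∀ {k} → Sign → (ℚ × ℚ → ℚ) → Vec Sign k → Vec (ℚ × ℚ) k → ℚ
sumLabelled s       f []            []       = 0ℚ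
sumLabelled Sign.+  f (Sign.+ ∷ ss) (J ∷ Js) = f J + sumLabelled Sign.+ f ss Js
sumLabelled Sign.+  f (Sign.- ∷ ss) (J ∷ Js) = sumLabelled Sign.+ f ss Js
sumLabelled Sign.-  f (Sign.+ ∷ ss) (J ∷ Js) = sumLabelled Sign.- f ss Js
sumLabelled Sign.-  f (Sign.- ∷ ss) (J ∷ Js) = f J + sumLabelled Sign.- f ss Js

-- μᵢ(Iˢ), where Iˢ is the union of the intervals with label s.
μ : ∀ {n} → SingleBlock n → Fin n → Sign → Cutting → ℚ
μ C i s X = sumLabelled s (mass C i) (labels X) (intervalsFrom 0ℚ (cuts X))

record IsSolution {n} (C : SingleBlock n) (ε : ℚ) (X : Cutting) : Set where
  field
    at-most-n  : #cuts X ℕ.≤ n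
    inUnit     : All InUnit (cuts X)
    increasing : Linked _<_ (cuts X)
    balanced   : ∀ j → ∣ μ C j Sign.+ X - μ C j Sign.- X ∣ ≤ ε

------------------------------------------------------------------------
-- Model of computation: while-programs on a unit-cost random access machine
-- with natural numbers (also used as addresses) and rational numbers.  As for
-- the real RAM, rationals support exact field operations and comparisons, but
-- there is no rounding of rationals to natural numbers.

-- Arrays are named by fixed numbers in the program text and are indexed by
-- computed natural numbers; scalar variables are array cells.
record Store : Set where
  constructor store
  field
    nats : ℕ → ℕ → ℕ
    rats : ℕ → ℕ → ℚ

open Store public

data NExp : Set where
  lit           : ℕ → NExp
  _!_           : ℕ → NExp → NExp
  add monus mul : NExp → NExp → NExp

data QExp : Set where
  lit             : ℚ → QExp
  _!_             : ℕ → NExp → QExp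
  add sub mul div : QExp → QExp → QExp

data BExp : Set where
  leqℕ : NExp → NExp → BExp
  leqℚ : QExp → QExp → BExp
  notᵇ : BExp → BExp
  andᵇ : BExp → BExp → BExp

infix  9 _!_
infix  5 _!_≔ℕ_ _!_≔ℚ_
infixr 4 _⨾_

data Program : Set where
  skip       : Program
  _!_≔ℕ_     : ℕ → NExp → NExp → Program
  _!_≔ℚ_     : ℕ → NExp → QExp → Program
  _⨾_        : Program → Program → Program
  ifte       : BExp → Program → Program → Program
  while      : BExp → Program → Program

quotient : ℚ → ℚ → ℚ
quotient p q with q ≟ 0ℚ
... | yes _   = 0ℚ
... | no  q≢0 = (p ÷ q) {{≢-nonZero q≢0}}

⟦_⟧ℕ : NExp → Store → ℕ
⟦ lit n     ⟧ℕ σ = n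
⟦ a ! e     ⟧ℕ σ = nats σ a (⟦ e ⟧ℕ σ)
⟦ add e f   ⟧ℕ σ = ⟦ e ⟧ℕ σ ℕ.+ ⟦ f ⟧ℕ σ
⟦ monus e f ⟧ℕ σ = ⟦ e ⟧ℕ σ ℕ.∸ ⟦ f ⟧ℕ σ
⟦ mul e f   ⟧ℕ σ = ⟦ e ⟧ℕ σ ℕ.* ⟦ f ⟧ℕ σ

⟦_⟧ℚ : QExp → Store → ℚ
⟦ lit q   ⟧ℚ σ = q
⟦ a ! e   ⟧ℚ σ = rats σ a (⟦ e ⟧ℕ σ)
⟦ add e f ⟧ℚ σ = ⟦ e ⟧ℚ σ + ⟦ f ⟧ℚ σ
⟦ sub e f ⟧ℚ σ = ⟦ e ⟧ℚ σ - ⟦ f ⟧ℚ σ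
⟦ mul e f ⟧ℚ σ = ⟦ e ⟧ℚ σ * ⟦ f ⟧ℚ σ
⟦ div e f ⟧ℚ σ = quotient (⟦ e ⟧ℚ σ) (⟦ f ⟧ℚ σ)

⟦_⟧ᵇ : BExp → Store → Bool
⟦ leqℕ e f ⟧ᵇ σ = does (⟦ e ⟧ℕ σ ℕ.≤? ⟦ f ⟧ℕ σ)
⟦ leqℚ e f ⟧ᵇ σ = does (⟦ e ⟧ℚ σ ≤? ⟦ f ⟧ℚ σ)
⟦ notᵇ b   ⟧ᵇ σ = not (⟦ b ⟧ᵇ σ)
⟦ andᵇ b c ⟧ᵇ σ = ⟦ b ⟧ᵇ σ ∧ ⟦ c ⟧ᵇ σ

update : {A : Set} → (ℕ → ℕ → A) → ℕ → ℕ → A → ℕ → ℕ → A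
update m a i x b j = if does (a ℕ.≟ b) ∧ does (i ℕ.≟ j) then x else m b j

infix 3 _,_⇓[_]_

-- P , σ ⇓[ t ] τ : from store σ, program P halts in store τ after t steps.
-- Every assignment, test and skip is one step; the expressions of a fixed
-- program have bounded size, so evaluating one takes a bounded number of
-- machine operations.
data _,_⇓[_]_ : Program → Store → ℕ → Store → Set where

  ⇓skip : ∀ {σ} →
    skip , σ ⇓[ 1 ] σ

  ⇓assignℕ : ∀ {σ a e f} →
    a ! e ≔ℕ f , σ ⇓[ 1 ] store (update (nats σ) a (⟦ e ⟧ℕ σ) (⟦ f ⟧ℕ σ)) (rats σ)

  ⇓assignℚ : ∀ {σ a e f} →
    a ! e ≔ℚ f , σ ⇓[ 1 ] store (nats σ) (update (rats σ) a (⟦ e ⟧ℕ σ) (⟦ f ⟧ℚ σ))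

  ⇓seq : ∀ {P Q ρ σ τ s t} →
    P , ρ ⇓[ s ] σ → Q , σ ⇓[ t ] τ →
    P ⨾ Q , ρ ⇓[ s ℕ.+ t ] τ

  ⇓ifTrue : ∀ {b P Q σ τ t} →
    ⟦ b ⟧ᵇ σ ≡ true → P , σ ⇓[ t ] τ →
    ifte b P Q , σ ⇓[ suc t ] τ

  ⇓ifFalse : ∀ {b P Q σ τ t} →
    ⟦ b ⟧ᵇ σ ≡ false → Q , σ ⇓[ t ] τ →
    ifte b P Q , σ ⇓[ suc t ] τ

  ⇓whileTrue : ∀ {b P ρ σ τ s t} →
    ⟦ b ⟧ᵇ ρ ≡ true → P , ρ ⇓[ s ] σ → while b P , σ ⇓[ t ] τ →
    while b P , ρ ⇓[ suc (s ℕ.+ t) ] τ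

  ⇓whileFalse : ∀ {b P σ} →
    ⟦ b ⟧ᵇ σ ≡ false →
    while b P , σ ⇓[ 1 ] σ

------------------------------------------------------------------------
-- Input, output and running time

padded : ∀ {n} → (Fin n → ℚ) → ℕ → ℚ
padded {n} f i with i ℕ.<? n
... | yes i<n = f (fromℕ< i<n)
... | no  _   = 0ℚ

-- n is cell 0 of array 0 of naturals and ε is cell 0 of array 0 of rationals;
-- arrays 1, 2, 3 of rationals hold the left endpoints, right endpoints and
-- heights of the blocks.  M and d are not part of the input.
input : ∀ {n} → SingleBlock n → ℚ → Store
input {n} C ε = store natInput ratInput
  where
  natInput : ℕ → ℕ → ℕ
  natInput 0 0 = n
  natInput _ _ = 0

  ratInput : ℕ → ℕ → ℚ
  ratInput 0 0 = ε
  ratInput 1 i = padded (left C) i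
  ratInput 2 i = padded (right C) i
  ratInput 3 i = padded (height C) i
  ratInput _ _ = 0ℚ

toSign : ℕ → Sign
toSign zero    = Sign.-
toSign (suc _) = Sign.+

-- The number of cuts is read from cell 0 of array 1 of naturals, the labels
-- from array 2 of naturals and the cuts from array 4 of rationals.
output : Store → Cutting
output σ = cutting {nats σ 1 0}
  (tabulate λ j → rats σ 4 (toℕ j))
  (tabulate λ j → toSign (nats σ 2 (toℕ j)))

-- (2M/ε)^(d+2) · n(n+d)
bound : (M ε : ℚ) .{{_ : Positive ε}} (d n : ℕ) → ℚ
bound M ε d n =
  ((fromℕ 2 * M ÷ ε) {{pos⇒nonZero ε}}) ^ (d ℕ.+ 2) * fromℕ (n ℕ.* (n ℕ.+ d))

-- The bound tends to 0 as ε grows, while every computation takes at least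
-- one step; hence the maximum with 1.  It makes no difference if n ≥ 1 and
-- ε ≤ 2M, in particular if n ≥ 1 and ε ≤ 1.
_≤O[_]_ : ℕ → ℕ → ℚ → Set
t ≤O[ c ] g = fromℕ t ≤ fromℕ c * (1ℚ ⊔ g)

{-# OPTIONS --safe #-}

-- Existence: the labelled partitions with at most n cuts form an n-sphere,
-- subdivided here into cubes of sign sequences with free coordinates.  If no point of it
-- were nearly balanced, labelling each point by a badly divided block would
-- contradict Ky Fan's lemma, proved by a parity count over hemispheres.  A
-- nearly balanced sequence on a fine grid is rounded to a grid of N ≈ 2M/ε
-- cells by choosing the sign of each cell so that the accumulated error stays
-- within one cell; a block then changes by at most 2 · M/N, whatever the number
-- of cuts.
--
-- Algorithm: the signs of the N cells are chosen from left to right.  Of two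
-- sequences on the first k cells that agree on the last sign, on the signs of
-- the cells in which unfinished blocks start, and on the numbers of plus signs
-- between these cells, only the cheaper one matters.  The cost counts the sign
-- changes, and n + 1 for each finished block that is not balanced.  The classes
-- are numbered in mixed radix.  With r ≤ d starting cells the radices are twice
-- the gaps between them, so there are at most 2 (2N)^r / r! = O((2M/ε)^d)
-- classes; the factorial absorbs the factors 2^r and (εN/2M)^r.

module Submission where

open import Defs
open import Data.Bool.Base using (Bool; true; false; not; if_then_else_; _∧_; _∨_; _xor_)
open import Data.Bool.Properties as Bool using (xor-∧-commutativeRing; xor-identityʳ; xor-comm)
open import Data.Empty using (⊥; ⊥-elim)
open import Data.Fin.Base using (Fin; zero; suc; toℕ; fromℕ<)
import Data.Fin.Properties as Fin
open import Data.Fin.Subset using () renaming (∣_∣ to card)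
import Data.Integer.Base as ℤ
import Data.Integer.Properties as ℤ
open import Data.Maybe.Base using (just; nothing)
open import Data.Nat.Base as ℕ using (ℕ; zero; suc; z≤n; s≤s; _!)
import Data.Nat.Coprimality as Coprime
import Data.Nat.Properties as ℕ
import Data.Nat.Tactic.RingSolver as ℕ-Solver
open import Data.Product.Base using (_×_; _,_; proj₁; proj₂; ∃-syntax)
open import Data.Rational.Base
open import Data.Rational.Properties
import Data.Sign.Base as Sign
open import Data.Sum.Base using (_⊎_; inj₁; inj₂)
open import Data.Unit.Base using (⊤; tt)
open import Data.Vec.Base using (Vec; []; _∷_; lookup; replicate; tabulate; _[_]≔_)
open import Data.Vec.Properties using (lookup∘update′; lookup-replicate)
open import Data.Vec.Relation.Unary.All using (All; []; _∷_)
open import Data.Vec.Relation.Unary.Linked using (Linked; []; [-]; _∷_)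
open import Function.Base using (_∘_)
open import Relation.Binary.Definitions using (tri<; tri≈; tri>)
open import Relation.Binary.PropositionalEquality
open import Relation.Nullary using (¬_; yes; no; does; Dec)
open import Relation.Nullary.Decidable using (dec-true; dec-false)
open import Relation.Nullary.Decidable.Core using (dec⇒maybe)
open import Tactic.RingSolver using (solve-∀)
open import Tactic.RingSolver.Core.AlmostCommutativeRing using (AlmostCommutativeRing; fromCommutativeRing)
open import Algebra.Definitions.RawSemiring +-*-rawSemiring using (_^_)

-- The fine grid lives in the existence proof only: its mesh shrinks with `n`, the dimension of the
-- sphere, and would spoil the running time. The coarse mesh is dictated by the rounding error
-- `2 * M / N` alone. `N` makes this error strictly less than `ε`, and the slack pays for the
-- balance on the fine grid being approximate; hence a combinatorial lemma suffices, without limits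
-- or compactness. The weight `n + 1` of a violation makes a cost of at most `n` equivalent to being
-- a solution. Flipping all signs affects neither balance nor the number of changes, so only
-- sequences that end in plus are compared. Sequences are stored whole, as binary codes, and each
-- candidate is evaluated from scratch in `O(n * N)` steps. With `N` layers this accounts for two of
-- the `d + 2` factors `2M/ε` and for one factor `n`; the other `d` come from the classes. Instances
-- with `ε ≥ 1` are solved without cuts. Otherwise `2M/ε ≥ 2`, because heights are at least 1, so
-- that rounding up costs at most a factor 3/2.

-- Rational arithmetic

ℚ-ring : AlmostCommutativeRing _ _
ℚ-ring = fromCommutativeRing +-*-commutativeRing λ p → dec⇒maybe (0ℚ ≟ p)

neg-involutive : ∀ p → - (- p) ≡ p
neg-involutive = solve-∀ ℚ-ring

0≤q-p : ∀ {p q} → p ≤ q → 0ℚ ≤ q - p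
0≤q-p {p} {q} p≤q = subst (_≤ q - p) (+-inverseʳ p) (+-monoˡ-≤ (- p) p≤q)

0<q-p : ∀ {p q} → p < q → 0ℚ < q - p
0<q-p {p} {q} p<q = subst (_< q - p) (+-inverseʳ p) (+-monoˡ-< (- p) p<q)

≤-from-difference : ∀ {p q} r → 0ℚ ≤ r → p + r ≡ q → p ≤ q
≤-from-difference {p} r 0≤r eq = subst₂ _≤_ (+-identityʳ p) eq (+-monoʳ-≤ p 0≤r)

<-from-difference : ∀ {p q} r → 0ℚ < r → p + r ≡ q → p < q
<-from-difference {p} r 0<r eq = subst₂ _<_ (+-identityʳ p) eq (+-monoʳ-< p 0<r)

0≤p+q : ∀ {p q} → 0ℚ ≤ p → 0ℚ ≤ q → 0ℚ ≤ p + q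
0≤p+q = +-mono-≤

0≤p*q : ∀ {p q} → 0ℚ ≤ p → 0ℚ ≤ q → 0ℚ ≤ p * q
0≤p*q {p} {q} 0≤p 0≤q = subst (_≤ p * q) (*-zeroʳ p) (*-monoˡ-≤-nonNeg p {{nonNegative 0≤p}} 0≤q)

0<p*q : ∀ {p q} → 0ℚ < p → 0ℚ < q → 0ℚ < p * q
0<p*q {p} {q} 0<p 0<q = subst (_< p * q) (*-zeroʳ p) (*-monoʳ-<-pos p {{positive 0<p}} 0<q)

*-mono-≤-nonNeg : ∀ {p q r s} → 0ℚ ≤ p → 0ℚ ≤ s → p ≤ q → r ≤ s → p * r ≤ q * s
*-mono-≤-nonNeg {p} {q} {r} {s} 0≤p 0≤s p≤q r≤s =
  ≤-trans (*-monoˡ-≤-nonNeg p {{nonNegative 0≤p}} r≤s) (*-monoʳ-≤-nonNeg s {{nonNegative 0≤s}} p≤q)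

p*q≤r⇒q≤r÷p : ∀ {p q r} → 0ℚ < p → p * q ≤ p * r → q ≤ r
p*q≤r⇒q≤r÷p {p} 0<p = *-cancelˡ-≤-pos p {{positive 0<p}}

Within : ℚ → ℚ → Set
Within ε x = - ε ≤ x × x ≤ ε

∣∣≤⇒Within : ∀ {ε x} → ∣ x ∣ ≤ ε → Within ε x
∣∣≤⇒Within {ε} {x} le with ∣p∣≡p∨∣p∣≡-p x
... | inj₁ eq = ≤-trans (neg-antimono-≤ (≤-trans (0≤∣p∣ x) le)) (∣p∣≡p⇒0≤p eq) , subst (_≤ ε) eq le
... | inj₂ eq = subst (- ε ≤_) (neg-involutive x) (neg-antimono-≤ (subst (_≤ ε) eq le))
              , ≤-trans (subst (_≤ 0ℚ) (neg-involutive x) (neg-antimono-≤ (subst (0ℚ ≤_) eq (0≤∣p∣ x)))) (≤-trans (0≤∣p∣ x) le)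

Within⇒∣∣≤ : ∀ {ε x} → Within ε x → ∣ x ∣ ≤ ε
Within⇒∣∣≤ {ε} {x} (lo , hi) with ∣p∣≡p∨∣p∣≡-p x
... | inj₁ eq = subst (_≤ ε) (sym eq) hi
... | inj₂ eq = subst₂ _≤_ (sym eq) (neg-involutive ε) (neg-antimono-≤ lo)

Within-+ : ∀ {p q x y} → Within p x → Within q y → Within (p + q) (x + y)
Within-+ {p} {q} (l , h) (l′ , h′) = subst (_≤ _) (sym (neg-distrib-+ p q)) (+-mono-≤ l l′) , +-mono-≤ h h′

Within-neg : ∀ {p x} → Within p x → Within p (- x)
Within-neg {p} {x} (l , h) = neg-antimono-≤ h , subst (- x ≤_) (neg-involutive p) (neg-antimono-≤ l)

Within-nonNeg : ∀ {ε x} → Within ε x → 0ℚ ≤ ε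
Within-nonNeg {ε} (lo , hi) with ≤-total 0ℚ ε
... | inj₁ 0≤ε = 0≤ε
... | inj₂ ε≤0 = ≤-trans (neg-antimono-≤ ε≤0) (≤-trans lo hi)

Within-mono : ∀ {p q x} → p ≤ q → Within p x → Within q x
Within-mono p≤q (l , h) = ≤-trans (neg-antimono-≤ p≤q) l , ≤-trans h p≤q

Within-* : ∀ {p q x} → 0ℚ ≤ q → Within p x → Within (q * p) (q * x)
Within-* {p} {q} {x} 0≤q (l , h) =
  subst (_≤ q * x) (sym (neg-distribʳ-* q p)) (*-monoˡ-≤-nonNeg q {{nonNegative 0≤q}} l)
  , *-monoˡ-≤-nonNeg q {{nonNegative 0≤q}} h

-- Sums and products of rationals compute on `mkℚ`, whereas `fromℕ` is defined by normalising a
-- fraction; this brings it into the form on which they reduce.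
fromℕ-mkℚ : ∀ n → fromℕ n ≡ mkℚ (ℤ.+ n) 0 (Coprime.sym (Coprime.1-coprimeTo n))
fromℕ-mkℚ n = normalize-coprime (Coprime.sym (Coprime.1-coprimeTo n))

fromℕ-+ : ∀ m n → fromℕ (m ℕ.+ n) ≡ fromℕ m + fromℕ n
fromℕ-+ m n = trans (cong (_/ 1) (trans (ℤ.pos-+ m n) (sym (cong₂ ℤ._+_ (ℤ.*-identityʳ (ℤ.+ m)) (ℤ.*-identityʳ (ℤ.+ n))))))
                    (sym (cong₂ _+_ (fromℕ-mkℚ m) (fromℕ-mkℚ n)))

fromℕ-* : ∀ m n → fromℕ (m ℕ.* n) ≡ fromℕ m * fromℕ n
fromℕ-* m n = trans (cong (_/ 1) (ℤ.pos-* m n)) (sym (cong₂ _*_ (fromℕ-mkℚ m) (fromℕ-mkℚ n)))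

fromℕ-suc : ∀ n → fromℕ (suc n) ≡ 1ℚ + fromℕ n
fromℕ-suc n = fromℕ-+ 1 n

fromℕ-suc′ : ∀ n → fromℕ (suc n) ≡ fromℕ n + 1ℚ
fromℕ-suc′ n = trans (fromℕ-suc n) (+-comm 1ℚ (fromℕ n))

0≤fromℕ : ∀ n → 0ℚ ≤ fromℕ n
0≤fromℕ zero    = ≤-refl
0≤fromℕ (suc n) = subst (0ℚ ≤_) (sym (fromℕ-suc n)) (0≤p+q (nonNegative⁻¹ 1ℚ) (0≤fromℕ n))

fromℕ-mono-≤ : ∀ {m n} → m ℕ.≤ n → fromℕ m ≤ fromℕ n
fromℕ-mono-≤ {m} {n} m≤n = ≤-from-difference (fromℕ (n ℕ.∸ m)) (0≤fromℕ (n ℕ.∸ m))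
  (trans (sym (fromℕ-+ m (n ℕ.∸ m))) (cong fromℕ (ℕ.m+[n∸m]≡n m≤n)))

0<fromℕ-suc : ∀ n → 0ℚ < fromℕ (suc n)
0<fromℕ-suc n = <-≤-trans (positive⁻¹ 1ℚ) (fromℕ-mono-≤ {1} {suc n} (s≤s z≤n))

archimedean : ∀ p → ∃[ n ] p ≤ fromℕ n
archimedean p@(mkℚ (ℤ.+ n) d c) = n , subst (p ≤_) (sym (fromℕ-mkℚ n))
  (*≤* (subst₂ ℤ._≤_ (ℤ.pos-* n 1) (ℤ.pos-* n (suc d)) (ℤ.+≤+ (ℕ.*-monoʳ-≤ n (s≤s z≤n)))))
archimedean p@(mkℚ (ℤ.-[1+ n ]) d c) = 0 , nonPositive⁻¹ p

-- `u` is the floor of `x` plus one, found by descending from an archimedean bound until the next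
-- step down would no longer exceed `x`.
next-integer : ∀ {x} → 0ℚ ≤ x → ∃[ u ] x < fromℕ u × fromℕ u ≤ x + 1ℚ
next-integer {x} 0≤x with archimedean x
... | U , x≤U = search (suc U) (<-≤-trans (<-from-difference 1ℚ (positive⁻¹ 1ℚ) refl)
                                 (subst (x + 1ℚ ≤_) (sym (fromℕ-suc′ U)) (+-monoˡ-≤ 1ℚ x≤U)))
  where
  search : ∀ u → x < fromℕ u → ∃[ u ] x < fromℕ u × fromℕ u ≤ x + 1ℚ
  search zero    x<0 = ⊥-elim (<-irrefl refl (≤-<-trans 0≤x x<0))
  search (suc u) x<u with x <? fromℕ u
  ... | yes x<u′ = search u x<u′
  ... | no  x≮u  = suc u , x<u
    , subst (_≤ x + 1ℚ) (sym (fromℕ-suc′ u)) (+-monoˡ-≤ 1ℚ (≮⇒≥ x≮u))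

-- Signs, finite sums and grids

sgn : Bool → ℚ
sgn true  = 1ℚ
sgn false = - 1ℚ

sgn-not : ∀ b → sgn (not b) ≡ - sgn b
sgn-not true  = refl
sgn-not false = refl

∑ : ℕ → (ℕ → ℚ) → ℚ
∑ zero    f = 0ℚ
∑ (suc k) f = ∑ k f + f k

∑-cong : ∀ k {f g} → (∀ j → j ℕ.< k → f j ≡ g j) → ∑ k f ≡ ∑ k g
∑-cong zero    eq = refl
∑-cong (suc k) eq = cong₂ _+_ (∑-cong k (λ j j<k → eq j (ℕ.m<n⇒m<1+n j<k))) (eq k ℕ.≤-refl)

∑-mono : ∀ k {f g} → (∀ j → j ℕ.< k → f j ≤ g j) → ∑ k f ≤ ∑ k g
∑-mono zero    le = ≤-refl
∑-mono (suc k) le = +-mono-≤ (∑-mono k (λ j j<k → le j (ℕ.m<n⇒m<1+n j<k))) (le k ℕ.≤-refl)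

∑-+ : ∀ k f g → ∑ k (λ j → f j + g j) ≡ ∑ k f + ∑ k g
∑-+ zero    f g = refl
∑-+ (suc k) f g = trans (cong (_+ (f k + g k)) (∑-+ k f g)) (interchange (∑ k f) (∑ k g) (f k) (g k))
  where
  interchange : ∀ a b c d → (a + b) + (c + d) ≡ (a + c) + (b + d)
  interchange = solve-∀ ℚ-ring

∑-*ˡ : ∀ k c f → ∑ k (λ j → c * f j) ≡ c * ∑ k f
∑-*ˡ zero    c f = sym (*-zeroʳ c)
∑-*ˡ (suc k) c f = trans (cong (_+ c * f k) (∑-*ˡ k c f)) (sym (*-distribˡ-+ c (∑ k f) (f k)))

∑-neg : ∀ k f → ∑ k (λ j → - f j) ≡ - ∑ k f
∑-neg zero    f = refl
∑-neg (suc k) f = trans (cong (_+ - f k) (∑-neg k f)) (sym (neg-distrib-+ (∑ k f) (f k)))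

∑-minus : ∀ k f g → ∑ k (λ j → f j - g j) ≡ ∑ k f - ∑ k g
∑-minus k f g = trans (∑-+ k f (λ j → - g j)) (cong (∑ k f +_) (∑-neg k g))

∑-zero : ∀ k {f} → (∀ j → j ℕ.< k → f j ≡ 0ℚ) → ∑ k f ≡ 0ℚ
∑-zero zero    eq = refl
∑-zero (suc k) eq = cong₂ _+_ (∑-zero k (λ j j<k → eq j (ℕ.m<n⇒m<1+n j<k))) (eq k ℕ.≤-refl)

∑-const : ∀ k c → ∑ k (λ _ → c) ≡ fromℕ k * c
∑-const zero    c = sym (*-zeroˡ c)
∑-const (suc k) c = trans (cong (_+ c) (∑-const k c)) (trans (step (fromℕ k) c) (cong (_* c) (sym (fromℕ-suc k))))
  where
  step : ∀ k c → k * c + c ≡ (1ℚ + k) * c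
  step = solve-∀ ℚ-ring

∑-telescope : ∀ k (f : ℕ → ℚ) → ∑ k (λ j → f (suc j) - f j) ≡ f k - f 0
∑-telescope zero    f = sym (+-inverseʳ (f 0))
∑-telescope (suc k) f = trans (cong (_+ (f (suc k) - f k)) (∑-telescope k f)) (cancel (f k) (f 0) (f (suc k)))
  where
  cancel : ∀ a b c → (a - b) + (c - a) ≡ c - b
  cancel = solve-∀ ℚ-ring

∑-append : ∀ a b f → ∑ (a ℕ.+ b) f ≡ ∑ a f + ∑ b (λ j → f (a ℕ.+ j))
∑-append a zero    f = trans (cong (λ k → ∑ k f) (ℕ.+-identityʳ a)) (sym (+-identityʳ _))
∑-append a (suc b) f = trans (cong (λ k → ∑ k f) (ℕ.+-suc a b))
  (trans (cong (_+ f (a ℕ.+ b)) (∑-append a b f)) (+-assoc (∑ a f) _ _))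

∑-blocks : ∀ N m f → ∑ (N ℕ.* m) f ≡ ∑ N (λ z → ∑ m (λ j → f (z ℕ.* m ℕ.+ j)))
∑-blocks zero    m f = refl
∑-blocks (suc N) m f = trans (cong (λ k → ∑ k f) (ℕ.+-comm m (N ℕ.* m)))
  (trans (∑-append (N ℕ.* m) m f) (cong (_+ ∑ m (λ j → f (N ℕ.* m ℕ.+ j))) (∑-blocks N m f)))

grid : ℚ → ℕ → ℚ
grid δ j = fromℕ j * δ

grid-zero : ∀ δ → grid δ 0 ≡ 0ℚ
grid-zero δ = *-zeroˡ δ

grid-suc : ∀ δ j → grid δ (suc j) ≡ grid δ j + δ
grid-suc δ j = trans (cong (_* δ) (fromℕ-suc j)) (step (fromℕ j) δ)
  where
  step : ∀ k c → (1ℚ + k) * c ≡ k * c + c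
  step = solve-∀ ℚ-ring

grid-mono : ∀ {δ j k} → 0ℚ ≤ δ → j ℕ.≤ k → grid δ j ≤ grid δ k
grid-mono {δ} 0≤δ j≤k = *-monoʳ-≤-nonNeg δ {{nonNegative 0≤δ}} (fromℕ-mono-≤ j≤k)

grid-strict : ∀ {δ j k} → 0ℚ < δ → j ℕ.< k → grid δ j < grid δ k
grid-strict {δ} {j} 0<δ j<k =
  <-≤-trans (<-from-difference δ 0<δ (sym (grid-suc δ j))) (grid-mono (<⇒≤ 0<δ) j<k)

-- For `p ≤ q` the difference `x ⊓ q - x ⊓ p` is the length of the part of `[p , q]` to the left of
-- `x`. All integrals below are built from such lengths.
⊓-increment-lower : ∀ x {p q} → p ≤ q → 0ℚ ≤ x ⊓ q - x ⊓ p
⊓-increment-lower x p≤q = 0≤q-p (⊓-monoʳ-≤ x p≤q)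

⊓-increment-upper : ∀ x {p q} → p ≤ q → x ⊓ q - x ⊓ p ≤ q - p
⊓-increment-upper x {p} {q} p≤q with ≤-total x p
... | inj₁ x≤p = subst (_≤ q - p) (sym (trans (cong₂ _-_ (p≤q⇒p⊓q≡p (≤-trans x≤p p≤q)) (p≤q⇒p⊓q≡p x≤p)) (+-inverseʳ x))) (0≤q-p p≤q)
... | inj₂ p≤x = subst (λ y → x ⊓ q - y ≤ q - p) (sym (p≥q⇒p⊓q≡q p≤x)) (+-monoˡ-≤ (- p) (p⊓q≤q x q))

⊓-increment-after : ∀ {x p q} → p ≤ q → x ≤ p → x ⊓ q - x ⊓ p ≡ 0ℚ
⊓-increment-after {x} p≤q x≤p =
  trans (cong₂ _-_ (p≤q⇒p⊓q≡p (≤-trans x≤p p≤q)) (p≤q⇒p⊓q≡p x≤p)) (+-inverseʳ x)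

⊓-increment-before : ∀ {x p q} → p ≤ q → q ≤ x → x ⊓ q - x ⊓ p ≡ q - p
⊓-increment-before p≤q q≤x = cong₂ _-_ (p≥q⇒p⊓q≡q q≤x) (p≥q⇒p⊓q≡q (≤-trans p≤q q≤x))

differs : Bool → Bool → ℕ
differs a b = if a xor b then 1 else 0

changes : (ℕ → Bool) → ℕ → ℕ
changes s zero          = 0
changes s (suc zero)    = 0
changes s (suc (suc k)) = changes s (suc k) ℕ.+ differs (s (suc k)) (s k)

-- Tucker's lemma for sign sequences

𝔽₂ : AlmostCommutativeRing _ _
𝔽₂ = fromCommutativeRing xor-∧-commutativeRing λ { false → just refl ; true → nothing }

-- A cell of the cube [-1,1]^L: every coordinate is either a sign or free.
-- The outermost constructor describes the last coordinate.
data Cube : ℕ → ℕ → Set where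
  []   : Cube 0 0
  fix  : ∀ {L k} → Bool → Cube L k → Cube (suc L) k
  free : ∀ {L k} → Cube L k → Cube (suc L) (suc k)

antipode : ∀ {L k} → Cube L k → Cube L k
antipode []        = []
antipode (fix b X) = fix (not b) (antipode X)
antipode (free X)  = free (antipode X)

infix 4 _⊑_

data _⊑_ : ∀ {L j k} → Cube L j → Cube L k → Set where
  []    : [] ⊑ []
  fix   : ∀ {L j k b} {X : Cube L j} {Y : Cube L k} → X ⊑ Y → fix b X ⊑ fix b Y
  free  : ∀ {L j k} {X : Cube L j} {Y : Cube L k} → X ⊑ Y → free X ⊑ free Y
  inner : ∀ {L j k b} {X : Cube L j} {Y : Cube L k} → X ⊑ Y → fix b X ⊑ free Y

⊑-refl : ∀ {L k} {X : Cube L k} → X ⊑ X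
⊑-refl {X = []}      = []
⊑-refl {X = fix b X} = fix ⊑-refl
⊑-refl {X = free X}  = free ⊑-refl

⊑-trans : ∀ {L i j k} {X : Cube L i} {Y : Cube L j} {Z : Cube L k} → X ⊑ Y → Y ⊑ Z → X ⊑ Z
⊑-trans []        []        = []
⊑-trans (fix p)   (fix q)   = fix (⊑-trans p q)
⊑-trans (fix p)   (inner q) = inner (⊑-trans p q)
⊑-trans (free p)  (free q)  = free (⊑-trans p q)
⊑-trans (inner p) (free q)  = inner (⊑-trans p q)

Cochain : ℕ → ℕ → Set
Cochain L k = Cube L k → Bool

-- The coboundary modulo two: the sum over the facets, two for every free coordinate. An edge is
-- treated apart because `Φ ∘ free` would have degree -1 there.
δ : ∀ {L k} → Cochain L k → Cochain L (suc k)
δ             Φ (fix b X) = δ (Φ ∘ fix b) X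
δ {k = zero}  Φ (free X)  = Φ (fix true X) xor Φ (fix false X)
δ {k = suc k} Φ (free X)  = (Φ (fix true X) xor Φ (fix false X)) xor δ (Φ ∘ free) X

δ-cong : ∀ {L k} {Φ Ψ : Cochain L k} (X : Cube L (suc k)) →
         (∀ {Y} → Y ⊑ X → Φ Y ≡ Ψ Y) → δ Φ X ≡ δ Ψ X
δ-cong             (fix b X) eq = δ-cong X (eq ∘ fix)
δ-cong {k = zero}  (free X)  eq = cong₂ _xor_ (eq (inner ⊑-refl)) (eq (inner ⊑-refl))
δ-cong {k = suc k} (free X)  eq =
  cong₂ _xor_ (cong₂ _xor_ (eq (inner ⊑-refl)) (eq (inner ⊑-refl))) (δ-cong X (eq ∘ free))

δ-xor : ∀ {L k} (Φ Ψ : Cochain L k) X → δ (λ Y → Φ Y xor Ψ Y) X ≡ δ Φ X xor δ Ψ X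
δ-xor             Φ Ψ (fix b X) = δ-xor (Φ ∘ fix b) (Ψ ∘ fix b) X
δ-xor {k = zero}  Φ Ψ (free X)  =
  interchange (Φ (fix true X)) (Ψ (fix true X)) (Φ (fix false X)) (Ψ (fix false X))
  where
  interchange : ∀ a b c d → (a xor b) xor (c xor d) ≡ (a xor c) xor (b xor d)
  interchange = solve-∀ 𝔽₂
δ-xor {k = suc k} Φ Ψ (free X)  =
  trans (cong (((Φ (fix true X) xor Ψ (fix true X)) xor (Φ (fix false X) xor Ψ (fix false X))) xor_)
              (δ-xor (Φ ∘ free) (Ψ ∘ free) X))
        (interchange (Φ (fix true X)) (Ψ (fix true X)) (Φ (fix false X)) (Ψ (fix false X))
                     (δ (Φ ∘ free) X) (δ (Ψ ∘ free) X))
  where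
  interchange : ∀ a b c d e f →
    ((a xor b) xor (c xor d)) xor (e xor f) ≡ ((a xor c) xor e) xor ((b xor d) xor f)
  interchange = solve-∀ 𝔽₂

δ-const : ∀ {L} b (X : Cube L 1) → δ (λ _ → b) X ≡ false
δ-const b (fix _ X) = δ-const b X
δ-const true  (free X) = refl
δ-const false (free X) = refl

δ∘δ : ∀ {L k} (Φ : Cochain L k) X → δ (δ Φ) X ≡ false
δ∘δ             Φ (fix b X) = δ∘δ (Φ ∘ fix b) X
δ∘δ {k = zero}  Φ (free X)  =
  trans (cong ((δ (Φ ∘ fix true) X xor δ (Φ ∘ fix false) X) xor_) (δ-xor (Φ ∘ fix true) (Φ ∘ fix false) X))
        (cancel (δ (Φ ∘ fix true) X xor δ (Φ ∘ fix false) X))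
  where
  cancel : ∀ a → a xor a ≡ false
  cancel = solve-∀ 𝔽₂
δ∘δ {k = suc k} Φ (free X)  =
  trans (cong ((δ (Φ ∘ fix true) X xor δ (Φ ∘ fix false) X) xor_)
              (trans (δ-xor (λ Y → Φ (fix true Y) xor Φ (fix false Y)) (δ (Φ ∘ free)) X)
                     (cong₂ _xor_ (δ-xor (Φ ∘ fix true) (Φ ∘ fix false) X) (δ∘δ (Φ ∘ free) X))))
        (cancel (δ (Φ ∘ fix true) X xor δ (Φ ∘ fix false) X))
  where
  cancel : ∀ a → a xor (a xor false) ≡ false
  cancel = solve-∀ 𝔽₂

leading : ℕ → Bool
leading zero    = true
leading (suc k) = not (leading k)

-- A k-dimensional hemisphere in the sphere of sign vectors with at most k
-- changes: the free coordinates are arbitrary and the sign of each fixed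
-- coordinate is determined by the parity of the number of free ones before it.
Hemisphere : ∀ {L k} → Cube L k → Set
Hemisphere []                = ⊤
Hemisphere {k = k} (fix b X) = b ≡ leading k × Hemisphere X
Hemisphere (free X)          = Hemisphere X

-- A hemisphere has exactly one cube for each choice of the free coordinates, as these determine the
-- fixed signs; the recursion decides whether the last coordinate is free.
∑H : ∀ L k → Cochain L k → Bool
∑H zero    zero    Φ = Φ []
∑H zero    (suc k) Φ = false
∑H (suc L) zero    Φ = ∑H L zero (Φ ∘ fix true)
∑H (suc L) (suc k) Φ = ∑H L (suc k) (Φ ∘ fix (leading (suc k))) xor ∑H L k (Φ ∘ free)

∑H-cong : ∀ L k {Φ Ψ : Cochain L k} → (∀ X → Hemisphere X → Φ X ≡ Ψ X) → ∑H L k Φ ≡ ∑H L k Ψ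
∑H-cong zero    zero    eq = eq [] tt
∑H-cong zero    (suc k) eq = refl
∑H-cong (suc L) zero    eq = ∑H-cong L zero λ X h → eq (fix true X) (refl , h)
∑H-cong (suc L) (suc k) eq =
  cong₂ _xor_ (∑H-cong L (suc k) λ X h → eq _ (refl , h)) (∑H-cong L k λ X h → eq (free X) h)

∑H-xor : ∀ L k (Φ Ψ : Cochain L k) → ∑H L k (λ X → Φ X xor Ψ X) ≡ ∑H L k Φ xor ∑H L k Ψ
∑H-xor zero    zero    Φ Ψ = refl
∑H-xor zero    (suc k) Φ Ψ = refl
∑H-xor (suc L) zero    Φ Ψ = ∑H-xor L zero (Φ ∘ fix true) (Ψ ∘ fix true)
∑H-xor (suc L) (suc k) Φ Ψ =
  trans (cong₂ _xor_ (∑H-xor L (suc k) (Φ ∘ fix _) (Ψ ∘ fix _)) (∑H-xor L k (Φ ∘ free) (Ψ ∘ free)))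
        (interchange (∑H L (suc k) (Φ ∘ fix _)) (∑H L (suc k) (Ψ ∘ fix _)) (∑H L k (Φ ∘ free)) (∑H L k (Ψ ∘ free)))
  where
  interchange : ∀ a b c d → (a xor b) xor (c xor d) ≡ (a xor c) xor (b xor d)
  interchange = solve-∀ 𝔽₂

∑H-false : ∀ L k {Φ : Cochain L k} → (∀ X → Φ X ≡ false) → ∑H L k Φ ≡ false
∑H-false zero    zero    eq = eq []
∑H-false zero    (suc k) eq = refl
∑H-false (suc L) zero    eq = ∑H-false L zero (λ X → eq (fix true X))
∑H-false (suc L) (suc k) eq =
  cong₂ _xor_ (∑H-false L (suc k) (λ X → eq (fix _ X))) (∑H-false L k (λ X → eq (free X)))

-- The boundary of a hemisphere consists of two antipodal hemispheres of one
-- dimension less.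
stokes : ∀ L k (Φ : Cochain L k) → ∑H L (suc k) (δ Φ) ≡ ∑H L k Φ xor ∑H L k (Φ ∘ antipode)
stokes zero zero Φ = sym (cancel (Φ []))
  where
  cancel : ∀ a → a xor a ≡ false
  cancel = solve-∀ 𝔽₂
stokes zero (suc k) Φ = refl
stokes (suc L) zero Φ =
  trans (cong₂ _xor_ (stokes L zero (Φ ∘ fix false)) (∑H-xor L zero (Φ ∘ fix true) (Φ ∘ fix false)))
        (cancel (∑H L zero (Φ ∘ fix false)) (∑H L zero (Φ ∘ fix false ∘ antipode)) (∑H L zero (Φ ∘ fix true)))
  where
  cancel : ∀ a b c → (a xor b) xor (c xor a) ≡ c xor b
  cancel = solve-∀ 𝔽₂
stokes (suc L) (suc k) Φ with leading k
... | b =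
  trans (cong₂ _xor_ (stokes L (suc k) (Φ ∘ fix (not (not b))))
          (trans (∑H-xor L (suc k) (λ X → Φ (fix true X) xor Φ (fix false X)) (δ (Φ ∘ free)))
            (cong₂ _xor_ (trans (∑H-xor L (suc k) (Φ ∘ fix true) (Φ ∘ fix false)) (both b)) (stokes L k (Φ ∘ free)))))
        -- The facets with last sign `not (not b)` arise twice, from cubes in which that coordinate
        -- is fixed and from cubes in which it is free, and cancel.
        (cancel (σ (not (not b))) (∑H L (suc k) (Φ ∘ fix (not (not b)) ∘ antipode)) (σ (not b))
                (∑H L k (Φ ∘ free)) (∑H L k (Φ ∘ free ∘ antipode)))
  where
  σ : Bool → Bool
  σ a = ∑H L (suc k) (Φ ∘ fix a)
  both : ∀ b → σ true xor σ false ≡ σ (not b) xor σ (not (not b))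
  both true  = xor-comm (σ true) (σ false)
  both false = refl
  cancel : ∀ a a′ c f f′ → (a xor a′) xor ((c xor a) xor (f xor f′)) ≡ (c xor f) xor (a′ xor f′)
  cancel = solve-∀ 𝔽₂

-- Cochains modulo two on sets of labels

Functional : ℕ → Set
Functional n = Vec Bool n → Bool

∅ : ∀ {n} → Vec Bool n
∅ = replicate _ false

infixr 7 _⌟_

-- Contraction with a vertex of the full simplex. The value 0 on sets that already contain `i`
-- discards degenerate simplices.
_⌟_ : ∀ {n} → Fin n → Functional n → Functional n
(i ⌟ F) c = if lookup c i then false else F (c [ i ]≔ true)

-- The simplicial coboundary: the sum of the values on the sets with one element removed.
d : ∀ {n} → Functional n → Functional n
d F []          = false
d F (false ∷ c) = d (F ∘ (false ∷_)) c
d F (true  ∷ c) = F (false ∷ c) xor d (F ∘ (true ∷_)) c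

d-false : ∀ {n} (c : Vec Bool n) → d (λ _ → false) c ≡ false
d-false []          = refl
d-false (false ∷ c) = d-false c
d-false (true  ∷ c) = d-false c

d-∅ : ∀ n (F : Functional n) → d F ∅ ≡ false
d-∅ zero    F = refl
d-∅ (suc n) F = d-∅ n (F ∘ (false ∷_))

-- The cone homotopy formula, free of signs modulo two. If `i` is not in `c`, removing `i` again
-- from the enlarged set gives the term `F c`. If it is, both sides vanish: in the coboundary on the
-- right only the removal of `i` itself survives, and it gives a second `F c`.
⌟-d : ∀ {n} (i : Fin n) (F : Functional n) c → (i ⌟ d F) c ≡ F c xor d (i ⌟ F) c
⌟-d zero F (true ∷ c) =
  trans (cancel (F (true ∷ c))) (cong (λ a → F (true ∷ c) xor (F (true ∷ c) xor a)) (sym (d-false c)))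
  where
  cancel : ∀ a → false ≡ a xor (a xor false)
  cancel = solve-∀ 𝔽₂
⌟-d zero    F (false ∷ c) = refl
⌟-d (suc i) F (false ∷ c) = ⌟-d i (F ∘ (false ∷_)) c
⌟-d (suc i) F (true  ∷ c) =
  trans (distrib (lookup c i))
    (trans (cong ((i ⌟ (F ∘ (false ∷_))) c xor_) (⌟-d i (F ∘ (true ∷_)) c))
      (swap ((i ⌟ (F ∘ (false ∷_))) c) (F (true ∷ c)) ((d (i ⌟ (F ∘ (true ∷_)))) c)))
  where
  distrib : ∀ b {x y} → (if b then false else (x xor y)) ≡
                        (if b then false else x) xor (if b then false else y)
  distrib true  = refl
  distrib false = refl
  swap : ∀ a b c → a xor (b xor c) ≡ b xor (a xor c)
  swap = solve-∀ 𝔽₂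

-- A set of labels is a subset of Fin n; the sign of the label i is ε i.
alternates : ∀ {n} → (Fin n → Bool) → Bool → Functional n
alternates ε s []          = true
alternates ε s (false ∷ c) = alternates (ε ∘ suc) s c
alternates ε s (true  ∷ c) = not (ε zero xor s) ∧ alternates (ε ∘ suc) (not s) c

-- The identity behind Ky Fan's lemma.
d-alternates : ∀ {n} (ε : Fin n → Bool) s c →
               d (alternates ε s) c ≡ alternates ε true c xor alternates ε false c
d-alternates ε s []          = refl
d-alternates ε s (false ∷ c) = d-alternates (ε ∘ suc) s c
d-alternates ε s (true  ∷ c) with ε zero | s
... | true  | true  = trans (cong (a true xor_) (d-alternates (ε ∘ suc) false c)) (cancel (a true) (a false))
  where
  a : Bool → Bool
  a s = alternates (ε ∘ suc) s c
  cancel : ∀ x y → x xor (x xor y) ≡ y xor false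
  cancel = solve-∀ 𝔽₂
... | true  | false = cong (alternates (ε ∘ suc) false c xor_) (d-false c)
... | false | true  = trans (cong (alternates (ε ∘ suc) true c xor_) (d-false c)) (xor-identityʳ _)
... | false | false = trans (cong (a false xor_) (d-alternates (ε ∘ suc) true c)) (cancel (a false) (a true))
  where
  a : Bool → Bool
  a s = alternates (ε ∘ suc) s c
  cancel : ∀ x y → x xor (y xor x) ≡ y
  cancel = solve-∀ 𝔽₂

alternates-not : ∀ {n} (ε : Fin n → Bool) s c → alternates (not ∘ ε) s c ≡ alternates ε (not s) c
alternates-not ε s []          = refl
alternates-not ε s (false ∷ c) = alternates-not (ε ∘ suc) s c
alternates-not ε s (true  ∷ c) =
  cong₂ _∧_ (flip (ε zero) s) (alternates-not (ε ∘ suc) (not s) c)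
  where
  flip : ∀ a b → not (not a xor b) ≡ not (a xor not b)
  flip true  true  = refl
  flip true  false = refl
  flip false true  = refl
  flip false false = refl

alternates-local : ∀ {n} (ε ε′ : Fin n → Bool) s c → (∀ i → lookup c i ≡ true → ε i ≡ ε′ i) →
                   alternates ε s c ≡ alternates ε′ s c
alternates-local ε ε′ s []          eq = refl
alternates-local ε ε′ s (false ∷ c) eq = alternates-local _ _ s c (eq ∘ suc)
alternates-local ε ε′ s (true  ∷ c) eq =
  cong₂ _∧_ (cong (λ e → not (e xor s)) (eq zero refl)) (alternates-local _ _ (not s) c (eq ∘ suc))

alternates-∅ : ∀ {n} (ε : Fin n → Bool) s → alternates ε s ∅ ≡ true
alternates-∅ {zero}  ε s = refl
alternates-∅ {suc n} ε s = alternates-∅ (ε ∘ suc) s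

alternates-singleton : ∀ {n} (ε : Fin n → Bool) i → (i ⌟ alternates ε true) ∅ ≡ ε i
alternates-singleton ε i = trans (cong (if_then false else alternates ε true (∅ [ i ]≔ true)) (lookup-replicate i false)) (go ε i)
  where
  go : ∀ {n} (ε : Fin n → Bool) i → alternates ε true (∅ [ i ]≔ true) ≡ ε i
  go ε zero with ε zero
  ... | true  = alternates-∅ (ε ∘ suc) false
  ... | false = refl
  go ε (suc i) = go (ε ∘ suc) i

size : ∀ {n} → Vec Bool n → ℕ
size []          = 0
size (false ∷ c) = size c
size (true  ∷ c) = suc (size c)

size≤n : ∀ {n} (c : Vec Bool n) → size c ℕ.≤ n
size≤n []          = z≤n
size≤n (false ∷ c) = ℕ.m≤n⇒m≤1+n (size≤n c)
size≤n (true  ∷ c) = s≤s (size≤n c)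

size-insert : ∀ {n} (c : Vec Bool n) i → lookup c i ≡ false → size (c [ i ]≔ true) ≡ suc (size c)
size-insert (false ∷ c) zero    eq = refl
size-insert (false ∷ c) (suc i) eq = size-insert c i eq
size-insert (true  ∷ c) (suc i) eq = cong suc (size-insert c i eq)

⌟-xor : ∀ {n} (i : Fin n) (F G : Functional n) c → (i ⌟ (λ c → F c xor G c)) c ≡ (i ⌟ F) c xor (i ⌟ G) c
⌟-xor i F G c with lookup c i
... | true  = refl
... | false = refl

-- Ky Fan's parity argument for antipodal labellings

module Labelled {L n : ℕ} (label : ∀ {k} → Cube L k → Fin n) where

  -- The sum of F over the flags of faces of a cube, where a flag is mapped
  -- to the set of its labels (and contributes 0 if a label is repeated).
  flags : ∀ {k} → Functional n → Cochain L k
  flags {zero}  F X = (label X ⌟ F) ∅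
  flags {suc k} F X = δ (flags (label X ⌟ F)) X

  -- The functional is evaluated only on sets of labels of faces of `X`. This is what allows the
  -- signs at one cube to be exchanged for those at another.
  flags-local : ∀ {k} (P : Fin n → Set) (F G : Functional n) (X : Cube L k) →
                (∀ c → (∀ i → lookup c i ≡ true → P i) → F c ≡ G c) →
                (∀ {j} {Y : Cube L j} → Y ⊑ X → P (label Y)) → flags F X ≡ flags G X
  ⌟-local : (P : Fin n → Set) (F G : Functional n) → (∀ c → (∀ i → lookup c i ≡ true → P i) → F c ≡ G c) →
            ∀ i → P i → ∀ c → (∀ i → lookup c i ≡ true → P i) → (i ⌟ F) c ≡ (i ⌟ G) c
  flags-local {zero} P F G X eq p =
    ⌟-local P F G eq (label X) (p ⊑-refl) ∅ λ i q → ⊥-elim (absurd (trans (sym (lookup-replicate i false)) q))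
    where
    absurd : false ≡ true → ⊥
    absurd ()
  flags-local {suc k} P F G X eq p = δ-cong X λ {Y} Y⊑X →
    flags-local P (label X ⌟ F) (label X ⌟ G) Y (⌟-local P F G eq (label X) (p ⊑-refl))
      λ Z⊑Y → p (⊑-trans Z⊑Y Y⊑X)
  ⌟-local P F G eq i pi c pc = cong (if lookup c i then false else_) (eq (c [ i ]≔ true) pc′)
    where
    pc′ : ∀ j → lookup (c [ i ]≔ true) j ≡ true → P j
    pc′ j q with j Fin.≟ i
    ... | yes refl = pi
    ... | no  j≢i  = pc j (trans (sym (lookup∘update′ j≢i c true)) q)

  flags-cong : ∀ {k} {F G : Functional n} (X : Cube L k) → (∀ c → F c ≡ G c) → flags F X ≡ flags G X
  flags-cong X eq = flags-local (λ _ → ⊤) _ _ X (λ c _ → eq c) (λ _ → tt)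

  flags-xor : ∀ {k} (F G : Functional n) (X : Cube L k) → flags (λ c → F c xor G c) X ≡ flags F X xor flags G X
  flags-xor {zero}  F G X = ⌟-xor (label X) F G ∅
  flags-xor {suc k} F G X =
    trans (δ-cong X λ {Y} _ → trans (flags-cong Y (⌟-xor (label X) F G)) (flags-xor (label X ⌟ F) (label X ⌟ G) Y))
          (δ-xor (flags (label X ⌟ F)) (flags (label X ⌟ G)) X)

  -- A flag of a cube of dimension `k` has `suc k` members, and flags with repeated labels
  -- contribute nothing, so `F` is evaluated on sets of exactly that size.
  flags-vanish : ∀ {k} (F : Functional n) (X : Cube L k) →
                 (∀ c → suc k ℕ.≤ size c → F c ≡ false) → flags F X ≡ false
  ⌟-vanish : ∀ k (F : Functional n) i → (∀ c → suc k ℕ.≤ size c → F c ≡ false) →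
             ∀ c → k ℕ.≤ size c → (i ⌟ F) c ≡ false
  flags-vanish {zero}  F X v = ⌟-vanish 0 F (label X) v ∅ z≤n
  flags-vanish {suc k} F X v = trans
    (δ-cong X λ {Y} _ → flags-vanish (label X ⌟ F) Y (⌟-vanish (suc k) F (label X) v))
    (δ-zero X)
    where
    δ-zero : ∀ {L k} (X : Cube L (suc k)) → δ (λ _ → false) X ≡ false
    δ-zero            (fix b X) = δ-zero X
    δ-zero {k = zero}  (free X) = refl
    δ-zero {k = suc k} (free X) = δ-zero X
  ⌟-vanish k F i v c k≤ with lookup c i in eq
  ... | true  = refl
  ... | false = v (c [ i ]≔ true) (subst (suc k ℕ.≤_) (sym (size-insert c i eq)) (s≤s k≤))

  -- By ⌟-d the labelling induces a chain map.
  δ-flags : ∀ {k} (F : Functional n) (X : Cube L (suc k)) → δ (flags F) X ≡ flags (d F) X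
  δ-flags {k} F X = sym (trans
    (δ-cong X λ {Y} _ → trans (flags-cong Y (⌟-d (label X) F)) (flags-xor F (d (label X ⌟ F)) Y))
    (trans (δ-xor (flags F) (flags (d (label X ⌟ F))) X)
      (trans (cong (δ (flags F) X xor_) (rest k X (label X ⌟ F))) (xor-identityʳ _))))
    where
    rest : ∀ k (X : Cube L (suc k)) G → δ (flags (d G)) X ≡ false
    -- At a vertex the contraction formula on the empty set leaves only `G ∅`, which does not depend
    -- on the vertex; a constant has no coboundary.
    rest zero X G = trans
      (δ-cong X λ {v} _ → trans (⌟-d (label v) G ∅) (trans (cong (G ∅ xor_) (d-∅ n (label v ⌟ G))) (xor-identityʳ _)))
      (δ-const (G ∅) X)
    rest (suc k) X G = trans (δ-cong X λ {Y} _ → sym (δ-flags G Y)) (δ∘δ (flags G) X)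

  module _ (label-antipode : ∀ {k} (X : Cube L k) → label (antipode X) ≡ label X) where

    δ-antipode : ∀ {L k} (Φ : Cochain L k) X → δ Φ (antipode X) ≡ δ (Φ ∘ antipode) X
    δ-antipode             Φ (fix b X) = δ-antipode (Φ ∘ fix (not b)) X
    δ-antipode {k = zero}  Φ (free X)  = xor-comm (Φ (fix true (antipode X))) (Φ (fix false (antipode X)))
    δ-antipode {k = suc k} Φ (free X)  =
      cong₂ _xor_ (xor-comm (Φ (fix true (antipode X))) (Φ (fix false (antipode X)))) (δ-antipode (Φ ∘ free) X)

    flags-antipode : ∀ {k} (F : Functional n) (X : Cube L k) → flags F (antipode X) ≡ flags F X
    flags-antipode {zero}  F X = cong (λ i → (i ⌟ F) ∅) (label-antipode X)
    flags-antipode {suc k} F X = trans (cong (λ i → δ (flags (i ⌟ F)) (antipode X)) (label-antipode X))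
      (trans (δ-antipode (flags (label X ⌟ F)) X) (δ-cong X λ {Y} _ → flags-antipode (label X ⌟ F) Y))

    -- Signs of labels are read off at the top cube of a flag; `coherent` says that any cube in
    -- between gives the same. Both conditions are confined to hemispheres of dimension at most `n`,
    -- where vertices have few sign changes.
    module _ (sign : ∀ {k} → Cube L k → Fin n → Bool)
             (coherent : ∀ {k} {X : Cube L k} → Hemisphere X → k ℕ.≤ n →
                         ∀ {i j} {Y : Cube L i} {Z : Cube L j} → Y ⊑ X → Z ⊑ Y →
                         sign Y (label Z) ≡ sign X (label Z))
             (odd : ∀ {k} {X : Cube L k} → Hemisphere X → k ℕ.≤ n →
                    ∀ {j} {Z : Cube L j} → Z ⊑ X → sign (antipode X) (label Z) ≡ not (sign X (label Z)))
             where

      Φ : ∀ {k} → Cochain L k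
      Φ X = flags (alternates (sign X) true) X

      -- `Φ` counts the flags whose labels, in increasing order, alternate in sign beginning with
      -- plus. By coherence the facets of `X` may all use the signs at `X`; then the coboundary
      -- becomes `d`, which yields the alternating flags of both kinds, and those beginning with
      -- minus are counted at the antipode.
      δΦ : ∀ {k} (X : Cube L (suc k)) → Hemisphere X → suc k ℕ.≤ n → δ Φ X ≡ Φ X xor Φ (antipode X)
      δΦ X h k≤n = begin
        δ Φ X                                                ≡⟨ δ-cong X (λ {Y} Y⊑X → flags-local (λ i → sign Y i ≡ sign X i) (alternates (sign Y) true) (alternates (sign X) true) Y
                                                                  (λ c eq → alternates-local _ _ true c eq)
                                                                  (λ Z⊑Y → coherent h k≤n Y⊑X Z⊑Y)) ⟩
        δ (flags (alternates (sign X) true)) X               ≡⟨ δ-flags (alternates (sign X) true) X ⟩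
        flags (d (alternates (sign X) true)) X               ≡⟨ flags-cong X (d-alternates (sign X) true) ⟩
        flags (λ c → alternates (sign X) true c xor alternates (sign X) false c) X
                                                             ≡⟨ flags-xor (alternates (sign X) true) (alternates (sign X) false) X ⟩
        Φ X xor flags (alternates (sign X) false) X          ≡⟨ cong (Φ X xor_) (flags-cong X (λ c → sym (alternates-not (sign X) true c))) ⟩
        Φ X xor flags (alternates (not ∘ sign X) true) X     ≡⟨ cong (Φ X xor_) (flags-local (λ i → sign (antipode X) i ≡ not (sign X i))
                                                                  (alternates (not ∘ sign X) true) (alternates (sign (antipode X)) true) X
                                                                  (λ c eq → alternates-local _ _ true c (λ i p → sym (eq i p)))
                                                                  (λ Z⊑X → odd h k≤n Z⊑X)) ⟩
        Φ X xor flags (alternates (sign (antipode X)) true) X ≡⟨ cong (Φ X xor_) (sym (flags-antipode (alternates (sign (antipode X)) true) X)) ⟩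
        Φ X xor Φ (antipode X)                               ∎
        where open ≡-Reasoning

      -- The parity of the alternating flags on the whole sphere of dimension `k`. It is the same in
      -- all dimensions up to `n`. In dimension 0 it is odd, since of two antipodal points exactly
      -- one has a positive label; in dimension `n` it is even, since `n + 1` different labels do
      -- not exist.
      α : ℕ → Bool
      α k = ∑H L k Φ xor ∑H L k (Φ ∘ antipode)

      α-step : ∀ k → suc k ℕ.≤ n → α (suc k) ≡ α k
      α-step k k≤n = trans (sym (∑H-xor L (suc k) Φ (Φ ∘ antipode)))
        (trans (∑H-cong L (suc k) (λ X h → sym (δΦ X h k≤n))) (stokes L k Φ))

      α≡true : ∀ k → k ℕ.≤ n → α k ≡ true
      α≡true (suc k) k<n = trans (α-step k k<n) (α≡true k (ℕ.<⇒≤ k<n))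
      α≡true zero    _   = trans (sym (∑H-xor L 0 Φ (Φ ∘ antipode)))
        (trans (∑H-cong L 0 (λ X h → point X h)) (one L))
        where
        point : ∀ X → Hemisphere X → Φ X xor Φ (antipode X) ≡ true
        point X h = trans (cong₂ _xor_ (alternates-singleton (sign X) (label X))
          (trans (alternates-singleton (sign (antipode X)) (label (antipode X)))
            (trans (cong (sign (antipode X)) (label-antipode X)) (odd h z≤n ⊑-refl))))
          (excluded (sign X (label X)))
          where
          excluded : ∀ b → b xor not b ≡ true
          excluded true  = refl
          excluded false = refl
        one : ∀ L → ∑H L 0 (λ _ → true) ≡ true
        one zero    = refl
        one (suc L) = one L

      α-n : α n ≡ false
      α-n = cong₂ _xor_ (∑H-false L n vanish) (∑H-false L n (λ X → vanish (antipode X)))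
        where
        vanish : ∀ (X : Cube L n) → Φ X ≡ false
        vanish X = flags-vanish (alternates (sign X) true) X λ c n<c → ⊥-elim (ℕ.<⇒≱ n<c (size≤n c))

      tucker : ⊥
      tucker with () ← trans (sym α-n) (α≡true n ℕ.≤-refl)

-- Rounding to a coarse grid

differs-refl : ∀ b → differs b b ≡ 0
differs-refl true  = refl
differs-refl false = refl

differs-triangle : ∀ a b c → differs a c ℕ.≤ differs b c ℕ.+ differs a b
differs-triangle true  true  true  = z≤n
differs-triangle true  true  false = s≤s z≤n
differs-triangle true  false true  = z≤n
differs-triangle true  false false = s≤s z≤n
differs-triangle false true  true  = s≤s z≤n
differs-triangle false true  false = z≤n
differs-triangle false false true  = s≤s z≤n
differs-triangle false false false = z≤n

changes-+ : ∀ s a k → changes s (suc a) ℕ.+ differs (s (a ℕ.+ k)) (s a) ℕ.≤ changes s (suc (a ℕ.+ k))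
changes-+ s a zero rewrite ℕ.+-identityʳ a | differs-refl (s a) = ℕ.≤-reflexive (ℕ.+-identityʳ _)
changes-+ s a (suc k) rewrite ℕ.+-suc a k = begin
  changes s (suc a) ℕ.+ differs (s (suc (a ℕ.+ k))) (s a)
    ≤⟨ ℕ.+-monoʳ-≤ (changes s (suc a)) (differs-triangle (s (suc (a ℕ.+ k))) (s (a ℕ.+ k)) (s a)) ⟩
  changes s (suc a) ℕ.+ (differs (s (a ℕ.+ k)) (s a) ℕ.+ differs (s (suc (a ℕ.+ k))) (s (a ℕ.+ k)))
    ≡⟨ sym (ℕ.+-assoc (changes s (suc a)) _ _) ⟩
  changes s (suc a) ℕ.+ differs (s (a ℕ.+ k)) (s a) ℕ.+ differs (s (suc (a ℕ.+ k))) (s (a ℕ.+ k))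
    ≤⟨ ℕ.+-monoˡ-≤ _ (changes-+ s a k) ⟩
  changes s (suc (a ℕ.+ k)) ℕ.+ differs (s (suc (a ℕ.+ k))) (s (a ℕ.+ k)) ∎
  where open ℕ.≤-Reasoning

changes-≤ : ∀ s {a b} → a ℕ.≤ b → changes s (suc a) ℕ.+ differs (s b) (s a) ℕ.≤ changes s (suc b)
changes-≤ s {a} {b} a≤b = subst (λ b → changes s (suc a) ℕ.+ differs (s b) (s a) ℕ.≤ changes s (suc b))
  (ℕ.m+[n∸m]≡n a≤b) (changes-+ s a (b ℕ.∸ a))

changes-cong : ∀ {s t} k → (∀ j → j ℕ.< k → s j ≡ t j) → changes s k ≡ changes t k
changes-cong zero          eq = refl
changes-cong (suc zero)    eq = refl
changes-cong (suc (suc k)) eq = cong₂ ℕ._+_ (changes-cong (suc k) (λ j j<k → eq j (ℕ.m<n⇒m<1+n j<k)))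
  (cong₂ differs (eq (suc k) ℕ.≤-refl) (eq k (s≤s (ℕ.n≤1+n k))))

occurs? : ∀ (s : ℕ → Bool) b k → (∃[ j ] j ℕ.< k × s j ≡ b) ⊎ (∀ j → j ℕ.< k → s j ≡ not b)
occurs? s b zero = inj₂ λ _ ()
occurs? s b (suc k) with s k Bool.≟ b | occurs? s b k
... | yes eq | _                    = inj₁ (k , ℕ.≤-refl , eq)
... | no  _  | inj₁ (j , j<k , eq)  = inj₁ (j , ℕ.m<n⇒m<1+n j<k , eq)
... | no neq | inj₂ none            = inj₂ λ j j<1+k → case (ℕ.m<1+n⇒m<n∨m≡n j<1+k)
  where
  case : ∀ {j} → j ℕ.< k ⊎ j ≡ k → s j ≡ not b
  case (inj₁ j<k)  = none _ j<k
  case (inj₂ refl) = Bool.¬-not neq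

-- Greedy rounding to a coarser grid: a cell of length δ = m γ gets the sign
-- that keeps the accumulated discrepancy between -δ and δ.  This sign always
-- occurs in the cell, so the number of sign changes does not grow.
module Rounding (N m : ℕ) (δ γ : ℚ) (0<γ : 0ℚ < γ) (0<δ : 0ℚ < δ) (δ≡mγ : fromℕ m * γ ≡ δ) (s : ℕ → Bool) where

  g : ℕ → ℚ
  g = grid γ

  fine : ℕ → ℕ → Bool
  fine z j = s (z ℕ.* m ℕ.+ j)

  average : ℕ → ℚ
  average z = ∑ m (λ j → sgn (fine z j) * γ)

  choose : ℚ → ℚ → Bool
  choose e t with e ≤? t
  ... | yes _ = true
  ... | no  _ = false

  data Choice (e t : ℚ) : Bool → Set where
    plus  : e ≤ t → Choice e t true
    minus : t < e → Choice e t false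

  choice : ∀ e t → Choice e t (choose e t)
  choice e t with e ≤? t
  ... | yes e≤t = plus e≤t
  ... | no  e≰t = minus (≰⇒> e≰t)

  excess : ℕ → ℚ
  excess zero    = 0ℚ
  excess (suc z) = excess z + (sgn (choose (excess z) (average z)) * δ - average z)

  rounded : ℕ → Bool
  rounded z = choose (excess z) (average z)

  constant-average : ∀ z b → (∀ j → j ℕ.< m → fine z j ≡ b) → average z ≡ sgn b * δ
  constant-average z b eq = trans (∑-cong m (λ j j<m → cong (λ b → sgn b * γ) (eq j j<m)))
    (trans (∑-const m (sgn b * γ)) (trans (swap (fromℕ m) (sgn b) γ) (cong (sgn b *_) δ≡mγ)))
    where
    swap : ∀ a b c → a * (b * c) ≡ b * (a * c)
    swap = solve-∀ ℚ-ring

  average-bounds : ∀ z → Within δ (average z)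
  average-bounds z = subst (_≤ average z) (trans (∑-const m (- γ)) (trans (sym (neg-distribʳ-* (fromℕ m) γ)) (cong -_ δ≡mγ)))
                       (∑-mono m λ j _ → proj₁ (term (fine z j)))
                   , subst (average z ≤_) (trans (∑-const m γ) δ≡mγ) (∑-mono m λ j _ → proj₂ (term (fine z j)))
    where
    term : ∀ b → Within γ (sgn b * γ)
    term true  = subst (Within γ) (sym (*-identityˡ γ)) (≤-trans (neg-antimono-≤ (<⇒≤ 0<γ)) (<⇒≤ 0<γ) , ≤-refl)
    term false = subst (Within γ) (trans (cong -_ (sym (*-identityˡ γ))) (neg-distribˡ-* 1ℚ γ))
                   (≤-refl , ≤-trans (neg-antimono-≤ (<⇒≤ 0<γ)) (<⇒≤ 0<γ))

  -- The lower bound is strict because ties are decided in favour of plus; without strictness a plus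
  -- could be chosen in a cell on which `s` is constantly minus.
  excess-bounds : ∀ z → - δ < excess z × excess z ≤ δ
  excess-bounds zero    = neg-antimono-< 0<δ , <⇒≤ 0<δ
  excess-bounds (suc z) = step (excess z) (average z) (choice (excess z) (average z)) (excess-bounds z) (average-bounds z)
    where
    step : ∀ e t {b} → Choice e t b → - δ < e × e ≤ δ → Within δ t →
           - δ < e + (sgn b * δ - t) × e + (sgn b * δ - t) ≤ δ
    step e t (plus e≤t) (lo , hi) (tlo , thi) =
        <-from-difference ((e - - δ) + (δ - t)) (+-mono-<-≤ (0<q-p lo) (0≤q-p thi)) (id₁ e t δ)
      , ≤-from-difference (t - e) (0≤q-p e≤t) (id₂ e t δ)
      where
      id₁ : ∀ e t δ → - δ + ((e - - δ) + (δ - t)) ≡ e + (1ℚ * δ - t)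
      id₁ = solve-∀ ℚ-ring
      id₂ : ∀ e t δ → (e + (1ℚ * δ - t)) + (t - e) ≡ δ
      id₂ = solve-∀ ℚ-ring
    step e t (minus t<e) (lo , hi) (tlo , thi) =
        <-from-difference (e - t) (0<q-p t<e) (id₁ e t δ)
      , ≤-from-difference ((δ - e) + (t - - δ)) (0≤p+q (0≤q-p hi) (0≤q-p tlo)) (id₂ e t δ)
      where
      id₁ : ∀ e t δ → - δ + (e - t) ≡ e + (- 1ℚ * δ - t)
      id₁ = solve-∀ ℚ-ring
      id₂ : ∀ e t δ → (e + (- 1ℚ * δ - t)) + ((δ - e) + (t - - δ)) ≡ δ
      id₂ = solve-∀ ℚ-ring

  excess-Within : ∀ z → Within δ (excess z)
  excess-Within z = <⇒≤ (proj₁ (excess-bounds z)) , proj₂ (excess-bounds z)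

  -- If the chosen sign did not occur, the integral over the cell would be the extreme value of the
  -- opposite sign, and `excess-bounds` would have forced the other choice.
  rounded-occurs : ∀ z → ∃[ j ] j ℕ.< m × fine z j ≡ rounded z
  rounded-occurs z = from (choice (excess z) (average z)) (excess-bounds z) (occurs? (fine z) (rounded z) m)
    where
    from : ∀ {b} → Choice (excess z) (average z) b → - δ < excess z × excess z ≤ δ →
           (∃[ j ] j ℕ.< m × fine z j ≡ b) ⊎ (∀ j → j ℕ.< m → fine z j ≡ not b) → ∃[ j ] j ℕ.< m × fine z j ≡ b
    from _ _ (inj₁ p) = p
    from (plus e≤t) (lo , hi) (inj₂ none) = ⊥-elim (<-irrefl refl (<-≤-trans lo
      (subst (excess z ≤_) (trans (constant-average z false none)
        (trans (sym (neg-distribˡ-* 1ℚ δ)) (cong -_ (*-identityˡ δ)))) e≤t)))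
    from (minus t<e) (lo , hi) (inj₂ none) = ⊥-elim (<-irrefl refl (<-≤-trans t<e
      (subst (excess z ≤_) (sym (trans (constant-average z true none) (*-identityˡ δ))) hi)))

  sample : ℕ → ℕ
  sample z = z ℕ.* m ℕ.+ proj₁ (rounded-occurs z)

  s-sample : ∀ z → s (sample z) ≡ rounded z
  s-sample z = proj₂ (proj₂ (rounded-occurs z))

  sample< : ∀ z → sample z ℕ.< suc z ℕ.* m
  sample< z = subst (sample z ℕ.<_) (ℕ.+-comm (z ℕ.* m) m)
                    (ℕ.+-monoʳ-< (z ℕ.* m) (proj₁ (proj₂ (rounded-occurs z))))

  -- Picking from every coarse cell one fine cell with the chosen sign exhibits `rounded` as a
  -- subsequence of `s`, and a subsequence has no more changes.
  rounded-changes-sample : ∀ z → changes rounded (suc z) ℕ.≤ changes s (suc (sample z))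
  rounded-changes-sample zero    = z≤n
  rounded-changes-sample (suc z) = ℕ.≤-trans
    (ℕ.+-mono-≤ (rounded-changes-sample z) (ℕ.≤-reflexive (cong₂ differs (sym (s-sample (suc z))) (sym (s-sample z)))))
    (changes-≤ s (ℕ.≤-trans (ℕ.<⇒≤ (sample< z)) (ℕ.m≤m+n (suc z ℕ.* m) (proj₁ (rounded-occurs (suc z))))))

  rounded-changes : changes rounded N ℕ.≤ changes s (N ℕ.* m)
  rounded-changes = go N
    where
    go : ∀ N → changes rounded N ℕ.≤ changes s (N ℕ.* m)
    go zero    = z≤n
    go (suc z) with suc z ℕ.* m | sample< z
    ... | suc k | s≤s le = ℕ.≤-trans (rounded-changes-sample z) (ℕ.≤-trans (ℕ.m≤m+n _ _) (changes-≤ s le))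

  grid-m : ∀ z → grid δ z ≡ g (z ℕ.* m)
  grid-m z = trans (cong (fromℕ z *_) (sym δ≡mγ)) (trans (sym (*-assoc (fromℕ z) (fromℕ m) γ)) (cong (_* γ) (sym (fromℕ-* z m))))

  -- The integral of the sign function up to `x`. A block is the difference of two such ranges, so
  -- its error will be at most twice the error for a single end point.
  integral-rounded : ℚ → ℚ
  integral-rounded x = ∑ N (λ z → sgn (rounded z) * (x ⊓ grid δ (suc z) - x ⊓ grid δ z))

  integral-fine : ℚ → ℚ
  integral-fine x = ∑ (N ℕ.* m) (λ j → sgn (s j) * (x ⊓ g (suc j) - x ⊓ g j))

  increment : ℚ → ℕ → ℕ → ℚ
  increment x z j = x ⊓ g (suc (z ℕ.* m ℕ.+ j)) - x ⊓ g (z ℕ.* m ℕ.+ j)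

  discrepancy : ℚ → ℕ → ℚ
  discrepancy x z = ∑ m (λ j → (sgn (rounded z) - sgn (fine z j)) * increment x z j)

  ∑-increment : ∀ x z → ∑ m (increment x z) ≡ x ⊓ grid δ (suc z) - x ⊓ grid δ z
  ∑-increment x z = trans
    (trans (∑-cong m (λ j _ → cong (λ k → x ⊓ g k - x ⊓ g (z ℕ.* m ℕ.+ j)) (sym (ℕ.+-suc (z ℕ.* m) j))))
           (∑-telescope m (λ j → x ⊓ g (z ℕ.* m ℕ.+ j))))
    (cong₂ (λ p q → x ⊓ p - x ⊓ q)
      (trans (cong g (ℕ.+-comm (z ℕ.* m) m)) (sym (grid-m (suc z))))
      (trans (cong g (ℕ.+-identityʳ (z ℕ.* m))) (sym (grid-m z))))

  integral-difference : ∀ x → integral-rounded x - integral-fine x ≡ ∑ N (discrepancy x)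
  integral-difference x = sym (trans (∑-cong N (λ z _ → split z)) (trans
    (∑-minus N (λ z → sgn (rounded z) * (x ⊓ grid δ (suc z) - x ⊓ grid δ z))
               (λ z → ∑ m (λ j → sgn (fine z j) * increment x z j)))
    (cong (λ y → integral-rounded x - y) (sym (∑-blocks N m (λ j → sgn (s j) * (x ⊓ g (suc j) - x ⊓ g j)))))))
    where
    split : ∀ z → discrepancy x z ≡ sgn (rounded z) * (x ⊓ grid δ (suc z) - x ⊓ grid δ z) - ∑ m (λ j → sgn (fine z j) * increment x z j)
    split z = trans (∑-cong m (λ j _ → distrib (sgn (rounded z)) (sgn (fine z j)) (increment x z j)))
      (trans (∑-minus m (λ j → sgn (rounded z) * increment x z j) (λ j → sgn (fine z j) * increment x z j))
        (cong (λ y → y - ∑ m (λ j → sgn (fine z j) * increment x z j))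
          (trans (∑-*ˡ m (sgn (rounded z)) (increment x z)) (cong (sgn (rounded z) *_) (∑-increment x z)))))
      where
      distrib : ∀ a b c → (a - b) * c ≡ a * c - b * c
      distrib = solve-∀ ℚ-ring

  g-step : ∀ j → g j ≤ g (suc j)
  g-step j = grid-mono (<⇒≤ 0<γ) (ℕ.n≤1+n j)

  g-difference : ∀ j → g (suc j) - g j ≡ γ
  g-difference j = trans (cong (_- g j) (grid-suc γ j)) (cancel (g j) γ)
    where
    cancel : ∀ a b → (a + b) - a ≡ b
    cancel = solve-∀ ℚ-ring

  increment-bounds : ∀ x z j → 0ℚ ≤ increment x z j × increment x z j ≤ γ
  increment-bounds x z j = ⊓-increment-lower x (g-step (z ℕ.* m ℕ.+ j))
    , subst (increment x z j ≤_) (g-difference (z ℕ.* m ℕ.+ j)) (⊓-increment-upper x (g-step (z ℕ.* m ℕ.+ j)))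

  full : ∀ z → ∑ m (λ j → (sgn (rounded z) - sgn (fine z j)) * γ) ≡ sgn (rounded z) * δ - average z
  full z = trans (∑-cong m (λ j _ → distrib (sgn (rounded z)) (sgn (fine z j)) γ))
    (trans (∑-minus m (λ j → sgn (rounded z) * γ) (λ j → sgn (fine z j) * γ))
      (cong (λ y → y - average z) (trans (∑-*ˡ m (sgn (rounded z)) (λ _ → γ))
        (cong (sgn (rounded z) *_) (trans (∑-const m γ) δ≡mγ)))))
    where
    distrib : ∀ a b c → (a - b) * c ≡ a * c - b * c
    distrib = solve-∀ ℚ-ring

  Between : ℚ → ℚ → ℚ → Set
  Between p q x = (p ≤ x × x ≤ q) ⊎ (q ≤ x × x ≤ p)

  -- Inside a cell the discrepancy is monotone.
  ∑-between : ∀ b (t : ℕ → Bool) (f : ℕ → ℚ) → (∀ j → 0ℚ ≤ f j × f j ≤ γ) →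
    Between 0ℚ (∑ m (λ j → (sgn b - sgn (t j)) * γ)) (∑ m (λ j → (sgn b - sgn (t j)) * f j))
  ∑-between true t f bounds = inj₁
    ( subst (_≤ ∑ m (λ j → (1ℚ - sgn (t j)) * f j)) (∑-zero m {λ _ → 0ℚ} (λ _ _ → refl))
        (∑-mono m λ j _ → 0≤p*q (coefficient (t j)) (proj₁ (bounds j)))
    , ∑-mono m λ j _ → *-monoˡ-≤-nonNeg (1ℚ - sgn (t j)) {{nonNegative (coefficient (t j))}} (proj₂ (bounds j)))
    where
    coefficient : ∀ b → 0ℚ ≤ 1ℚ - sgn b
    coefficient true  = ≤-refl
    coefficient false = nonNegative⁻¹ (1ℚ - - 1ℚ)
  ∑-between false t f bounds = inj₂
    ( (∑-mono m λ j _ → *-monoˡ-≤-nonPos (- 1ℚ - sgn (t j)) {{nonPositive (coefficient (t j))}} (proj₂ (bounds j)))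
    , subst (∑ m (λ j → (- 1ℚ - sgn (t j)) * f j) ≤_) (∑-zero m {λ _ → 0ℚ} (λ _ _ → refl))
        (∑-mono m λ j _ → subst ((- 1ℚ - sgn (t j)) * f j ≤_) (*-zeroʳ (- 1ℚ - sgn (t j)))
          (*-monoˡ-≤-nonPos (- 1ℚ - sgn (t j)) {{nonPositive (coefficient (t j))}} (proj₁ (bounds j)))))
    where
    coefficient : ∀ b → - 1ℚ - sgn b ≤ 0ℚ
    coefficient true  = nonPositive⁻¹ (- 1ℚ - 1ℚ)
    coefficient false = ≤-refl

  discrepancy-between : ∀ x z → Between 0ℚ (sgn (rounded z) * δ - average z) (discrepancy x z)
  discrepancy-between x z = subst (λ c → Between 0ℚ c (discrepancy x z)) (full z)
    (∑-between (rounded z) (fine z) (increment x z) (increment-bounds x z))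

  Within-between : ∀ {e c x} → Within δ e → Within δ (e + c) → Between 0ℚ c x → Within δ (e + x)
  Within-between {e} {c} {x} (l , h) (l′ , h′) (inj₁ (p , q)) =
    ≤-trans l (subst (_≤ e + x) (+-identityʳ e) (+-monoʳ-≤ e p)) , ≤-trans (+-monoʳ-≤ e q) h′
  Within-between {e} {c} {x} (l , h) (l′ , h′) (inj₂ (p , q)) =
    ≤-trans l′ (+-monoʳ-≤ e p) , ≤-trans (subst (e + x ≤_) (+-identityʳ e) (+-monoʳ-≤ e q)) h

  discrepancy-full : ∀ x z → grid δ (suc z) ≤ x → discrepancy x z ≡ sgn (rounded z) * δ - average z
  discrepancy-full x z G≤x = trans
    (∑-cong m (λ j j<m → cong ((sgn (rounded z) - sgn (fine z j)) *_)
      (trans (⊓-increment-before (g-step (z ℕ.* m ℕ.+ j)) (≤-trans (end j j<m) G≤x)) (g-difference (z ℕ.* m ℕ.+ j)))))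
    (full z)
    where
    end : ∀ j → j ℕ.< m → g (suc (z ℕ.* m ℕ.+ j)) ≤ grid δ (suc z)
    end j j<m = subst (g (suc (z ℕ.* m ℕ.+ j)) ≤_) (sym (grid-m (suc z))) (grid-mono (<⇒≤ 0<γ)
      (subst (suc (z ℕ.* m ℕ.+ j) ℕ.≤_) (ℕ.+-comm (z ℕ.* m) m) (ℕ.+-monoʳ-< (z ℕ.* m) j<m)))

  discrepancy-empty : ∀ x z → x ≤ grid δ z → discrepancy x z ≡ 0ℚ
  discrepancy-empty x z x≤G = ∑-zero m λ j _ → trans (cong ((sgn (rounded z) - sgn (fine z j)) *_)
    (⊓-increment-after (g-step (z ℕ.* m ℕ.+ j)) (≤-trans x≤G (subst (_≤ g (z ℕ.* m ℕ.+ j)) (sym (grid-m z))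
      (grid-mono (<⇒≤ 0<γ) (ℕ.m≤m+n (z ℕ.* m) j)))))) (*-zeroʳ (sgn (rounded z) - sgn (fine z j)))

  -- Cells left of `x` contribute in full and reproduce `excess`; cells right of `x` contribute
  -- nothing. In the cell of `x` the partial contribution lies between nothing and the full one,
  -- hence the sum lies between two consecutive excesses. The equation is carried along to make this
  -- induction possible.
  accumulated : ∀ x z → Within δ (∑ z (discrepancy x)) × (grid δ z ≤ x → ∑ z (discrepancy x) ≡ excess z)
  accumulated x zero = excess-Within zero , λ _ → refl
  accumulated x (suc z) = step (accumulated x z) (≤-total (grid δ z) x)
    where
    D : ℚ
    D = ∑ z (discrepancy x)
    step : Within δ D × (grid δ z ≤ x → D ≡ excess z) → grid δ z ≤ x ⊎ x ≤ grid δ z →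
           Within δ (D + discrepancy x z) × (grid δ (suc z) ≤ x → D + discrepancy x z ≡ excess (suc z))
    step (w , eq) (inj₁ G≤x) =
        subst (λ e → Within δ (e + discrepancy x z)) (sym (eq G≤x))
          (Within-between (excess-Within z) (excess-Within (suc z)) (discrepancy-between x z))
      , λ G′≤x → cong₂ _+_ (eq G≤x) (discrepancy-full x z G′≤x)
    step (w , eq) (inj₂ x≤G) =
        subst (Within δ) (sym (trans (cong (D +_) (discrepancy-empty x z x≤G)) (+-identityʳ D))) w
      , λ G′≤x → ⊥-elim (<-irrefl refl (<-≤-trans (grid-strict 0<δ (ℕ.n<1+n z)) (≤-trans G′≤x x≤G)))

  rounding-error : ∀ x → Within δ (integral-rounded x - integral-fine x)
  rounding-error x = subst (Within δ) (sym (integral-difference x)) (proj₁ (accumulated x N))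

-- Existence of balanced sign sequences

-- The linear form with coefficients `w`, evaluated at the centre of the cube: free coordinates
-- count as 0.
⟪_⟫ : ∀ {L k} → Cube L k → (ℕ → ℚ) → ℚ
⟪ []          ⟫ w = 0ℚ
⟪ fix {L} b X ⟫ w = ⟪ X ⟫ w + sgn b * w L
⟪ free X      ⟫ w = ⟪ X ⟫ w

⟪⟫-antipode : ∀ {L k} (X : Cube L k) w → ⟪ antipode X ⟫ w ≡ - ⟪ X ⟫ w
⟪⟫-antipode []              w = refl
⟪⟫-antipode (fix {L} b X) w = trans (cong₂ (λ p q → p + q * w L) (⟪⟫-antipode X w) (sgn-not b))
  (step (⟪ X ⟫ w) (sgn b) (w L))
  where
  step : ∀ x b w → - x + - b * w ≡ - (x + b * w)
  step = solve-∀ ℚ-ring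
⟪⟫-antipode (free X)        w = ⟪⟫-antipode X w

sgn-Within : ∀ b {c w} → 0ℚ ≤ w → w ≤ c → Within c (sgn b * w)
sgn-Within true  {c} {w} 0≤w w≤c = subst (Within c) (sym (*-identityˡ w))
  (≤-trans (neg-antimono-≤ (≤-trans 0≤w w≤c)) 0≤w , w≤c)
sgn-Within false {c} {w} 0≤w w≤c = subst (Within c) (trans (cong -_ (sym (*-identityˡ w))) (neg-distribˡ-* 1ℚ w))
  (Within-neg (≤-trans (neg-antimono-≤ (≤-trans 0≤w w≤c)) 0≤w , w≤c))

-- Passing to a face moves at most `k` coordinates from 0 to a sign, each of which changes the value
-- by at most `c`.
⟪⟫-face : ∀ {L j k} {Y : Cube L j} {X : Cube L k} {c} w → (∀ j → 0ℚ ≤ w j × w j ≤ c) → Y ⊑ X →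
          Within (fromℕ k * c) (⟪ Y ⟫ w - ⟪ X ⟫ w)
⟪⟫-face {c = c} w bounds [] = subst (λ p → Within p 0ℚ) (sym (*-zeroˡ c)) (≤-refl , ≤-refl)
⟪⟫-face {k = k} {c = c} w bounds (fix {L = L} {b = b} {Y} {X} Y⊑X) =
  subst (Within (fromℕ k * c)) (cancel (⟪ Y ⟫ w) (⟪ X ⟫ w) (sgn b * w L)) (⟪⟫-face w bounds Y⊑X)
  where
  cancel : ∀ y x a → y - x ≡ (y + a) - (x + a)
  cancel = solve-∀ ℚ-ring
⟪⟫-face {k = suc k} {c = c} w bounds (free Y⊑X) =
  Within-mono (*-monoʳ-≤-nonNeg c {{nonNegative (≤-trans (proj₁ (bounds 0)) (proj₂ (bounds 0)))}} (fromℕ-mono-≤ (ℕ.n≤1+n k)))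
    (⟪⟫-face w bounds Y⊑X)
⟪⟫-face {k = suc k} {c = c} w bounds (inner {L = L} {b = b} {Y} {X} Y⊑X) =
  subst₂ Within (trans (cong (fromℕ k * c +_) (sym (*-identityˡ c)))
                       (trans (sym (*-distribʳ-+ c (fromℕ k) 1ℚ)) (cong (_* c) (sym (fromℕ-suc′ k)))))
         (swap (⟪ Y ⟫ w) (⟪ X ⟫ w) (sgn b * w L))
         (Within-+ (⟪⟫-face w bounds Y⊑X) (sgn-Within b (proj₁ (bounds L)) (proj₂ (bounds L))))
  where
  swap : ∀ y x a → (y - x) + a ≡ (y + a) - x
  swap = solve-∀ ℚ-ring

dimension : ∀ {L j k} {Z : Cube L j} {X : Cube L k} → Z ⊑ X → j ℕ.≤ k
dimension []        = z≤n
dimension (fix p)   = dimension p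
dimension (free p)  = s≤s (dimension p)
dimension (inner p) = ℕ.m≤n⇒m≤1+n (dimension p)

vertex : ∀ {L k} (X : Cube L k) → ∃[ v ] (_⊑_ {L} {0} v X)
vertex []        = [] , []
vertex (fix b X) = fix b (proj₁ (vertex X)) , fix (proj₂ (vertex X))
vertex (free X)  = fix true (proj₁ (vertex X)) , inner (proj₂ (vertex X))

signs : ∀ {L} → Cube L 0 → ℕ → Bool
signs []            j = true
signs (fix {L} b v) j with j ℕ.≟ L
... | yes _ = b
... | no  _ = signs v j

signs-last : ∀ {L} b (v : Cube L 0) → signs (fix b v) L ≡ b
signs-last {L} b v with L ℕ.≟ L
... | yes _   = refl
... | no  L≢L = ⊥-elim (L≢L refl)

signs-init : ∀ {L} b (v : Cube L 0) {j} → j ℕ.< L → signs (fix b v) j ≡ signs v j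
signs-init {L} b v {j} j<L with j ℕ.≟ L
... | yes refl = ⊥-elim (ℕ.<-irrefl refl j<L)
... | no  _    = refl

⟪⟫-signs : ∀ {L} (v : Cube L 0) w → ⟪ v ⟫ w ≡ ∑ L (λ j → sgn (signs v j) * w j)
⟪⟫-signs []            w = refl
⟪⟫-signs (fix {L} b v) w = cong₂ _+_
  (trans (⟪⟫-signs v w) (∑-cong L λ j j<L → cong (λ b → sgn b * w j) (sym (signs-init b v j<L))))
  (cong (λ b → sgn b * w L) (sym (signs-last b v)))

last : ∀ {L} → Cube L 0 → Bool
last []        = true
last (fix b v) = b

-- Counts changes as if a plus sign stood in front, by the default of `last`. The hemispheres also
-- begin with plus, which makes the parity argument uniform.
changes⁺ : ∀ {L} → Cube L 0 → ℕ
changes⁺ []        = 0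
changes⁺ (fix b v) = changes⁺ v ℕ.+ differs b (last v)

changes-signs : ∀ {L} (v : Cube L 0) → changes (signs v) L ℕ.≤ changes⁺ v
changes-signs []                        = z≤n
changes-signs (fix b [])                = z≤n
changes-signs (fix {suc L} b v@(fix b′ v′)) = ℕ.+-mono-≤
  (ℕ.≤-trans (ℕ.≤-reflexive (changes-cong (suc L) (λ j j<L → signs-init b v j<L))) (changes-signs v))
  (ℕ.≤-reflexive (cong₂ differs (signs-last b v) (trans (signs-init b v ℕ.≤-refl) (signs-last b′ v′))))

-- If the last sign is not the expected one then there are fewer than k
-- changes, by parity.
changes-hemisphere : ∀ {L k} {v : Cube L 0} {X : Cube L k} → v ⊑ X → Hemisphere X →
                     changes⁺ v ℕ.+ differs (last v) (leading k) ℕ.≤ k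
changes-hemisphere [] h = z≤n
changes-hemisphere {k = k} (fix {X = v} v⊑X) (refl , h)
  rewrite differs-refl (leading k) | ℕ.+-identityʳ (changes⁺ v ℕ.+ differs (leading k) (last v)) =
  subst (λ d → changes⁺ v ℕ.+ d ℕ.≤ k) (differs-comm (last v) (leading k)) (changes-hemisphere v⊑X h)
  where
  differs-comm : ∀ a b → differs a b ≡ differs b a
  differs-comm true  true  = refl
  differs-comm true  false = refl
  differs-comm false true  = refl
  differs-comm false false = refl
changes-hemisphere {k = suc k} (inner {b = b} {v} v⊑X) h = begin
  changes⁺ v ℕ.+ differs b (last v) ℕ.+ differs b (not (leading k))
    ≡⟨ ℕ.+-assoc (changes⁺ v) _ _ ⟩
  changes⁺ v ℕ.+ (differs b (last v) ℕ.+ differs b (not (leading k)))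
    ≤⟨ ℕ.+-monoʳ-≤ (changes⁺ v) (parity b (last v) (leading k)) ⟩
  changes⁺ v ℕ.+ suc (differs (last v) (leading k))
    ≡⟨ ℕ.+-suc (changes⁺ v) _ ⟩
  suc (changes⁺ v ℕ.+ differs (last v) (leading k))
    ≤⟨ s≤s (changes-hemisphere v⊑X h) ⟩
  suc k ∎
  where
  open ℕ.≤-Reasoning
  parity : ∀ b a e → differs b a ℕ.+ differs b (not e) ℕ.≤ suc (differs a e)
  parity true  true  true  = s≤s z≤n
  parity true  true  false = z≤n
  parity true  false true  = s≤s (s≤s z≤n)
  parity true  false false = s≤s z≤n
  parity false true  true  = s≤s z≤n
  parity false true  false = s≤s (s≤s z≤n)
  parity false false true  = z≤n
  parity false false false = s≤s z≤n

isPositive : ℚ → Bool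
isPositive p with 0ℚ <? p
... | yes _ = true
... | no  _ = false

isPositive-true : ∀ {p} → 0ℚ < p → isPositive p ≡ true
isPositive-true {p} 0<p with 0ℚ <? p
... | yes _  = refl
... | no  ≮ = ⊥-elim (≮ 0<p)

isPositive-false : ∀ {p} → p < 0ℚ → isPositive p ≡ false
isPositive-false {p} p<0 with 0ℚ <? p
... | yes 0<p = ⊥-elim (<-asym p<0 0<p)
... | no  _   = refl

module _ {θ : ℚ} where

  -- The last index is returned untested, which keeps the function total; it is large whenever some
  -- index is and no earlier one has been found.
  firstLarge : ∀ {n} → (Fin (suc n) → ℚ) → Fin (suc n)
  firstLarge {zero}  f = zero
  firstLarge {suc n} f with θ <? f zero
  ... | yes _ = zero
  ... | no  _ = suc (firstLarge (f ∘ suc))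

  firstLarge-cong : ∀ {n} {f g : Fin (suc n) → ℚ} → (∀ i → f i ≡ g i) → firstLarge f ≡ firstLarge g
  firstLarge-cong {zero}          eq = refl
  firstLarge-cong {suc n} {f} {g} eq with θ <? f zero | θ <? g zero
  ... | yes _ | yes _  = refl
  ... | yes p | no  ¬q = ⊥-elim (¬q (subst (θ <_) (eq zero) p))
  ... | no ¬p | yes q  = ⊥-elim (¬p (subst (θ <_) (sym (eq zero)) q))
  ... | no  _ | no  _  = cong suc (firstLarge-cong (λ i → eq (suc i)))

  firstLarge-large : ∀ {n} (f : Fin (suc n) → ℚ) i → θ < f i → θ < f (firstLarge f)
  firstLarge-large {zero}  f zero    θ<f = θ<f
  firstLarge-large {suc n} f i       θ<f with θ <? f zero
  firstLarge-large {suc n} f i       θ<f | yes p = p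
  firstLarge-large {suc n} f zero    θ<f | no ¬p = ⊥-elim (¬p θ<f)
  firstLarge-large {suc n} f (suc i) θ<f | no ¬p = firstLarge-large (f ∘ suc) i θ<f

  large-sign : ∀ {a b} → θ < ∣ a ∣ → Within θ (b - a) → (0ℚ < a × 0ℚ < b) ⊎ (a < 0ℚ × b < 0ℚ)
  large-sign {a} {b} θ<∣a∣ within@(lo , hi) with ∣p∣≡p∨∣p∣≡-p a
  ... | inj₁ eq = inj₁ (≤-<-trans (Within-nonNeg within) θ<a , <-from-difference ((b - a - - θ) + (a - θ)) (+-mono-≤-< (0≤q-p lo) (0<q-p θ<a)) (id₁ a b θ))
    where
    θ<a : θ < a
    θ<a = subst (θ <_) eq θ<∣a∣
    id₁ : ∀ a b θ → 0ℚ + ((b - a - - θ) + (a - θ)) ≡ b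
    id₁ = solve-∀ ℚ-ring
  ... | inj₂ eq = inj₂ (<-from-difference (- a) (≤-<-trans (Within-nonNeg within) θ<-a) (+-inverseʳ a)
      , <-from-difference ((θ - (b - a)) + (- a - θ)) (+-mono-≤-< (0≤q-p hi) (0<q-p θ<-a)) (id₁ a b θ))
    where
    θ<-a : θ < - a
    θ<-a = subst (θ <_) eq θ<∣a∣
    id₁ : ∀ a b θ → b + ((θ - (b - a)) + (- a - θ)) ≡ 0ℚ
    id₁ = solve-∀ ℚ-ring

⊓-increment-mono : ∀ {l r p q} → l ≤ r → p ≤ q → l ⊓ q - l ⊓ p ≤ r ⊓ q - r ⊓ p
⊓-increment-mono {l} {r} {p} {q} l≤r p≤q with ≤-total l p
... | inj₁ l≤p = subst (_≤ r ⊓ q - r ⊓ p) (sym (⊓-increment-after p≤q l≤p)) (⊓-increment-lower r p≤q)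
... | inj₂ p≤l = subst₂ (λ x y → l ⊓ q - x ≤ r ⊓ q - y) (sym (p≥q⇒p⊓q≡q p≤l)) (sym (p≥q⇒p⊓q≡q (≤-trans p≤l l≤r)))
                   (+-monoˡ-≤ (- p) (⊓-monoˡ-≤ q l≤r))

-- The length of [l , r] ∩ (-∞ , q], for l ≤ r.
coverage : ℚ → ℚ → ℚ → ℚ
coverage l r q = r ⊓ q - l ⊓ q

coverage-increment : ∀ l r p q → coverage l r q - coverage l r p ≡ (r ⊓ q - r ⊓ p) - (l ⊓ q - l ⊓ p)
coverage-increment l r p q = swap (r ⊓ q) (l ⊓ q) (r ⊓ p) (l ⊓ p)
  where
  swap : ∀ a b c d → (a - b) - (c - d) ≡ (a - c) - (b - d)
  swap = solve-∀ ℚ-ring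

coverage-bounds : ∀ {l r p q} → l ≤ r → p ≤ q →
                 0ℚ ≤ coverage l r q - coverage l r p × coverage l r q - coverage l r p ≤ q - p
coverage-bounds {l} {r} {p} {q} l≤r p≤q =
    subst (0ℚ ≤_) (sym (coverage-increment l r p q)) (0≤q-p (⊓-increment-mono l≤r p≤q))
  , subst (_≤ q - p) (sym (coverage-increment l r p q))
      (≤-trans (≤-from-difference (l ⊓ q - l ⊓ p) (⊓-increment-lower l p≤q) (cancel (r ⊓ q - r ⊓ p) (l ⊓ q - l ⊓ p)))
               (⊓-increment-upper r p≤q))
  where
  cancel : ∀ a b → (a - b) + b ≡ a
  cancel = solve-∀ ℚ-ring

coverage-grid : ∀ {γ l r} → 0ℚ ≤ γ → l ≤ r → ∀ j →
                0ℚ ≤ coverage l r (grid γ (suc j)) - coverage l r (grid γ j) ×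
                coverage l r (grid γ (suc j)) - coverage l r (grid γ j) ≤ γ
coverage-grid {γ} {l} {r} 0≤γ l≤r j =
    proj₁ bounds
  , subst (coverage l r (grid γ (suc j)) - coverage l r (grid γ j) ≤_)
      (trans (cong (_+ - grid γ j) (grid-suc γ j)) (cancel (grid γ j) γ)) (proj₂ bounds)
  where
  bounds : 0ℚ ≤ coverage l r (grid γ (suc j)) - coverage l r (grid γ j) ×
           coverage l r (grid γ (suc j)) - coverage l r (grid γ j) ≤ grid γ (suc j) - grid γ j
  bounds = coverage-bounds l≤r (grid-mono {γ} 0≤γ (ℕ.n≤1+n j))
  cancel : ∀ a b → (a + b) - a ≡ b
  cancel = solve-∀ ℚ-ring

product-bounds : ∀ {h M x γ} → 0ℚ ≤ h → h ≤ M → 0ℚ ≤ x × x ≤ γ → 0ℚ ≤ h * x × h * x ≤ M * γ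
product-bounds {h} {M} {x} {γ} 0≤h h≤M (0≤x , x≤γ) =
  0≤p*q 0≤h 0≤x , *-mono-≤-nonNeg {h} {M} {x} {γ} 0≤h (≤-trans 0≤x x≤γ) h≤M x≤γ

-- ∫ s over [l , r], for the sign function s on the first k cells of a grid.
imbalance : (ℕ → ℚ) → ℚ → ℚ → (ℕ → Bool) → ℕ → ℚ
imbalance g l r s k = ∑ k (λ j → sgn (s j) * (coverage l r (g (suc j)) - coverage l r (g j)))

imbalance-integral : ∀ g l r s k → imbalance g l r s k ≡
  ∑ k (λ j → sgn (s j) * (r ⊓ g (suc j) - r ⊓ g j)) - ∑ k (λ j → sgn (s j) * (l ⊓ g (suc j) - l ⊓ g j))
imbalance-integral g l r s k = trans
  (∑-cong k (λ j _ → trans (cong (sgn (s j) *_) (coverage-increment l r (g j) (g (suc j))))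
                           (distrib (sgn (s j)) (r ⊓ g (suc j) - r ⊓ g j) (l ⊓ g (suc j) - l ⊓ g j))))
  (∑-minus k (λ j → sgn (s j) * (r ⊓ g (suc j) - r ⊓ g j)) (λ j → sgn (s j) * (l ⊓ g (suc j) - l ⊓ g j)))
  where
  distrib : ∀ a b c → a * (b - c) ≡ a * b - a * c
  distrib = solve-∀ ℚ-ring

-- The threshold is `θ` for arbitrary cubes but `θ + θ` for vertices, because a second `θ` is lost
-- in passing from the centre of a cube to one of its vertices. The dimension is at most `suc n`,
-- which explains `small`.
module NearlyBalanced {L n : ℕ} (w : Fin (suc n) → ℕ → ℚ) (θ c : ℚ)
  (w-bounds : ∀ i j → 0ℚ ≤ w i j × w i j ≤ c) (small : fromℕ (suc n) * c ≤ θ)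
  (none : ∀ (v : Cube L 0) → changes (signs v) L ℕ.≤ suc n → ¬ (∀ i → Within (θ + θ) (⟪ v ⟫ (w i))))
  where

  value : ∀ {k} → Fin (suc n) → Cube L k → ℚ
  value i X = ⟪ X ⟫ (w i)

  value-face : ∀ {j k} {Y : Cube L j} {X : Cube L k} i → k ℕ.≤ suc n → Y ⊑ X → Within θ (value i Y - value i X)
  value-face i k≤n Y⊑X = Within-mono
    (≤-trans (*-monoʳ-≤-nonNeg c {{nonNegative (≤-trans (proj₁ (w-bounds i 0)) (proj₂ (w-bounds i 0)))}} (fromℕ-mono-≤ k≤n)) small)
    (⟪⟫-face (w i) (w-bounds i) Y⊑X)

  -- Otherwise a vertex of `Z`, having at most `k` changes as a vertex of a hemisphere, would be
  -- balanced up to `θ + θ`, contrary to `none`.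
  some-large : ∀ {k} {X : Cube L k} → Hemisphere X → k ℕ.≤ suc n →
               ∀ {j} {Z : Cube L j} → Z ⊑ X → ∃[ i ] θ < ∣ value i Z ∣
  some-large {k} {X} hX k≤n {j} {Z} Z⊑X = decide (Fin.any? (λ i → θ <? ∣ value i Z ∣))
    where
    v : Cube L 0
    v = proj₁ (vertex Z)
    v⊑Z : v ⊑ Z
    v⊑Z = proj₂ (vertex Z)
    cancel : ∀ a b → a + (b - a) ≡ b
    cancel = solve-∀ ℚ-ring
    few-changes : changes (signs v) L ℕ.≤ suc n
    few-changes = ℕ.≤-trans (changes-signs v) (ℕ.≤-trans (ℕ.m≤m+n (changes⁺ v) _)
      (ℕ.≤-trans (changes-hemisphere (⊑-trans v⊑Z Z⊑X) hX) k≤n))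
    decide : Dec (∃[ i ] θ < ∣ value i Z ∣) → ∃[ i ] θ < ∣ value i Z ∣
    decide (yes large) = large
    decide (no ¬large) = ⊥-elim (none v few-changes λ i →
      subst (Within (θ + θ)) (cancel (value i Z) (value i v))
        (Within-+ {θ} {θ} {value i Z} {value i v - value i Z}
          (∣∣≤⇒Within {θ} {value i Z} (≮⇒≥ (λ θ< → ¬large (i , θ<))))
          (value-face {Y = v} {X = Z} i (ℕ.≤-trans (dimension Z⊑X) k≤n) v⊑Z)))

  label : ∀ {k} → Cube L k → Fin (suc n)
  label X = firstLarge {θ} (λ i → ∣ value i X ∣)

  label-antipode : ∀ {k} (X : Cube L k) → label (antipode X) ≡ label X
  label-antipode X = firstLarge-cong {f = λ i → ∣ value i (antipode X) ∣} {g = λ i → ∣ value i X ∣}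
    λ i → trans (cong ∣_∣ (⟪⟫-antipode X (w i))) (∣-p∣≡∣p∣ (value i X))

  label-large : ∀ {k} {X : Cube L k} → Hemisphere X → k ℕ.≤ suc n →
                ∀ {j} {Z : Cube L j} → Z ⊑ X → θ < ∣ value (label Z) Z ∣
  label-large hX k≤n {Z = Z} Z⊑X = firstLarge-large (λ i → ∣ value i Z ∣) (proj₁ i) (proj₂ i)
    where
    i : ∃[ i ] θ < ∣ value i Z ∣
    i = some-large hX k≤n Z⊑X

  sign : ∀ {k} → Cube L k → Fin (suc n) → Bool
  sign X i = isPositive (value i X)

  face-sign : ∀ {j k} {Z : Cube L j} {X : Cube L k} i → k ℕ.≤ suc n → Z ⊑ X → θ < ∣ value i Z ∣ →
              (0ℚ < value i Z × 0ℚ < value i X) ⊎ (value i Z < 0ℚ × value i X < 0ℚ)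
  face-sign {Z = Z} {X} i k≤n Z⊑X large = large-sign {θ} {value i Z} {value i X} large
    (subst (Within θ) (swap (value i Z) (value i X)) (Within-neg {θ} {value i Z - value i X} (value-face {Y = Z} {X = X} i k≤n Z⊑X)))
    where
    swap : ∀ a b → - (a - b) ≡ b - a
    swap = solve-∀ ℚ-ring

  isPositive-cong : ∀ {p q} → (0ℚ < p × 0ℚ < q) ⊎ (p < 0ℚ × q < 0ℚ) → isPositive q ≡ isPositive p
  isPositive-cong {p} {q} (inj₁ (0<p , 0<q)) = trans (isPositive-true {q} 0<q) (sym (isPositive-true {p} 0<p))
  isPositive-cong {p} {q} (inj₂ (p<0 , q<0)) = trans (isPositive-false {q} q<0) (sym (isPositive-false {p} p<0))

  isPositive-neg : ∀ {p q} → (0ℚ < p × 0ℚ < q) ⊎ (p < 0ℚ × q < 0ℚ) → isPositive (- q) ≡ not (isPositive q)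
  isPositive-neg {p} {q} (inj₁ (_ , 0<q)) =
    trans (isPositive-false { - q} (neg-antimono-< 0<q)) (cong not (sym (isPositive-true {q} 0<q)))
  isPositive-neg {p} {q} (inj₂ (_ , q<0)) =
    trans (isPositive-true { - q} (neg-antimono-< q<0)) (cong not (sym (isPositive-false {q} q<0)))

  sign-face : ∀ {j k} {Z : Cube L j} {X : Cube L k} i → k ℕ.≤ suc n → Z ⊑ X → θ < ∣ value i Z ∣ → sign X i ≡ sign Z i
  sign-face {Z = Z} {X} i k≤n Z⊑X large =
    isPositive-cong {value i Z} {value i X} (face-sign {Z = Z} {X} i k≤n Z⊑X large)

  -- Both signs agree with the sign at `Z`: there the labelled block exceeds `θ`, and its value
  -- moves by at most `θ` within `X`.
  coherent : ∀ {k} {X : Cube L k} → Hemisphere X → k ℕ.≤ suc n →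
             ∀ {i j} {Y : Cube L i} {Z : Cube L j} → Y ⊑ X → Z ⊑ Y →
             sign Y (label Z) ≡ sign X (label Z)
  coherent {X = X} hX k≤n {Y = Y} {Z} Y⊑X Z⊑Y = trans
    (sign-face {Z = Z} {Y} (label Z) (ℕ.≤-trans (dimension Y⊑X) k≤n) Z⊑Y (label-large hX k≤n (⊑-trans Z⊑Y Y⊑X)))
    (sym (sign-face {Z = Z} {X} (label Z) k≤n (⊑-trans Z⊑Y Y⊑X) (label-large hX k≤n (⊑-trans Z⊑Y Y⊑X))))

  odd : ∀ {k} {X : Cube L k} → Hemisphere X → k ℕ.≤ suc n →
        ∀ {j} {Z : Cube L j} → Z ⊑ X → sign (antipode X) (label Z) ≡ not (sign X (label Z))
  odd {X = X} hX k≤n {Z = Z} Z⊑X = trans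
    (cong isPositive (⟪⟫-antipode X (w (label Z))))
    (isPositive-neg {value (label Z) Z} {value (label Z) X}
      (face-sign {Z = Z} {X} (label Z) k≤n Z⊑X (label-large hX k≤n Z⊑X)))

  contradiction : ⊥
  contradiction = Labelled.tucker label label-antipode sign coherent odd

refine : ∀ {δ θ} (c : ℚ) → 0ℚ < δ → 0ℚ < θ → ∃[ m ] ∃[ γ ] 0ℚ < γ × fromℕ m * γ ≡ δ × c * γ ≤ θ
refine {δ} {θ} c 0<δ 0<θ = go (archimedean (c * δ * (1/ θ) {{θ≢0}}))
  where
  θ≢0 : NonZero θ
  θ≢0 = pos⇒nonZero θ {{positive 0<θ}}
  go : ∃[ k ] c * δ * (1/ θ) {{θ≢0}} ≤ fromℕ k → ∃[ m ] ∃[ γ ] 0ℚ < γ × fromℕ m * γ ≡ δ × c * γ ≤ θ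
  -- The successor guarantees a positive number of parts, by which `δ` can be divided.
  go (k , le) = suc k , inv (fromℕ (suc k)) (0<fromℕ-suc k) (≤-trans le (fromℕ-mono-≤ (ℕ.n≤1+n k)))
    where
    inv : ∀ x → 0ℚ < x → c * δ * (1/ θ) {{θ≢0}} ≤ x → ∃[ γ ] 0ℚ < γ × x * γ ≡ δ × c * γ ≤ θ
    inv x 0<x le′ = y * δ , 0<p*q (positive⁻¹ y {{1/pos⇒pos x {{positive 0<x}}}}) 0<δ , xγ≡δ
      , p*q≤r⇒q≤r÷p 0<x (begin
        x * (c * (y * δ))      ≡⟨ swap x c (y * δ) ⟩
        c * (x * (y * δ))      ≡⟨ cong (c *_) xγ≡δ ⟩
        c * δ                  ≡⟨ sym (*-identityʳ (c * δ)) ⟩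
        c * δ * 1ℚ             ≡⟨ cong (c * δ *_) (sym (*-inverseˡ θ {{θ≢0}})) ⟩
        c * δ * ((1/ θ) {{θ≢0}} * θ) ≡⟨ sym (*-assoc (c * δ) ((1/ θ) {{θ≢0}}) θ) ⟩
        c * δ * (1/ θ) {{θ≢0}} * θ   ≤⟨ *-monoʳ-≤-nonNeg θ {{nonNegative (<⇒≤ 0<θ)}} le′ ⟩
        x * θ                  ∎)
      where
      open ≤-Reasoning
      x≢0 : NonZero x
      x≢0 = pos⇒nonZero x {{positive 0<x}}
      y : ℚ
      y = (1/ x) {{x≢0}}
      xγ≡δ : x * (y * δ) ≡ δ
      xγ≡δ = trans (sym (*-assoc x y δ)) (trans (cong (_* δ) (*-inverseʳ x {{x≢0}})) (*-identityˡ δ))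
      swap : ∀ a b d → a * (b * d) ≡ b * (a * d)
      swap = solve-∀ ℚ-ring

-- The double negation of existence suffices: the dynamic program computes the
-- least cost, and it is decidable whether that is at most the number of blocks.
balanced-signs : ∀ {n} N (h l r : Fin (suc n) → ℚ) M δ ε →
  (∀ i → 0ℚ ≤ h i) → (∀ i → h i ≤ M) → (∀ i → l i ≤ r i) → 0ℚ < δ → fromℕ 2 * (M * δ) < ε →
  ¬ (∀ s → changes s N ℕ.≤ suc n → ¬ (∀ i → Within ε (h i * imbalance (grid δ) (l i) (r i) s N)))
balanced-signs {n} N h l r M δ ε 0≤h h≤M l≤r 0<δ 2Mδ<ε none =
  -- `θ` is half of the slack: near balance up to `θ + θ` and the rounding error `2 * M * δ` then
  -- add up to exactly `ε`.
  go (½ * (ε - fromℕ 2 * (M * δ))) (0<p*q (positive⁻¹ ½) (0<q-p 2Mδ<ε)) (total ε (fromℕ 2 * (M * δ)))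
  where
  total : ∀ ε a → (½ * (ε - a) + ½ * (ε - a)) + a ≡ ε
  total = solve-∀ ℚ-ring
  module _ (θ γ : ℚ) (m : ℕ) (0<γ : 0ℚ < γ) (mγ≡δ : fromℕ m * γ ≡ δ) (total : (θ + θ) + fromℕ 2 * (M * δ) ≡ ε) where
    g : ℕ → ℚ
    g = grid γ
    gain : Fin (suc n) → ℕ → ℚ
    gain i j = coverage (l i) (r i) (g (suc j)) - coverage (l i) (r i) (g j)
    w : Fin (suc n) → ℕ → ℚ
    w i j = h i * gain i j
    value-vertex : ∀ i (v : Cube (N ℕ.* m) 0) → ⟪ v ⟫ (w i) ≡ h i * imbalance g (l i) (r i) (signs v) (N ℕ.* m)
    value-vertex i v = trans (⟪⟫-signs v (w i))
      (trans (∑-cong (N ℕ.* m) (λ j _ → swap (sgn (signs v j)) (h i) (gain i j)))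
             (∑-*ˡ (N ℕ.* m) (h i) (λ j → sgn (signs v j) * gain i j)))
      where
      swap : ∀ a b c → a * (b * c) ≡ b * (a * c)
      swap = solve-∀ ℚ-ring
    to-coarse : ∀ v → changes (signs v) (N ℕ.* m) ℕ.≤ suc n → ¬ (∀ i → Within (θ + θ) (⟪ v ⟫ (w i)))
    to-coarse v few balanced = none rounded (ℕ.≤-trans rounded-changes few)
      λ i → subst₂ Within total (split i)
              (Within-+ {θ + θ} {fromℕ 2 * (M * δ)} (subst (Within (θ + θ)) (value-vertex i v) (balanced i)) (error i))
      where
      open Rounding N m δ γ 0<γ 0<δ mγ≡δ (signs v) hiding (g)
      e : ℚ → ℚ
      e x = integral-rounded x - integral-fine x
      double : ∀ M δ → M * (δ + δ) ≡ fromℕ 2 * (M * δ)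
      double = solve-∀ ℚ-ring
      error : ∀ i → Within (fromℕ 2 * (M * δ)) (h i * (e (r i) - e (l i)))
      error i = Within-mono {h i * (δ + δ)} {fromℕ 2 * (M * δ)} {h i * (e (r i) - e (l i))}
        (≤-trans (*-monoʳ-≤-nonNeg (δ + δ) {{nonNegative (0≤p+q (<⇒≤ 0<δ) (<⇒≤ 0<δ))}} (h≤M i)) (≤-reflexive (double M δ)))
        (Within-* {δ + δ} {h i} {e (r i) - e (l i)} (0≤h i)
          (Within-+ {δ} {δ} {e (r i)} { - e (l i)} (rounding-error (r i)) (Within-neg {δ} {e (l i)} (rounding-error (l i)))))
      cancel : ∀ h a b c d → h * (b - d) + h * ((a - b) - (c - d)) ≡ h * (a - c)
      cancel = solve-∀ ℚ-ring
      split : ∀ i → h i * imbalance g (l i) (r i) (signs v) (N ℕ.* m) + h i * (e (r i) - e (l i))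
                  ≡ h i * imbalance (grid δ) (l i) (r i) rounded N
      split i = trans (cong (λ x → h i * x + h i * (e (r i) - e (l i))) (imbalance-integral g (l i) (r i) (signs v) (N ℕ.* m)))
        (trans (cancel (h i) (integral-rounded (r i)) (integral-fine (r i)) (integral-rounded (l i)) (integral-fine (l i)))
               (cong (h i *_) (sym (imbalance-integral (grid δ) (l i) (r i) rounded N))))
  go : ∀ θ → 0ℚ < θ → (θ + θ) + fromℕ 2 * (M * δ) ≡ ε → ⊥
  go θ 0<θ tot = finish (refine (fromℕ (suc n) * M) 0<δ 0<θ)
    where
    finish : ∃[ m ] ∃[ γ ] 0ℚ < γ × fromℕ m * γ ≡ δ × fromℕ (suc n) * M * γ ≤ θ → ⊥
    finish (m , γ , 0<γ , mγ≡δ , small) = NearlyBalanced.contradiction (w θ γ m 0<γ mγ≡δ tot) θ (M * γ)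
      (λ i j → product-bounds (0≤h i) (h≤M i) (coverage-grid (<⇒≤ 0<γ) (l≤r i) j))
      (subst (_≤ θ) (*-assoc (fromℕ (suc n)) M γ) small) (to-coarse θ γ m 0<γ mγ≡δ tot)

-- Keys and costs of sign sequences

bit : Bool → ℕ
bit true  = 1
bit false = 0

bit≤1 : ∀ b → bit b ℕ.≤ 1
bit≤1 true  = s≤s z≤n
bit≤1 false = z≤n

bit-injective : ∀ {a b} → bit a ≡ bit b → a ≡ b
bit-injective {true}  {true}  eq = refl
bit-injective {false} {false} eq = refl

∑ℕ : ℕ → (ℕ → ℕ) → ℕ
∑ℕ zero    f = 0
∑ℕ (suc k) f = ∑ℕ k f ℕ.+ f k

∑ℕ-cong : ∀ k {f g} → (∀ j → j ℕ.< k → f j ≡ g j) → ∑ℕ k f ≡ ∑ℕ k g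
∑ℕ-cong zero    eq = refl
∑ℕ-cong (suc k) eq = cong₂ ℕ._+_ (∑ℕ-cong k (λ j j<k → eq j (ℕ.m<n⇒m<1+n j<k))) (eq k ℕ.≤-refl)

∑ℕ-+ : ∀ k f g → ∑ℕ k (λ j → f j ℕ.+ g j) ≡ ∑ℕ k f ℕ.+ ∑ℕ k g
∑ℕ-+ zero    f g = refl
∑ℕ-+ (suc k) f g = trans (cong (ℕ._+ (f k ℕ.+ g k)) (∑ℕ-+ k f g)) (interchange (∑ℕ k f) (∑ℕ k g) (f k) (g k))
  where
  interchange : ∀ a b c d → (a ℕ.+ b) ℕ.+ (c ℕ.+ d) ≡ (a ℕ.+ c) ℕ.+ (b ℕ.+ d)
  interchange = ℕ-Solver.solve-∀

∑ℕ-zero : ∀ k {f} → (∀ j → j ℕ.< k → f j ≡ 0) → ∑ℕ k f ≡ 0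
∑ℕ-zero zero    eq = refl
∑ℕ-zero (suc k) eq = cong₂ ℕ._+_ (∑ℕ-zero k (λ j j<k → eq j (ℕ.m<n⇒m<1+n j<k))) (eq k ℕ.≤-refl)

∑ℕ-zero⁻¹ : ∀ k {f} → ∑ℕ k f ≡ 0 → ∀ j → j ℕ.< k → f j ≡ 0
∑ℕ-zero⁻¹ (suc k) {f} eq j j<1+k with ℕ.m<1+n⇒m<n∨m≡n j<1+k
... | inj₁ j<k  = ∑ℕ-zero⁻¹ k (ℕ.m+n≡0⇒m≡0 (∑ℕ k f) eq) j j<k
... | inj₂ refl = ℕ.m+n≡0⇒n≡0 (∑ℕ k f) eq

any : ℕ → (ℕ → Bool) → Bool
any zero    p = false
any (suc k) p = p k ∨ any k p

any-cong : ∀ k {p q : ℕ → Bool} → (∀ j → j ℕ.< k → p j ≡ q j) → any k p ≡ any k q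
any-cong zero    eq = refl
any-cong (suc k) eq = cong₂ _∨_ (eq k ℕ.≤-refl) (any-cong k (λ j j<k → eq j (ℕ.m<n⇒m<1+n j<k)))

any-intro : ∀ k {p : ℕ → Bool} j → j ℕ.< k → p j ≡ true → any k p ≡ true
any-intro (suc k) {p} j j<1+k eq with p k in eqk | ℕ.m<1+n⇒m<n∨m≡n j<1+k
... | true  | _         = refl
... | false | inj₁ j<k  = any-intro k j j<k eq
... | false | inj₂ refl with () ← trans (sym eqk) eq

any-elim : ∀ k {p : ℕ → Bool} → any k p ≡ true → ∃[ j ] j ℕ.< k × p j ≡ true
any-elim (suc k) {p} eq with p k in eqk
... | true  = k , ℕ.≤-refl , eqk
... | false with any-elim k eq
... | j , j<k , pj = j , ℕ.m<n⇒m<1+n j<k , pj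

leq : ℚ → ℚ → Bool
leq p q = does (p ≤? q)

does-true : ∀ {A : Set} (a? : Dec A) → does a? ≡ true → A
does-true (yes a) eq = a

does-false : ∀ {A : Set} (a? : Dec A) → does a? ≡ false → ¬ A
does-false (no ¬a) eq = ¬a

leq-true : ∀ {p q} → p ≤ q → leq p q ≡ true
leq-true {p} {q} = dec-true (p ≤? q)

leq-false : ∀ {p q} → q < p → leq p q ≡ false
leq-false {p} {q} q<p = dec-false (p ≤? q) λ p≤q → <-irrefl refl (<-≤-trans q<p p≤q)

leq-true⁻¹ : ∀ p q → leq p q ≡ true → p ≤ q
leq-true⁻¹ p q = does-true (p ≤? q)

leq-false⁻¹ : ∀ p q → leq p q ≡ false → q < p
leq-false⁻¹ p q eq = ≰⇒> (does-false (p ≤? q) eq)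

∧-true : ∀ {a b} → a ∧ b ≡ true → a ≡ true × b ≡ true
∧-true {true} {true} eq = refl , refl

not-true : ∀ {a} → not a ≡ true → a ≡ false
not-true {false} eq = refl

-- The mixed radix code of a sign sequence s relative to a set of marked
-- cells.  Reading the cells j-1, …, 0, every marked cell contributes a digit
-- consisting of its own sign and of the number P of plus signs among the len
-- cells between it and the next marked one.
encode : (ℕ → Bool) → (ℕ → Bool) → (j len P K : ℕ) → ℕ
encode mark s zero    len P K = K
encode mark s (suc j) len P K =
  if mark j then encode mark s j 0 0 (K ℕ.* (2 ℕ.* suc len) ℕ.+ (bit (s j) ℕ.+ 2 ℕ.* P))
            else encode mark s j (suc len) (P ℕ.+ bit (s j)) K

radix : (ℕ → Bool) → (j len R : ℕ) → ℕ
radix mark zero    len R = R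
radix mark (suc j) len R =
  if mark j then radix mark j 0 (R ℕ.* (2 ℕ.* suc len)) else radix mark j (suc len) R

digit< : ∀ b {P len} → P ℕ.≤ len → bit b ℕ.+ 2 ℕ.* P ℕ.< 2 ℕ.* suc len
digit< b {P} {len} P≤len = ℕ.≤-trans
  (s≤s (ℕ.+-mono-≤ (bit≤1 b) (ℕ.*-monoʳ-≤ 2 P≤len))) (ℕ.≤-reflexive (double len))
  where
  double : ∀ l → suc (1 ℕ.+ 2 ℕ.* l) ≡ 2 ℕ.* suc l
  double = ℕ-Solver.solve-∀

mixed< : ∀ {K R D B} → K ℕ.< R → D ℕ.< B → K ℕ.* B ℕ.+ D ℕ.< R ℕ.* B
mixed< {K} {R} {D} {B} K<R D<B = ℕ.≤-trans
  (ℕ.+-monoʳ-< (K ℕ.* B) D<B) (ℕ.≤-trans (ℕ.≤-reflexive (ℕ.+-comm (K ℕ.* B) B)) (ℕ.*-monoˡ-≤ B K<R))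

mixed-injective : ∀ {K K′ D D′ B} → D ℕ.< B → D′ ℕ.< B → K ℕ.* B ℕ.+ D ≡ K′ ℕ.* B ℕ.+ D′ → K ≡ K′ × D ≡ D′
mixed-injective {K} {K′} {D} {D′} {B} D<B D′<B eq with ℕ.<-cmp K K′
... | tri< K<K′ _ _ = ⊥-elim (ℕ.<-irrefl eq (ℕ.<-≤-trans (mixed< K<K′ D<B) (ℕ.m≤m+n (K′ ℕ.* B) D′)))

... | tri> _ _ K′<K = ⊥-elim (ℕ.<-irrefl (sym eq) (ℕ.<-≤-trans (mixed< K′<K D′<B) (ℕ.m≤m+n (K ℕ.* B) D)))
... | tri≈ _ refl _ = refl , ℕ.+-cancelˡ-≡ (K ℕ.* B) D D′ eq

encode<radix : ∀ mark s j {len P K R} → P ℕ.≤ len → K ℕ.< R → encode mark s j len P K ℕ.< radix mark j len R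
encode<radix mark s zero    P≤len K<R = K<R
encode<radix mark s (suc j) P≤len K<R with mark j
... | true  = encode<radix mark s j z≤n (mixed< K<R (digit< (s j) P≤len))
... | false = encode<radix mark s j (ℕ.≤-trans (ℕ.+-mono-≤ P≤len (bit≤1 (s j))) (ℕ.≤-reflexive (ℕ.+-comm _ 1))) K<R

encode-cong : ∀ mark mark′ s t j {len P K} → (∀ i → i ℕ.< j → mark i ≡ mark′ i) → (∀ i → i ℕ.< j → s i ≡ t i) →
              encode mark s j len P K ≡ encode mark′ t j len P K
encode-cong mark mark′ s t zero    eqm eqs = refl
encode-cong mark mark′ s t (suc j) eqm eqs
  rewrite eqm j ℕ.≤-refl | eqs j ℕ.≤-refl with mark′ j
... | true  = encode-cong mark mark′ s t j (λ i i<j → eqm i (ℕ.m<n⇒m<1+n i<j)) (λ i i<j → eqs i (ℕ.m<n⇒m<1+n i<j))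
... | false = encode-cong mark mark′ s t j (λ i i<j → eqm i (ℕ.m<n⇒m<1+n i<j)) (λ i i<j → eqs i (ℕ.m<n⇒m<1+n i<j))

radix-cong : ∀ mark mark′ j {len R} → (∀ i → i ℕ.< j → mark i ≡ mark′ i) → radix mark j len R ≡ radix mark′ j len R
radix-cong mark mark′ zero    eqm = refl
radix-cong mark mark′ (suc j) eqm rewrite eqm j ℕ.≤-refl with mark′ j
... | true  = radix-cong mark mark′ j (λ i i<j → eqm i (ℕ.m<n⇒m<1+n i<j))
... | false = radix-cong mark mark′ j (λ i i<j → eqm i (ℕ.m<n⇒m<1+n i<j))

pluses : (ℕ → Bool) → ℕ → ℕ
pluses s j = ∑ℕ j (bit ∘ s)

-- The information recorded by the code: the signs of the marked cells and the
-- numbers of plus signs after them (compared without subtraction).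
Agree : (ℕ → Bool) → (s t : ℕ → Bool) → (j P Q : ℕ) → Set
Agree mark s t j P Q = ∀ c → c ℕ.< j → mark c ≡ true →
  s c ≡ t c × P ℕ.+ pluses s j ℕ.+ pluses t (suc c) ≡ Q ℕ.+ pluses t j ℕ.+ pluses s (suc c)

digit-injective : ∀ a b {P Q} → bit a ℕ.+ 2 ℕ.* P ≡ bit b ℕ.+ 2 ℕ.* Q → a ≡ b × P ≡ Q
digit-injective true  true  {P} {Q} eq = refl , ℕ.*-cancelˡ-≡ P Q 2 (ℕ.suc-injective eq)
digit-injective false false {P} {Q} eq = refl , ℕ.*-cancelˡ-≡ P Q 2 eq
digit-injective true  false {P} {Q} eq = ⊥-elim (ℕ.even≢odd Q P (sym eq))
digit-injective false true  {P} {Q} eq = ⊥-elim (ℕ.even≢odd P Q eq)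

-- The digit of the lowest marked cell is the least significant one, so the recursion first compares
-- the codes at the end and splits off digits on the way back.
encode-injective : ∀ mark s t j {len P Q K K′} → P ℕ.≤ len → Q ℕ.≤ len →
                   encode mark s j len P K ≡ encode mark t j len Q K′ → K ≡ K′ × Agree mark s t j P Q
encode-injective mark s t zero    P≤ Q≤ eq = eq , λ _ ()
encode-injective mark s t (suc j) {len} {P} {Q} P≤ Q≤ eq with mark j in eqm
... | false with encode-injective mark s t j
      (ℕ.≤-trans (ℕ.+-mono-≤ P≤ (bit≤1 (s j))) (ℕ.≤-reflexive (ℕ.+-comm _ 1)))
      (ℕ.≤-trans (ℕ.+-mono-≤ Q≤ (bit≤1 (t j))) (ℕ.≤-reflexive (ℕ.+-comm _ 1))) eq
...   | K≡ , agree = K≡ , λ c c<1+j mc → below c mc (ℕ.m<1+n⇒m<n∨m≡n c<1+j)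
  where
  shift : ∀ p b s t → p ℕ.+ b ℕ.+ s ℕ.+ t ≡ p ℕ.+ (s ℕ.+ b) ℕ.+ t
  shift = ℕ-Solver.solve-∀
  below : ∀ c → mark c ≡ true → c ℕ.< j ⊎ c ≡ j → s c ≡ t c ×
          P ℕ.+ pluses s (suc j) ℕ.+ pluses t (suc c) ≡ Q ℕ.+ pluses t (suc j) ℕ.+ pluses s (suc c)
  below c mc (inj₁ c<j) with agree c c<j mc
  ... | sc , eq = sc , trans (sym (shift P (bit (s j)) (pluses s j) (pluses t (suc c))))
                         (trans eq (shift Q (bit (t j)) (pluses t j) (pluses s (suc c))))
  below c mc (inj₂ refl) with () ← trans (sym eqm) mc
encode-injective mark s t (suc j) {len} {P} {Q} P≤ Q≤ eq | true
  with encode-injective mark s t j z≤n z≤n eq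
... | eq′ , agree with mixed-injective (digit< (s j) P≤) (digit< (t j) Q≤) eq′
...   | K≡ , D≡ with digit-injective (s j) (t j) {P} {Q} D≡
...     | sj , P≡Q = K≡ , λ c c<1+j mc → below c mc (ℕ.m<1+n⇒m<n∨m≡n c<1+j)
  where
  below : ∀ c → mark c ≡ true → c ℕ.< j ⊎ c ≡ j → s c ≡ t c ×
          P ℕ.+ pluses s (suc j) ℕ.+ pluses t (suc c) ≡ Q ℕ.+ pluses t (suc j) ℕ.+ pluses s (suc c)
  below c mc (inj₂ refl) = sj , trans (cong (λ p → p ℕ.+ pluses s (suc j) ℕ.+ pluses t (suc j)) P≡Q)
                                      (swap Q (pluses s (suc j)) (pluses t (suc j)))
    where
    swap : ∀ p s t → p ℕ.+ s ℕ.+ t ≡ p ℕ.+ t ℕ.+ s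
    swap = ℕ-Solver.solve-∀
  below c mc (inj₁ c<j) with agree c c<j mc
  ... | sc , eq = sc , trans (shift P (pluses s j) (bit (s j)) (pluses t (suc c)))
                    (trans (cong₂ ℕ._+_ (cong₂ ℕ._+_ P≡Q (cong bit sj)) eq) (sym (shift Q (pluses t j) (bit (t j)) (pluses s (suc c)))))
    where
    shift : ∀ p s b t → p ℕ.+ (s ℕ.+ b) ℕ.+ t ≡ p ℕ.+ b ℕ.+ (s ℕ.+ t)
    shift = ℕ-Solver.solve-∀

encode-agree : ∀ mark s t j {len P Q K} → Agree mark s t j P Q →
               encode mark s j len P K ≡ encode mark t j len Q K
encode-agree mark s t zero    agree = refl
encode-agree mark s t (suc j) {len} {P} {Q} {K} agree with mark j in eqm
... | false = encode-agree mark s t j λ c c<j mc →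
      proj₁ (agree c (ℕ.m<n⇒m<1+n c<j) mc)
    , trans (shift P (bit (s j)) (pluses s j) (pluses t (suc c)))
        (trans (proj₂ (agree c (ℕ.m<n⇒m<1+n c<j) mc)) (sym (shift Q (bit (t j)) (pluses t j) (pluses s (suc c)))))
  where
  shift : ∀ p b s t → p ℕ.+ b ℕ.+ s ℕ.+ t ≡ p ℕ.+ (s ℕ.+ b) ℕ.+ t
  shift = ℕ-Solver.solve-∀
... | true = trans
    (cong (λ D → encode mark s j 0 0 (K ℕ.* (2 ℕ.* suc len) ℕ.+ D)) (cong₂ (λ b p → bit b ℕ.+ 2 ℕ.* p) sj P≡Q))
    (encode-agree mark s t j λ c c<j mc → proj₁ (agree c (ℕ.m<n⇒m<1+n c<j) mc) ,
      ℕ.+-cancelˡ-≡ (P ℕ.+ bit (s j)) _ _ (trans (sym (shift P (pluses s j) (bit (s j)) (pluses t (suc c))))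
        (trans (proj₂ (agree c (ℕ.m<n⇒m<1+n c<j) mc))
          (trans (shift Q (pluses t j) (bit (t j)) (pluses s (suc c)))
            (cong (ℕ._+ (pluses t j ℕ.+ pluses s (suc c))) (cong₂ ℕ._+_ (sym P≡Q) (cong bit (sym sj))))))))
  where
  sj : s j ≡ t j
  sj = proj₁ (agree j ℕ.≤-refl eqm)
  swap : ∀ p s t → p ℕ.+ s ℕ.+ t ≡ s ℕ.+ t ℕ.+ p
  swap = ℕ-Solver.solve-∀
  P≡Q : P ≡ Q
  P≡Q = ℕ.+-cancelˡ-≡ (pluses s (suc j) ℕ.+ pluses t (suc j)) P Q (trans (sym (swap P (pluses s (suc j)) (pluses t (suc j))))
    (trans (proj₂ (agree j ℕ.≤-refl eqm)) (trans (swap Q (pluses t (suc j)) (pluses s (suc j)))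
      (cong (ℕ._+ Q) (ℕ.+-comm (pluses t (suc j)) (pluses s (suc j)))))))
  shift : ∀ p s b t → p ℕ.+ (s ℕ.+ b) ℕ.+ t ≡ p ℕ.+ b ℕ.+ (s ℕ.+ t)
  shift = ℕ-Solver.solve-∀

lastBit : ℕ → (ℕ → Bool) → ℕ
lastBit zero    s = 0
lastBit (suc k) s = bit (s k)

lastBit≤1 : ∀ k s → lastBit k s ℕ.≤ 1
lastBit≤1 zero    s = z≤n
lastBit≤1 (suc k) s = bit≤1 (s k)

-- The number of changes added by cell `k` depends only on the last two signs. The sums are crossed
-- to state equality of two increases without subtraction; `violation-suc` and `bellman` follow the
-- same pattern.
changes-suc : ∀ k s t → lastBit k s ≡ lastBit k t → s k ≡ t k →
              changes s (suc k) ℕ.+ changes t k ≡ changes t (suc k) ℕ.+ changes s k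
changes-suc zero    s t _  _  = refl
changes-suc (suc k) s t lb sk
  rewrite sk | bit-injective {s k} {t k} lb = swap (changes s (suc k)) (differs (t (suc k)) (t k)) (changes t (suc k))
  where
  swap : ∀ a d b → a ℕ.+ d ℕ.+ b ≡ b ℕ.+ d ℕ.+ a
  swap = ℕ-Solver.solve-∀

between : ∀ {δ} → 0ℚ < δ → ∀ k {x} → 0ℚ ≤ x → x < grid δ k → ∃[ c ] c ℕ.< k × grid δ c ≤ x × x < grid δ (suc c)
between {δ} 0<δ zero    0≤x x<0 = ⊥-elim (<-irrefl refl (≤-<-trans 0≤x (subst (_ <_) (grid-zero δ) x<0)))
between {δ} 0<δ (suc k) {x} 0≤x x<G = decide (x <? grid δ k)
  where
  decide : Dec (x < grid δ k) → ∃[ c ] c ℕ.< suc k × grid δ c ≤ x × x < grid δ (suc c)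
  decide (no  x≮G)  = k , ℕ.≤-refl , ≮⇒≥ x≮G , x<G
  decide (yes x<G′) = widen (between 0<δ k 0≤x x<G′)
    where
    widen : ∃[ c ] c ℕ.< k × grid δ c ≤ x × x < grid δ (suc c) → ∃[ c ] c ℕ.< suc k × grid δ c ≤ x × x < grid δ (suc c)
    widen (c , c<k , bounds) = c , ℕ.m<n⇒m<1+n c<k , bounds

module Dynamic (n : ℕ) (l r h : ℕ → ℚ) (δ ε : ℚ)
               (0<δ : 0ℚ < δ) (0≤l : ∀ i → i ℕ.< n → 0ℚ ≤ l i) (l<r : ∀ i → i ℕ.< n → l i < r i) where

  G : ℕ → ℚ
  G = grid δ

  -- At time k cell j is marked if some block that starts in cell j has not
  -- ended yet.
  starts : ℕ → ℕ → ℕ → Bool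
  starts k j i = leq (G j) (l i) ∧ (not (leq (G (suc j)) (l i)) ∧ not (leq (r i) (G k)))

  marked : ℕ → ℕ → Bool
  marked k j = any n (starts k j)

  -- The sign of the last cell is the most significant digit, with radix 2; it decides whether the
  -- next sign is a change.
  key : ℕ → (ℕ → Bool) → ℕ
  key k s = encode (marked k) s k 0 0 (lastBit k s)

  keys : ℕ → ℕ
  keys k = radix (marked k) k 0 2

  key<keys : ∀ k s → key k s ℕ.< keys k
  key<keys k s = encode<radix (marked k) s k z≤n (s≤s (lastBit≤1 k s))

  key-cong : ∀ k {s t} → (∀ j → j ℕ.< k → s j ≡ t j) → key k s ≡ key k t
  key-cong k {s} {t} eq = trans (encode-cong (marked k) (marked k) s t k (λ _ _ → refl) eq)
                        (cong (encode (marked k) t k 0 0) (lastBit-cong k eq))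
    where
    lastBit-cong : ∀ k {s t} → (∀ j → j ℕ.< k → s j ≡ t j) → lastBit k s ≡ lastBit k t
    lastBit-cong zero    eq = refl
    lastBit-cong (suc k) eq = cong bit (eq k ℕ.≤-refl)

  starts⁻¹ : ∀ k j i → starts k j i ≡ true → G j ≤ l i × l i < G (suc j) × G k < r i
  starts⁻¹ k j i eq =
      leq-true⁻¹ (G j) (l i) (proj₁ split)
    , leq-false⁻¹ (G (suc j)) (l i) (not-true (proj₁ (∧-true (proj₂ split))))
    , leq-false⁻¹ (r i) (G k) (not-true (proj₂ (∧-true {not (leq (G (suc j)) (l i))} (proj₂ split))))
    where
    split : leq (G j) (l i) ≡ true × not (leq (G (suc j)) (l i)) ∧ not (leq (r i) (G k)) ≡ true
    split = ∧-true eq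

  starts-intro : ∀ k j i → G j ≤ l i → l i < G (suc j) → G k < r i → starts k j i ≡ true
  starts-intro k j i p q₁ q₂ = cong₂ _∧_ (leq-true p) (cong₂ (λ a b → not a ∧ not b) (leq-false q₁) (leq-false q₂))

  marked-pred : ∀ k j → marked (suc k) j ≡ true → marked k j ≡ true
  marked-pred k j eq = extend (any-elim n eq)
    where
    extend : ∃[ i ] i ℕ.< n × starts (suc k) j i ≡ true → marked k j ≡ true
    extend (i , i<n , st) = any-intro n i i<n (starts-intro k j i (proj₁ (starts⁻¹ (suc k) j i st)) (proj₁ (proj₂ (starts⁻¹ (suc k) j i st)))
      (≤-<-trans (grid-mono (<⇒≤ 0<δ) (ℕ.n≤1+n k)) (proj₂ (proj₂ (starts⁻¹ (suc k) j i st)))))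

  key-injective : ∀ k s t → key k s ≡ key k t → lastBit k s ≡ lastBit k t × Agree (marked k) s t k 0 0
  key-injective k s t = encode-injective (marked k) s t k z≤n z≤n

  -- A mark on an earlier cell can only disappear as time goes on, so agreement at time `k`
  -- restricts to the remaining marks and extends by the common new sign. After cell `k` itself
  -- there is nothing to count yet.
  key-suc : ∀ k s t → key k s ≡ key k t → s k ≡ t k → key (suc k) s ≡ key (suc k) t
  key-suc k s t eq sk = trans (cong (encode (marked (suc k)) s (suc k) 0 0) (cong bit sk))
    (encode-agree (marked (suc k)) s t (suc k) λ c c<1+k mc → agree c mc (ℕ.m<1+n⇒m<n∨m≡n c<1+k))
    where
    agree : ∀ c → marked (suc k) c ≡ true → c ℕ.< k ⊎ c ≡ k → s c ≡ t c ×
            pluses s (suc k) ℕ.+ pluses t (suc c) ≡ pluses t (suc k) ℕ.+ pluses s (suc c)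
    agree c mc (inj₂ refl) = sk , ℕ.+-comm (pluses s (suc k)) (pluses t (suc k))
    agree c mc (inj₁ c<k) = proj₁ before , trans (swap (pluses s k) (bit (s k)) (pluses t (suc c)))
                         (trans (cong₂ ℕ._+_ (proj₂ before) (cong bit sk)) (sym (swap (pluses t k) (bit (t k)) (pluses s (suc c)))))
      where
      before : s c ≡ t c × pluses s k ℕ.+ pluses t (suc c) ≡ pluses t k ℕ.+ pluses s (suc c)
      before = proj₂ (key-injective k s t eq) c c<k (marked-pred k c mc)
      swap : ∀ a b c → a ℕ.+ b ℕ.+ c ≡ a ℕ.+ c ℕ.+ b
      swap = ℕ-Solver.solve-∀

  imb : ℕ → (ℕ → Bool) → ℕ → ℚ
  imb i = imbalance G (l i) (r i)

  gain : ℕ → ℕ → ℚ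
  gain i j = coverage (l i) (r i) (G (suc j)) - coverage (l i) (r i) (G j)

  G-step : ∀ j → G j ≤ G (suc j)
  G-step j = grid-mono (<⇒≤ 0<δ) (ℕ.n≤1+n j)

  G-difference : ∀ j → G (suc j) - G j ≡ δ
  G-difference j = trans (cong (_+ - G j) (grid-suc δ j)) (cancel (G j) δ)
    where
    cancel : ∀ a b → (a + b) - a ≡ b
    cancel = solve-∀ ℚ-ring

  gain-before : ∀ i j → G (suc j) ≤ l i → l i ≤ r i → gain i j ≡ 0ℚ
  gain-before i j G≤l l≤r = trans (coverage-increment (l i) (r i) (G j) (G (suc j)))
    (trans (cong₂ _-_ (⊓-increment-before (G-step j) (≤-trans G≤l l≤r)) (⊓-increment-before (G-step j) G≤l))
           (+-inverseʳ (G (suc j) - G j)))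

  gain-after : ∀ i j → r i ≤ G j → l i ≤ r i → gain i j ≡ 0ℚ
  gain-after i j r≤G l≤r = trans (coverage-increment (l i) (r i) (G j) (G (suc j)))
    (cong₂ _-_ (⊓-increment-after (G-step j) r≤G) (⊓-increment-after (G-step j) (≤-trans l≤r r≤G)))

  gain-inside : ∀ i j → l i ≤ G j → G (suc j) ≤ r i → gain i j ≡ δ
  gain-inside i j l≤G G≤r = trans (coverage-increment (l i) (r i) (G j) (G (suc j)))
    (trans (cong₂ _-_ (trans (⊓-increment-before (G-step j) G≤r) (G-difference j)) (⊓-increment-after (G-step j) l≤G))
           (+-identityʳ δ))

  imb-before : ∀ i s k → G k ≤ l i → l i ≤ r i → imb i s k ≡ 0ℚ
  imb-before i s k G≤l l≤r = ∑-zero k λ j j<k →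
    trans (cong (sgn (s j) *_) (gain-before i j (≤-trans (grid-mono (<⇒≤ 0<δ) j<k) G≤l) l≤r)) (*-zeroʳ (sgn (s j)))

  -- An unfinished block covers every cell after its first one completely, up to time `k`. Its
  -- integral therefore depends on the sign of the first cell and the number of plus signs since,
  -- and both are recorded in the key.
  imb-determined : ∀ k s t i → i ℕ.< n → G k < r i → key k s ≡ key k t → imb i s k ≡ imb i t k
  imb-determined k s t i i<n G<r eq = decide (l i <? G k)
    where
    from-cell : ∃[ c ] c ℕ.< k × G c ≤ l i × l i < G (suc c) → imb i s k ≡ imb i t k
    from-cell (c , c<k , Gc≤l , l<G′) = conclude (compare k c<k ℕ.≤-refl)
      where
      agree : s c ≡ t c × pluses s k ℕ.+ pluses t (suc c) ≡ pluses t k ℕ.+ pluses s (suc c)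
      agree = proj₂ (key-injective k s t eq) c c<k (any-intro n i i<n (starts-intro k c i Gc≤l l<G′ G<r))
      q : (ℕ → Bool) → ℕ → ℚ
      q s j = fromℕ (pluses s j)
      -- The integral minus `2 * δ` times the number of plus signs after cell `c` is the same for
      -- `s` and `t`. It is written additively to match `agree`.
      Compare : ℕ → Set
      Compare j = imb i s j + fromℕ 2 * δ * (q t j + q s (suc c)) ≡ imb i t j + fromℕ 2 * δ * (q s j + q t (suc c))
      step : ∀ a b d → sgn a * d + fromℕ 2 * d * fromℕ (bit b) ≡ sgn b * d + fromℕ 2 * d * fromℕ (bit a)
      step true  true  d = refl
      step false false d = refl
      step true  false d = identity d
        where
        identity : ∀ d → 1ℚ * d + fromℕ 2 * d * 0ℚ ≡ - 1ℚ * d + fromℕ 2 * d * 1ℚ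
        identity = solve-∀ ℚ-ring
      step false true  d = identity d
        where
        identity : ∀ d → - 1ℚ * d + fromℕ 2 * d * 1ℚ ≡ 1ℚ * d + fromℕ 2 * d * 0ℚ
        identity = solve-∀ ℚ-ring
      compare : ∀ j → c ℕ.< j → j ℕ.≤ k → Compare j
      compare (suc j) c<1+j j<k = extend (ℕ.m<1+n⇒m<n∨m≡n c<1+j)
       where
       open ≡-Reasoning
       extend : c ℕ.< j ⊎ c ≡ j → Compare (suc j)
       extend (inj₂ refl) = cong₂ (λ x y → x + fromℕ 2 * δ * y)
            (cong₂ _+_ (trans (imb-before i s c Gc≤l (<⇒≤ (l<r i i<n))) (sym (imb-before i t c Gc≤l (<⇒≤ (l<r i i<n)))))
                       (cong (λ b → sgn b * gain i c) (proj₁ agree)))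
            (+-comm (q t (suc c)) (q s (suc c)))
       extend (inj₁ c<j) = begin
        (imb i s j + sgn (s j) * gain i j) + fromℕ 2 * δ * (q t (suc j) + q s (suc c))
          ≡⟨ cong₂ (λ x y → (imb i s j + sgn (s j) * x) + fromℕ 2 * δ * (y + q s (suc c))) inside (fromℕ-+ (pluses t j) (bit (t j))) ⟩
        (imb i s j + sgn (s j) * δ) + fromℕ 2 * δ * ((q t j + fromℕ (bit (t j))) + q s (suc c))
          ≡⟨ regroup (imb i s j) (sgn (s j) * δ) (fromℕ 2 * δ) (q t j) (fromℕ (bit (t j))) (q s (suc c)) ⟩
        (imb i s j + fromℕ 2 * δ * (q t j + q s (suc c))) + (sgn (s j) * δ + fromℕ 2 * δ * fromℕ (bit (t j)))
          ≡⟨ cong₂ _+_ (compare j c<j (ℕ.<⇒≤ j<k)) (step (s j) (t j) δ) ⟩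
        (imb i t j + fromℕ 2 * δ * (q s j + q t (suc c))) + (sgn (t j) * δ + fromℕ 2 * δ * fromℕ (bit (s j)))
          ≡⟨ sym (regroup (imb i t j) (sgn (t j) * δ) (fromℕ 2 * δ) (q s j) (fromℕ (bit (s j))) (q t (suc c))) ⟩
        (imb i t j + sgn (t j) * δ) + fromℕ 2 * δ * ((q s j + fromℕ (bit (s j))) + q t (suc c))
          ≡⟨ cong₂ (λ x y → (imb i t j + sgn (t j) * x) + fromℕ 2 * δ * (y + q t (suc c))) (sym inside) (sym (fromℕ-+ (pluses s j) (bit (s j)))) ⟩
        (imb i t j + sgn (t j) * gain i j) + fromℕ 2 * δ * (q s (suc j) + q t (suc c)) ∎
        where
        inside : gain i j ≡ δ
        inside = gain-inside i j (≤-trans (<⇒≤ l<G′) (grid-mono (<⇒≤ 0<δ) c<j))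
                                 (≤-trans (grid-mono (<⇒≤ 0<δ) j<k) (<⇒≤ G<r))
        regroup : ∀ x a e y b z → (x + a) + e * ((y + b) + z) ≡ (x + e * (y + z)) + (a + e * b)
        regroup = solve-∀ ℚ-ring
      conclude : Compare k → imb i s k ≡ imb i t k
      conclude e = trans (expand (imb i s k) C) (trans (cong (_- C) (trans e (cong (λ y → imb i t k + fromℕ 2 * δ * y)
          (trans (sym (fromℕ-+ (pluses s k) (pluses t (suc c)))) (trans (cong fromℕ (proj₂ agree)) (fromℕ-+ (pluses t k) (pluses s (suc c)))))))) (sym (expand (imb i t k) C)))
        where
        C : ℚ
        C = fromℕ 2 * δ * (q t k + q s (suc c))
        expand : ∀ x c → x ≡ (x + c) - c
        expand = solve-∀ ℚ-ring
    decide : Dec (l i < G k) → imb i s k ≡ imb i t k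
    decide (no  l≮G) = trans (imb-before i s k (≮⇒≥ l≮G) (<⇒≤ (l<r i i<n))) (sym (imb-before i t k (≮⇒≥ l≮G) (<⇒≤ (l<r i i<n))))
    decide (yes l<G) = from-cell (between 0<δ k (0≤l i i<n) l<G)

  violation : ℕ → (ℕ → Bool) → ℕ → ℕ
  violation k s i =
    if leq (r i) (G k)
    then (if leq (h i * imb i s k) ε ∧ leq (- ε) (h i * imb i s k) then 0 else 1)
    else 0

  cost : ℕ → (ℕ → Bool) → ℕ
  cost k s = changes s k ℕ.+ suc n ℕ.* ∑ℕ n (violation k s)

  imbalance-cong : ∀ i k {s t} → (∀ j → j ℕ.< k → s j ≡ t j) → imb i s k ≡ imb i t k
  imbalance-cong i k eq = ∑-cong k λ j j<k → cong (λ b → sgn b * gain i j) (eq j j<k)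

  cost-cong : ∀ k {s t} → (∀ j → j ℕ.< k → s j ≡ t j) → cost k s ≡ cost k t
  cost-cong k eq = cong₂ (λ a b → a ℕ.+ suc n ℕ.* b) (changes-cong k eq)
    (∑ℕ-cong n λ i _ → cong (λ x → if leq (r i) (G k) then (if leq (h i * x) ε ∧ leq (- ε) (h i * x) then 0 else 1) else 0)
                            (imbalance-cong i k eq))

  -- A block finished by time `k` gains nothing more, so its verdict stays. A block still unfinished
  -- has no violation at time `k`, and its integral at time `suc k` is determined by the key and the
  -- new sign.
  violation-suc : ∀ k s t → key k s ≡ key k t → s k ≡ t k → ∀ i → i ℕ.< n →
                  violation (suc k) s i ℕ.+ violation k t i ≡ violation (suc k) t i ℕ.+ violation k s i
  violation-suc k s t eq sk i i<n = by-cases (leq (r i) (G k)) refl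
    where
    check : Bool → ℚ → ℕ
    check b x = if b then (if leq (h i * x) ε ∧ leq (- ε) (h i * x) then 0 else 1) else 0
    open-block : leq (r i) (G k) ≡ false → imb i s (suc k) ≡ imb i t (suc k)
    open-block e = cong₂ _+_ (imb-determined k s t i i<n (leq-false⁻¹ (r i) (G k) e) eq) (cong (λ b → sgn b * gain i k) sk)
    closed-block : leq (r i) (G k) ≡ true → ∀ s → imb i s (suc k) ≡ imb i s k
    closed-block e s = trans (cong (imb i s k +_) (trans (cong (sgn (s k) *_)
        (gain-after i k (leq-true⁻¹ (r i) (G k) e) (<⇒≤ (l<r i i<n)))) (*-zeroʳ (sgn (s k))))) (+-identityʳ (imb i s k))
    by-cases : ∀ b → leq (r i) (G k) ≡ b → violation (suc k) s i ℕ.+ violation k t i ≡ violation (suc k) t i ℕ.+ violation k s i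
    by-cases false e = begin
      violation (suc k) s i ℕ.+ violation k t i  ≡⟨ cong₂ ℕ._+_ (cong (check (leq (r i) (G (suc k)))) (open-block e)) (cong (λ b → check b (imb i t k)) e) ⟩
      violation (suc k) t i ℕ.+ 0                ≡⟨ cong (violation (suc k) t i ℕ.+_) (sym (cong (λ b → check b (imb i s k)) e)) ⟩
      violation (suc k) t i ℕ.+ violation k s i  ∎
      where open ≡-Reasoning
    by-cases true e = trans (cong₂ ℕ._+_ (same s) refl) (trans (ℕ.+-comm (violation k s i) (violation k t i)) (cong (ℕ._+ violation k s i) (sym (same t))))
      where
      same : ∀ s → violation (suc k) s i ≡ violation k s i
      same s = cong₂ check (trans (leq-true (≤-trans (leq-true⁻¹ (r i) (G k) e) (G-step k))) (sym e)) (closed-block e s)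

  -- The common last cell increases both costs by the same amount, so the order of the costs is
  -- preserved.
  bellman : ∀ k s t → key k s ≡ key k t → s k ≡ t k → cost k s ℕ.≤ cost k t → cost (suc k) s ℕ.≤ cost (suc k) t
  bellman k s t eq sk le = ℕ.+-cancelʳ-≤ (cost k t) (cost (suc k) s) (cost (suc k) t)
    (ℕ.≤-trans (ℕ.≤-reflexive balance) (ℕ.+-monoʳ-≤ (cost (suc k) t) le))
    where
    V : ℕ → (ℕ → Bool) → ℕ
    V k s = ∑ℕ n (violation k s)
    violations : V (suc k) s ℕ.+ V k t ≡ V (suc k) t ℕ.+ V k s
    violations = trans (sym (∑ℕ-+ n (violation (suc k) s) (violation k t)))
      (trans (∑ℕ-cong n (violation-suc k s t eq sk)) (∑ℕ-+ n (violation (suc k) t) (violation k s)))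
    regroup : ∀ c v c′ v′ m → (c ℕ.+ m ℕ.* v) ℕ.+ (c′ ℕ.+ m ℕ.* v′) ≡ (c ℕ.+ c′) ℕ.+ m ℕ.* (v ℕ.+ v′)
    regroup = ℕ-Solver.solve-∀
    balance : cost (suc k) s ℕ.+ cost k t ≡ cost (suc k) t ℕ.+ cost k s
    balance = trans (regroup (changes s (suc k)) (V (suc k) s) (changes t k) (V k t) (suc n))
      (trans (cong₂ (λ a b → a ℕ.+ suc n ℕ.* b) (changes-suc k s t (proj₁ (key-injective k s t eq)) sk) violations)
             (sym (regroup (changes t (suc k)) (V (suc k) t) (changes s k) (V k s) (suc n))))

  cost-zero : ∀ s → cost 0 s ≡ 0
  cost-zero s = trans (cong (suc n ℕ.*_) (∑ℕ-zero n λ i i<n →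
      cong (λ b → if b then (if leq (h i * 0ℚ) ε ∧ leq (- ε) (h i * 0ℚ) then 0 else 1) else 0)
           (leq-false (subst (_< r i) (sym (grid-zero δ)) (≤-<-trans (0≤l i i<n) (l<r i i<n))))))
    (ℕ.*-zeroʳ (suc n))

  module _ (N : ℕ) (r≤G : ∀ i → i ℕ.< n → r i ≤ G N) where

    cost-balanced : ∀ s → changes s N ℕ.≤ n → (∀ i → i ℕ.< n → Within ε (h i * imb i s N)) → cost N s ℕ.≤ n
    cost-balanced s c≤n balanced = subst (ℕ._≤ n) (sym (trans
      (cong (λ v → changes s N ℕ.+ suc n ℕ.* v) (∑ℕ-zero n λ i i<n →
        cong₂ (λ a b → if a then (if b then 0 else 1) else 0) (leq-true (r≤G i i<n))
              (cong₂ _∧_ (leq-true (proj₂ (balanced i i<n))) (leq-true (proj₁ (balanced i i<n))))))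
      (trans (cong (changes s N ℕ.+_) (ℕ.*-zeroʳ (suc n))) (ℕ.+-identityʳ (changes s N))))) c≤n

    cost-balanced⁻¹ : ∀ s → cost N s ℕ.≤ n → changes s N ℕ.≤ n × (∀ i → i ℕ.< n → Within ε (h i * imb i s N))
    cost-balanced⁻¹ s c≤n = ℕ.≤-trans (ℕ.m≤m+n (changes s N) _) c≤n , λ i i<n → check i i<n
        (∑ℕ-zero⁻¹ n (small (∑ℕ n (violation N s)) (ℕ.≤-trans (ℕ.m≤n+m _ (changes s N)) c≤n)) i i<n)
      where
      -- A single violation already costs more than `n`.
      small : ∀ v → suc n ℕ.* v ℕ.≤ n → v ≡ 0
      small zero    _  = refl
      small (suc v) le = ⊥-elim (ℕ.<-irrefl refl (ℕ.≤-trans (ℕ.m≤m*n (suc n) (suc v)) le))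
      check : ∀ i → i ℕ.< n → violation N s i ≡ 0 → Within ε (h i * imb i s N)
      check i i<n v≡0 = within (zero⇒true _ (trans (sym (cong (λ a → if a then (if ok then 0 else 1) else 0) (leq-true (r≤G i i<n)))) v≡0))
        where
        ok : Bool
        ok = leq (h i * imb i s N) ε ∧ leq (- ε) (h i * imb i s N)
        zero⇒true : ∀ b → (if b then 0 else 1) ≡ 0 → b ≡ true
        zero⇒true true _ = refl
        within : ok ≡ true → Within ε (h i * imb i s N)
        within e = leq-true⁻¹ (- ε) (h i * imb i s N) (proj₂ (∧-true {leq (h i * imb i s N) ε} e))
                 , leq-true⁻¹ (h i * imb i s N) ε (proj₁ (∧-true e))

    key-final : ∀ s → key N s ≡ lastBit N s
    key-final s = encode-unmarked N N
      where
      unmarked : ∀ j → marked N j ≡ false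
      unmarked j = decide (marked N j) refl
        where
        none : ∃[ i ] i ℕ.< n × starts N j i ≡ true → ⊥
        none (i , i<n , st) = <-irrefl refl (<-≤-trans (proj₂ (proj₂ (starts⁻¹ N j i st))) (r≤G i i<n))
        decide : ∀ b → marked N j ≡ b → marked N j ≡ false
        decide false eq = eq
        decide true  eq = ⊥-elim (none (any-elim n eq))
      encode-unmarked : ∀ K j {len P} → encode (marked N) s j len P (lastBit K s) ≡ lastBit K s
      encode-unmarked K zero    = refl
      encode-unmarked K (suc j) {len} {P} = trans (if-false (unmarked j)) (encode-unmarked K j {suc len} {P ℕ.+ bit (s j)})
        where
        if-false : ∀ {b} {x y : ℕ} → b ≡ false → (if b then x else y) ≡ y
        if-false refl = refl

-- From sign sequences to cuttings

labelSign : ℕ → ℚ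
labelSign zero    = - 1ℚ
labelSign (suc _) = 1ℚ

labelSign-bit : ∀ b → labelSign (bit b) ≡ sgn b
labelSign-bit true  = refl
labelSign-bit false = refl

Increasing : ℕ → ℚ → (ℕ → ℚ) → ℚ → Set
Increasing zero    p x q = p < q
Increasing (suc m) p x q = p < x 0 × Increasing m (x 0) (x ∘ suc) q

-- `F` is a distribution function: `F q - F p` is the mass between `p` and `q`. The sum is the
-- signed mass of the labelled intervals.
signedSum : (ℚ → ℚ) → ℕ → ℚ → (ℕ → ℚ) → (ℕ → ℕ) → ℚ → ℚ
signedSum F zero    p x b q = labelSign (b 0) * (F q - F p)
signedSum F (suc m) p x b q = labelSign (b 0) * (F (x 0) - F p) + signedSum F m (x 0) (x ∘ suc) (b ∘ suc) q

increasing-< : ∀ m {p x q} → Increasing m p x q → p < q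
increasing-< zero    p<q        = p<q
increasing-< (suc m) (p<x , inc) = <-trans p<x (increasing-< m inc)

increasing-extend : ∀ m {p x q q′} → q < q′ → Increasing m p x q → Increasing m p x q′
increasing-extend zero    q<q′ p<q         = <-trans p<q q<q′
increasing-extend (suc m) q<q′ (p<x , inc) = p<x , increasing-extend m q<q′ inc

increasing-snoc : ∀ m {p p′ x x′ q q′} → p ≡ p′ → (∀ j → j ℕ.< m → x j ≡ x′ j) → x′ m ≡ q → q < q′ →
                  Increasing m p x q → Increasing (suc m) p′ x′ q′
increasing-snoc zero    refl eq refl q<q′ p<q         = p<q , q<q′
increasing-snoc (suc m) refl eq xm   q<q′ (p<x , inc) =
  subst (_ <_) (eq 0 (s≤s z≤n)) p<x , increasing-snoc m (eq 0 (s≤s z≤n)) (λ j j<m → eq (suc j) (s≤s j<m)) xm q<q′ inc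

signedSum-extend : ∀ F m p x b q q′ → signedSum F m p x b q′ ≡ signedSum F m p x b q + labelSign (b m) * (F q′ - F q)
signedSum-extend F zero    p x b q q′ = split (labelSign (b 0)) (F p) (F q) (F q′)
  where
  split : ∀ s a b c → s * (c - a) ≡ s * (b - a) + s * (c - b)
  split = solve-∀ ℚ-ring
signedSum-extend F (suc m) p x b q q′ = trans
  (cong (labelSign (b 0) * (F (x 0) - F p) +_) (signedSum-extend F m (x 0) (x ∘ suc) (b ∘ suc) q q′))
  (sym (+-assoc (labelSign (b 0) * (F (x 0) - F p)) (signedSum F m (x 0) (x ∘ suc) (b ∘ suc) q) (labelSign (b (suc m)) * (F q′ - F q))))

-- The primed arrays are those after a cut has been written. They are only required to agree with
-- the old ones on the entries in use, which is all that an update in place provides.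
signedSum-snoc : ∀ F m {p p′} x x′ b b′ {q} q′ → p ≡ p′ → (∀ j → j ℕ.< m → x j ≡ x′ j) → x′ m ≡ q →
                 (∀ j → j ℕ.≤ m → b j ≡ b′ j) →
                 signedSum F (suc m) p′ x′ b′ q′ ≡ signedSum F m p x b q + labelSign (b′ (suc m)) * (F q′ - F q)
signedSum-snoc F zero {p} x x′ b b′ q′ refl eqx refl eqb =
  cong (λ y → labelSign y * (F (x′ 0) - F p) + labelSign (b′ 1) * (F q′ - F (x′ 0))) (sym (eqb 0 z≤n))
signedSum-snoc F (suc m) {p} x x′ b b′ {q} q′ refl eqx xm eqb = trans
  (cong₂ _+_ (cong₂ (λ y z → labelSign y * (F z - F p)) (sym (eqb 0 z≤n)) (sym (eqx 0 (s≤s z≤n))))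
    (signedSum-snoc F m (x ∘ suc) (x′ ∘ suc) (b ∘ suc) (b′ ∘ suc) q′ (eqx 0 (s≤s z≤n))
      (λ j j<m → eqx (suc j) (s≤s j<m)) xm (λ j j≤m → eqb (suc j) (s≤s j≤m))))
  (sym (+-assoc (labelSign (b 0) * (F (x 0) - F p)) (signedSum F m (x 0) (x ∘ suc) (b ∘ suc) q) (labelSign (b′ (suc (suc m))) * (F q′ - F q))))

sumLabelled-difference : ∀ (f : ℚ × ℚ → ℚ) F → (∀ {p q} → p ≤ q → f (p , q) ≡ F q - F p) →
  ∀ m p x b → Increasing m p x 1ℚ →
  let ss = tabulate {n = suc m} (λ j → toSign (b (toℕ j)))
      Js = intervalsFrom p (tabulate {n = m} (λ j → x (toℕ j)))
  in sumLabelled Sign.+ f ss Js - sumLabelled Sign.- f ss Js ≡ signedSum F m p x b 1ℚ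
sumLabelled-difference f F eq zero p x b p<1 = single (b 0)
  where
  single : ∀ b → sumLabelled Sign.+ f (toSign b ∷ []) ((p , 1ℚ) ∷ []) - sumLabelled Sign.- f (toSign b ∷ []) ((p , 1ℚ) ∷ [])
               ≡ labelSign b * (F 1ℚ - F p)
  single zero    = trans (minus (f (p , 1ℚ))) (cong (- 1ℚ *_) (eq (<⇒≤ p<1)))
    where
    minus : ∀ a → 0ℚ - (a + 0ℚ) ≡ - 1ℚ * a
    minus = solve-∀ ℚ-ring
  single (suc _) = trans (plus (f (p , 1ℚ))) (cong (1ℚ *_) (eq (<⇒≤ p<1)))
    where
    plus : ∀ a → (a + 0ℚ) - 0ℚ ≡ 1ℚ * a
    plus = solve-∀ ℚ-ring
sumLabelled-difference f F eq (suc m) p x b (p<x , inc) = step (b 0)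
  where
  ss : Vec Sign.Sign (suc m)
  ss = tabulate (λ j → toSign (b (suc (toℕ j))))
  Js : Vec (ℚ × ℚ) (suc m)
  Js = intervalsFrom (x 0) (tabulate {n = m} (λ j → x (suc (toℕ j))))
  rest : sumLabelled Sign.+ f ss Js - sumLabelled Sign.- f ss Js ≡ signedSum F m (x 0) (x ∘ suc) (b ∘ suc) 1ℚ
  rest = sumLabelled-difference f F eq m (x 0) (x ∘ suc) (b ∘ suc) inc
  step : ∀ c → sumLabelled Sign.+ f (toSign c ∷ ss) ((p , x 0) ∷ Js) - sumLabelled Sign.- f (toSign c ∷ ss) ((p , x 0) ∷ Js)
             ≡ labelSign c * (F (x 0) - F p) + signedSum F m (x 0) (x ∘ suc) (b ∘ suc) 1ℚ
  step zero    = trans (minus (f (p , x 0)) (sumLabelled Sign.+ f ss Js) (sumLabelled Sign.- f ss Js))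
                       (cong₂ (λ y z → - 1ℚ * y + z) (eq (<⇒≤ p<x)) rest)
    where
    minus : ∀ a s t → s - (a + t) ≡ - 1ℚ * a + (s - t)
    minus = solve-∀ ℚ-ring
  step (suc _) = trans (plus (f (p , x 0)) (sumLabelled Sign.+ f ss Js) (sumLabelled Sign.- f ss Js))
                       (cong₂ (λ y z → 1ℚ * y + z) (eq (<⇒≤ p<x)) rest)
    where
    plus : ∀ a s t → (a + s) - t ≡ 1ℚ * a + (s - t)
    plus = solve-∀ ℚ-ring

increasing-inUnit : ∀ m {p x} → 0ℚ ≤ p → Increasing m p x 1ℚ → All InUnit (tabulate {n = m} (λ j → x (toℕ j)))
increasing-inUnit zero    0≤p inc         = []
increasing-inUnit (suc m) 0≤p (p<x , inc) =
  (≤-trans 0≤p (<⇒≤ p<x) , <⇒≤ (increasing-< m inc)) ∷ increasing-inUnit m (≤-trans 0≤p (<⇒≤ p<x)) inc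

increasing-linked : ∀ m {p x q} → Increasing m p x q → Linked _<_ (tabulate {n = m} (λ j → x (toℕ j)))
increasing-linked zero          inc                     = []
increasing-linked (suc zero)    inc                     = [-]
increasing-linked (suc (suc m)) {x = x} (_ , inc@(x₀<x₁ , _)) = x₀<x₁ ∷ increasing-linked (suc m) {x = x ∘ suc} inc

interval-coverage : ∀ {l r p q} → l ≤ r → p ≤ q → 0ℚ ⊔ ((r ⊓ q) - (l ⊔ p)) ≡ coverage l r q - coverage l r p
interval-coverage {l} {r} {p} {q} l≤r p≤q = by-cases (≤-total r p) (≤-total q l) (≤-total l p)
  where
  zero-difference : ∀ a b → (a - b) - (a - b) ≡ 0ℚ
  zero-difference = solve-∀ ℚ-ring
  equal-parts : ∀ a c → (a - a) - (c - c) ≡ 0ℚ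
  equal-parts = solve-∀ ℚ-ring
  nonpos : ∀ {a b} → a ≤ b → 0ℚ ⊔ (a - b) ≡ 0ℚ
  nonpos {a} {b} a≤b = p≥q⇒p⊔q≡p (subst (a - b ≤_) (+-inverseʳ b) (+-monoˡ-≤ (- b) a≤b))
  by-cases : r ≤ p ⊎ p ≤ r → q ≤ l ⊎ l ≤ q → l ≤ p ⊎ p ≤ l → 0ℚ ⊔ ((r ⊓ q) - (l ⊔ p)) ≡ coverage l r q - coverage l r p
  by-cases (inj₁ r≤p) _ _ = trans
    (trans (cong₂ (λ a b → 0ℚ ⊔ (a - b)) (p≤q⇒p⊓q≡p (≤-trans r≤p p≤q)) (p≤q⇒p⊔q≡q (≤-trans l≤r r≤p))) (nonpos r≤p))
    (sym (trans (cong₂ _-_ (cong₂ _-_ (p≤q⇒p⊓q≡p (≤-trans r≤p p≤q)) (p≤q⇒p⊓q≡p (≤-trans l≤r (≤-trans r≤p p≤q))))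
                           (cong₂ _-_ (p≤q⇒p⊓q≡p r≤p) (p≤q⇒p⊓q≡p (≤-trans l≤r r≤p)))) (zero-difference r l)))
  by-cases (inj₂ p≤r) (inj₁ q≤l) _ = trans
    (trans (cong₂ (λ a b → 0ℚ ⊔ (a - b)) (p≥q⇒p⊓q≡q (≤-trans q≤l l≤r)) (p≥q⇒p⊔q≡p (≤-trans p≤q q≤l))) (nonpos q≤l))
    (sym (trans (cong₂ _-_ (cong₂ _-_ (p≥q⇒p⊓q≡q (≤-trans q≤l l≤r)) (p≥q⇒p⊓q≡q q≤l))
                           (cong₂ _-_ (p≥q⇒p⊓q≡q p≤r) (p≥q⇒p⊓q≡q (≤-trans p≤q q≤l)))) (equal-parts q p)))
  by-cases (inj₂ p≤r) (inj₂ l≤q) c = trans (p≤q⇒p⊔q≡q (0≤q-p (⊔-lub (⊓-glb l≤r l≤q) (⊓-glb p≤r p≤q))))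
    (trans (rearrange c) (sym (cong₂ _-_ (cong (λ y → r ⊓ q - y) (p≤q⇒p⊓q≡p l≤q)) (cong (λ y → y - l ⊓ p) (p≥q⇒p⊓q≡q p≤r)))))
    where
    rearrange : l ≤ p ⊎ p ≤ l → (r ⊓ q) - (l ⊔ p) ≡ ((r ⊓ q) - l) - (p - l ⊓ p)
    rearrange (inj₁ l≤p) = trans (cong (λ y → (r ⊓ q) - y) (p≤q⇒p⊔q≡q l≤p))
      (trans (identity (r ⊓ q) l p) (cong (λ y → ((r ⊓ q) - l) - (p - y)) (sym (p≤q⇒p⊓q≡p l≤p))))
      where
      identity : ∀ a l p → a - p ≡ (a - l) - (p - l)
      identity = solve-∀ ℚ-ring
    rearrange (inj₂ p≤l) = trans (cong (λ y → (r ⊓ q) - y) (p≥q⇒p⊔q≡p p≤l))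
      (trans (identity (r ⊓ q) l p) (cong (λ y → ((r ⊓ q) - l) - (p - y)) (sym (p≥q⇒p⊓q≡q p≤l))))
      where
      identity : ∀ a l p → a - l ≡ (a - l) - (p - p)
      identity = solve-∀ ℚ-ring

mass-coverage : ∀ {n} (C : SingleBlock n) i {p q} → p ≤ q →
                mass C i (p , q) ≡ height C i * coverage (left C i) (right C i) q - height C i * coverage (left C i) (right C i) p
mass-coverage C i {p} {q} p≤q = trans
  (cong (height C i *_) (interval-coverage (<⇒≤ (left<right C i)) p≤q))
  (distrib (height C i) (coverage (left C i) (right C i) q) (coverage (left C i) (right C i) p))
  where
  distrib : ∀ h a b → h * (a - b) ≡ h * a - h * b
  distrib = solve-∀ ℚ-ring

-- A program logic

-- Total correctness with an upper bound for the time. Bounds, unlike exact times, follow from the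
-- shape of the program, whichever branches are taken.
record Runs (P : Program) (σ : Store) (T : ℕ) (Q : Store → Set) : Set where
  constructor runs
  field
    {time}    : ℕ
    {final}   : Store
    execution : P , σ ⇓[ time ] final
    time≤     : time ℕ.≤ T
    post      : Q final

setℕ : ℕ → ℕ → ℕ → Store → Store
setℕ a i x σ = store (update (nats σ) a i x) (rats σ)

setℚ : ℕ → ℕ → ℚ → Store → Store
setℚ a i x σ = store (nats σ) (update (rats σ) a i x)

runs-skip : ∀ {σ} {Q : Store → Set} → Q σ → Runs skip σ 1 Q
runs-skip q = runs ⇓skip ℕ.≤-refl q

runs-ℕ : ∀ {σ a e f} {Q : Store → Set} → Q (setℕ a (⟦ e ⟧ℕ σ) (⟦ f ⟧ℕ σ) σ) → Runs (a ! e ≔ℕ f) σ 1 Q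
runs-ℕ q = runs ⇓assignℕ ℕ.≤-refl q

runs-ℚ : ∀ {σ a e f} {Q : Store → Set} → Q (setℚ a (⟦ e ⟧ℕ σ) (⟦ f ⟧ℚ σ) σ) → Runs (a ! e ≔ℚ f) σ 1 Q
runs-ℚ q = runs ⇓assignℚ ℕ.≤-refl q

runs-seq : ∀ {P P′ σ s t} {Q : Store → Set} → Runs P σ s (λ τ → Runs P′ τ t Q) → Runs (P ⨾ P′) σ (s ℕ.+ t) Q
runs-seq (runs e₁ t₁ (runs e₂ t₂ q)) = runs (⇓seq e₁ e₂) (ℕ.+-mono-≤ t₁ t₂) q

runs-weaken : ∀ {P σ T T′} {Q Q′ : Store → Set} → T ℕ.≤ T′ → (∀ {τ} → Q τ → Q′ τ) → Runs P σ T Q → Runs P σ T′ Q′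
runs-weaken T≤ f (runs e t q) = runs e (ℕ.≤-trans t T≤) (f q)

runs-post : ∀ {P σ T} {Q Q′ : Store → Set} → (∀ {τ} → Q τ → Q′ τ) → Runs P σ T Q → Runs P σ T Q′
runs-post = runs-weaken ℕ.≤-refl

infixr 3 _then_

_then_ : ∀ {P P′ σ s t} {Q R : Store → Set} → Runs P σ s R → (∀ {τ} → R τ → Runs P′ τ t Q) → Runs (P ⨾ P′) σ (s ℕ.+ t) Q
p then f = runs-seq (runs-post f p)

runs-ℕ⨾ : ∀ {P σ a e f t} {Q : Store → Set} → Runs P (setℕ a (⟦ e ⟧ℕ σ) (⟦ f ⟧ℕ σ) σ) t Q → Runs (a ! e ≔ℕ f ⨾ P) σ (suc t) Q
runs-ℕ⨾ r = runs-seq (runs-ℕ r)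

runs-ℚ⨾ : ∀ {P σ a e f t} {Q : Store → Set} → Runs P (setℚ a (⟦ e ⟧ℕ σ) (⟦ f ⟧ℚ σ) σ) t Q → Runs (a ! e ≔ℚ f ⨾ P) σ (suc t) Q
runs-ℚ⨾ r = runs-seq (runs-ℚ r)

-- Both branches share one bound; several programs below pad the shorter branch by `skip` to fit it.
runs-if : ∀ {b P P′ σ T} {Q : Store → Set} → (⟦ b ⟧ᵇ σ ≡ true → Runs P σ T Q) → (⟦ b ⟧ᵇ σ ≡ false → Runs P′ σ T Q) →
          Runs (ifte b P P′) σ (suc T) Q
runs-if {b} {σ = σ} f g = by-cases (⟦ b ⟧ᵇ σ) refl
  where
  by-cases : ∀ c → ⟦ b ⟧ᵇ σ ≡ c → Runs (ifte b _ _) σ (suc _) _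
  by-cases true  eq with f eq
  ... | runs e t q = runs (⇓ifTrue eq e) (s≤s t) q
  by-cases false eq with g eq
  ... | runs e t q = runs (⇓ifFalse eq e) (s≤s t) q

-- A syntactic overestimate of the arrays that a program changes. It computes to a Boolean on
-- concrete programs, so that framing conditions are proved by `refl`.
writesℕ writesℚ : Program → ℕ → Bool
writesℕ skip         b = false
writesℕ (a ! _ ≔ℕ _) b = does (a ℕ.≟ b)
writesℕ (_ ! _ ≔ℚ _) b = false
writesℕ (P ⨾ P′)     b = writesℕ P b ∨ writesℕ P′ b
writesℕ (ifte _ P P′) b = writesℕ P b ∨ writesℕ P′ b
writesℕ (while _ P)  b = writesℕ P b
writesℚ skip         b = false
writesℚ (_ ! _ ≔ℕ _) b = false
writesℚ (a ! _ ≔ℚ _) b = does (a ℕ.≟ b)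
writesℚ (P ⨾ P′)     b = writesℚ P b ∨ writesℚ P′ b
writesℚ (ifte _ P P′) b = writesℚ P b ∨ writesℚ P′ b
writesℚ (while _ P)  b = writesℚ P b

record Frame (P : Program) (σ τ : Store) : Set where
  field
    frameℕ : ∀ b → writesℕ P b ≡ false → ∀ i → nats τ b i ≡ nats σ b i
    frameℚ : ∀ b → writesℚ P b ≡ false → ∀ i → rats τ b i ≡ rats σ b i

open Frame public

update-array : ∀ {A : Set} (m : ℕ → ℕ → A) a i x b → does (a ℕ.≟ b) ≡ false → ∀ j → update m a i x b j ≡ m b j
update-array m a i x b eq j rewrite eq = refl

update-same : ∀ {A : Set} (m : ℕ → ℕ → A) a i x → update m a i x a i ≡ x
update-same m a i x rewrite dec-true (a ℕ.≟ a) refl | dec-true (i ℕ.≟ i) refl = refl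

update-other : ∀ {A : Set} (m : ℕ → ℕ → A) a i x j → i ≢ j → update m a i x a j ≡ m a j
update-other m a i x j i≢j rewrite dec-true (a ℕ.≟ a) refl | dec-false (i ℕ.≟ j) i≢j = refl

update-at : ∀ {A : Set} (m : ℕ → ℕ → A) a i x {c} → i ≡ c → update m a i x a c ≡ x
update-at m a i x refl = update-same m a i x

x+1≡suc : ∀ {x y} → x ≡ y → x ℕ.+ 1 ≡ suc y
x+1≡suc {x} refl = ℕ.+-comm x 1

∨-false : ∀ {a b} → a ∨ b ≡ false → a ≡ false × b ≡ false
∨-false {false} {false} eq = refl , refl

frame : ∀ {P σ t τ} → P , σ ⇓[ t ] τ → Frame P σ τ
frame ⇓skip = record { frameℕ = λ _ _ _ → refl ; frameℚ = λ _ _ _ → refl }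
frame (⇓assignℕ {σ} {a} {e} {f}) = record
  { frameℕ = λ b eq i → update-array (nats σ) a (⟦ e ⟧ℕ σ) (⟦ f ⟧ℕ σ) b eq i ; frameℚ = λ _ _ _ → refl }
frame (⇓assignℚ {σ} {a} {e} {f}) = record
  { frameℕ = λ _ _ _ → refl ; frameℚ = λ b eq i → update-array (rats σ) a (⟦ e ⟧ℕ σ) (⟦ f ⟧ℚ σ) b eq i }
frame (⇓seq e e′) = record
  { frameℕ = λ b eq i → trans (frameℕ (frame e′) b (proj₂ (∨-false eq)) i) (frameℕ (frame e) b (proj₁ (∨-false eq)) i)
  ; frameℚ = λ b eq i → trans (frameℚ (frame e′) b (proj₂ (∨-false eq)) i) (frameℚ (frame e) b (proj₁ (∨-false eq)) i) }
frame (⇓ifTrue _ e) = record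
  { frameℕ = λ b eq → frameℕ (frame e) b (proj₁ (∨-false eq)) ; frameℚ = λ b eq → frameℚ (frame e) b (proj₁ (∨-false eq)) }
frame (⇓ifFalse {P = P} _ e) = record
  { frameℕ = λ b eq → frameℕ (frame e) b (proj₂ (∨-false {writesℕ P b} eq))
  ; frameℚ = λ b eq → frameℚ (frame e) b (proj₂ (∨-false {writesℚ P b} eq)) }
frame (⇓whileTrue _ e e′) = record
  { frameℕ = λ b eq i → trans (frameℕ (frame e′) b eq i) (frameℕ (frame e) b eq i)
  ; frameℚ = λ b eq i → trans (frameℚ (frame e′) b eq i) (frameℚ (frame e) b eq i) }
frame (⇓whileFalse _) = record { frameℕ = λ _ _ _ → refl ; frameℚ = λ _ _ _ → refl }

runs-frame : ∀ {P σ T} {Q : Store → Set} → Runs P σ T Q → Runs P σ T (λ τ → Q τ × Frame P σ τ)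
runs-frame (runs e t q) = runs e t (q , frame e)

-- The index of the invariant bounds the number of remaining iterations; a true guard must come with
-- a positive index.
runs-while : ∀ b P (T : ℕ) (I : ℕ → Store → Set) →
             (∀ {m σ} → I m σ → ⟦ b ⟧ᵇ σ ≡ true → ∃[ m′ ] m ≡ suc m′ × Runs P σ T (I m′)) →
             ∀ m {σ} → I m σ → Runs (while b P) σ (suc (m ℕ.* suc T)) (λ τ → (∃[ m ] I m τ) × ⟦ b ⟧ᵇ τ ≡ false)
runs-while b P T I body m {σ} inv = by-cases (⟦ b ⟧ᵇ σ) refl
  where
  Q : Store → Set
  Q τ = (∃[ m ] I m τ) × ⟦ b ⟧ᵇ τ ≡ false
  by-cases : ∀ c → ⟦ b ⟧ᵇ σ ≡ c → Runs (while b P) σ (suc (m ℕ.* suc T)) Q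
  by-cases false eq = runs (⇓whileFalse eq) (s≤s z≤n) ((m , inv) , eq)
  by-cases true  eq with body inv eq
  ... | m′ , refl , runs e t inv′ with runs-while b P T I body m′ inv′
  ...   | runs e′ t′ q = runs (⇓whileTrue eq e e′)
          (s≤s (ℕ.≤-trans (ℕ.+-mono-≤ t t′) (ℕ.≤-reflexive (ℕ.+-suc T (m′ ℕ.* suc T))))) q

var : ℕ → NExp
var a = a ! lit 0

forUp : ℕ → NExp → Program → Program
forUp v e P = while (leqℕ (add (var v) (lit 1)) e) (P ⨾ v ! lit 0 ≔ℕ add (var v) (lit 1))

forDown : ℕ → Program → Program
forDown v P = while (leqℕ (lit 1) (var v)) (v ! lit 0 ≔ℕ monus (var v) (lit 1) ⨾ P)

runs-forUp : ∀ v e P m T (I : ℕ → Store → Set) →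
             (∀ {j σ} → I j σ → nats σ v 0 ≡ j × ⟦ e ⟧ℕ σ ≡ m) →
             (∀ {j σ} → j ℕ.< m → I j σ → Runs P σ T (λ τ → I (suc j) (setℕ v 0 (nats τ v 0 ℕ.+ 1) τ))) →
             ∀ j {σ} → j ℕ.≤ m → I j σ → Runs (forUp v e P) σ (suc ((m ℕ.∸ j) ℕ.* (2 ℕ.+ T))) (I m)
runs-forUp v e P m T I reads body j {σ} j≤m inv =
  runs-weaken (ℕ.≤-reflexive (cong (λ t → suc ((m ℕ.∸ j) ℕ.* suc t)) (ℕ.+-comm T 1))) done
    (runs-while b (P ⨾ v ! lit 0 ≔ℕ add (var v) (lit 1)) (T ℕ.+ 1) Left iterate (m ℕ.∸ j) (j , ℕ.m+[n∸m]≡n j≤m , inv))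
  where
  b : BExp
  b = leqℕ (add (var v) (lit 1)) e
  Left : ℕ → Store → Set
  Left k σ = ∃[ j ] j ℕ.+ k ≡ m × I j σ
  guard : ∀ {j σ} → I j σ → ⟦ b ⟧ᵇ σ ≡ does (j ℕ.+ 1 ℕ.≤? m)
  guard inv = cong₂ (λ x y → does (x ℕ.+ 1 ℕ.≤? y)) (proj₁ (reads inv)) (proj₂ (reads inv))
  below : ∀ {j σ} → I j σ → ⟦ b ⟧ᵇ σ ≡ true → j ℕ.< m
  below {j} inv eq = subst (ℕ._≤ m) (ℕ.+-comm j 1) (does-true (j ℕ.+ 1 ℕ.≤? m) (trans (sym (guard inv)) eq))
  iterate : ∀ {k σ} → Left k σ → ⟦ b ⟧ᵇ σ ≡ true → ∃[ k′ ] k ≡ suc k′ × Runs (P ⨾ v ! lit 0 ≔ℕ add (var v) (lit 1)) σ (T ℕ.+ 1) (Left k′)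
  iterate {zero}  (j , eq , inv) t = ⊥-elim (ℕ.<-irrefl (trans (sym (ℕ.+-identityʳ j)) eq) (below inv t))
  iterate {suc k} (j , eq , inv) t = k , refl ,
    (body (below inv t) inv then λ inv′ → runs-ℕ (suc j , trans (sym (ℕ.+-suc j k)) eq , inv′))
  done : ∀ {τ} → (∃[ k ] Left k τ) × ⟦ b ⟧ᵇ τ ≡ false → I m τ
  done {τ} ((k , j , eq , inv) , f) = subst (λ j → I j τ) (ℕ.≤-antisym
    (subst (j ℕ.≤_) eq (ℕ.m≤m+n j k))
    (ℕ.≮⇒≥ λ j<m → does-false (j ℕ.+ 1 ℕ.≤? m) (trans (sym (guard inv)) f) (subst (ℕ._≤ m) (ℕ.+-comm 1 j) j<m))) inv

runs-forDown : ∀ v P T (I : ℕ → Store → Set) →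
               (∀ {j σ} → I j σ → nats σ v 0 ≡ j) →
               (∀ {j σ} → I (suc j) σ → Runs P (setℕ v 0 (nats σ v 0 ℕ.∸ 1) σ) T (I j)) →
               ∀ j {σ} → I j σ → Runs (forDown v P) σ (suc (j ℕ.* (2 ℕ.+ T))) (I 0)
runs-forDown v P T I reads body j {σ} inv = runs-post done (runs-while b (v ! lit 0 ≔ℕ monus (var v) (lit 1) ⨾ P) (1 ℕ.+ T) I iterate j inv)
  where
  b : BExp
  b = leqℕ (lit 1) (var v)
  guard : ∀ {j σ} → I j σ → ⟦ b ⟧ᵇ σ ≡ does (1 ℕ.≤? j)
  guard inv = cong (λ x → does (1 ℕ.≤? x)) (reads inv)
  iterate : ∀ {j σ} → I j σ → ⟦ b ⟧ᵇ σ ≡ true → ∃[ j′ ] j ≡ suc j′ × Runs (v ! lit 0 ≔ℕ monus (var v) (lit 1) ⨾ P) σ (1 ℕ.+ T) (I j′)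
  iterate {zero}  inv t = ⊥-elim (ℕ.<-irrefl refl (does-true (1 ℕ.≤? 0) (trans (sym (guard inv)) t)))
  iterate {suc j} inv t = j , refl , (runs-ℕ (body inv) then λ r → r)
  done : ∀ {τ} → (∃[ j ] I j τ) × ⟦ b ⟧ᵇ τ ≡ false → I 0 τ
  done {τ} ((zero  , inv) , f) = inv
  done {τ} ((suc j , inv) , f) = ⊥-elim (does-false (1 ℕ.≤? suc j) (trans (sym (guard inv)) f) (s≤s z≤n))

-- The program

-- The arrays of naturals 0, 1 and 2 hold n, the number of cuts and the labels.
cells# layer# j# i# offset# next# address# code# key# radix# len# plus# flag# viol# count# bits# powers# table# costs# : ℕ
cells#   = 10
layer#   = 11
j#       = 12
i#       = 13
offset#  = 14
next#    = 15
address# = 16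
code#    = 17
key#     = 18
radix#   = 19
len#     = 20
plus#    = 21
flag#    = 22
viol#    = 23
count#   = 24
bits#    = 30
powers#  = 31
table#   = 32
costs#   = 33

-- The arrays of rationals 0 to 4 hold ε, the endpoints and the heights of the
-- blocks, and the cuts.
cellsℚ# acc# before# after# grid# : ℕ
cellsℚ#  = 10
acc#     = 11
before#  = 12
after#   = 13
grid#    = 30

markCell : Program
markCell =
  flag# ! lit 0 ≔ℕ lit 0 ⨾
  i# ! lit 0 ≔ℕ lit 0 ⨾
  forUp i# (var 0)
    (ifte (andᵇ (leqℚ (grid# ! var j#) (1 ! var i#))
          (andᵇ (notᵇ (leqℚ (grid# ! add (lit 1) (var j#)) (1 ! var i#)))
                (notᵇ (leqℚ (2 ! var i#) (grid# ! var layer#)))))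
      (flag# ! lit 0 ≔ℕ lit 1)
      skip)

computeKey : Program
computeKey =
  key# ! lit 0 ≔ℕ bits# ! monus (var layer#) (lit 1) ⨾
  radix# ! lit 0 ≔ℕ lit 2 ⨾
  len# ! lit 0 ≔ℕ lit 0 ⨾
  plus# ! lit 0 ≔ℕ lit 0 ⨾
  j# ! lit 0 ≔ℕ var layer# ⨾
  forDown j#
    (markCell ⨾
     ifte (leqℕ (lit 1) (var flag#))
       (key# ! lit 0 ≔ℕ add (mul (var key#) (mul (lit 2) (add (lit 1) (var len#))))
                            (add (bits# ! var j#) (mul (lit 2) (var plus#))) ⨾
        radix# ! lit 0 ≔ℕ mul (var radix#) (mul (lit 2) (add (lit 1) (var len#))) ⨾
        len# ! lit 0 ≔ℕ lit 0 ⨾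
        plus# ! lit 0 ≔ℕ lit 0)
       (plus# ! lit 0 ≔ℕ add (var plus#) (bits# ! var j#) ⨾
        len# ! lit 0 ≔ℕ add (lit 1) (var len#) ⨾
        skip ⨾
        skip))

-- Here `plus#` holds the part of the code that is still to be decoded; the highest power is tested
-- first.
decode : Program
decode =
  j# ! lit 0 ≔ℕ var layer# ⨾
  plus# ! lit 0 ≔ℕ var code# ⨾
  forDown j#
    (ifte (leqℕ (powers# ! var j#) (var plus#))
       (bits# ! var j# ≔ℕ lit 1 ⨾
        plus# ! lit 0 ≔ℕ monus (var plus#) (powers# ! var j#))
       (bits# ! var j# ≔ℕ lit 0 ⨾
        skip))

varℚ : ℕ → QExp
varℚ a = a ! lit 0

rightEnd leftEnd addCell integrate : Program
rightEnd =
  ifte (leqℚ (2 ! var i#) (grid# ! add (lit 1) (var j#)))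
    (after# ! lit 0 ≔ℚ 2 ! var i#)
    (after# ! lit 0 ≔ℚ grid# ! add (lit 1) (var j#))
leftEnd =
  ifte (leqℚ (1 ! var i#) (grid# ! add (lit 1) (var j#)))
    (after# ! lit 0 ≔ℚ sub (varℚ after#) (1 ! var i#))
    (after# ! lit 0 ≔ℚ sub (varℚ after#) (grid# ! add (lit 1) (var j#)))
addCell =
  ifte (leqℕ (lit 1) (bits# ! var j#))
    (acc# ! lit 0 ≔ℚ add (varℚ acc#) (sub (varℚ after#) (varℚ before#)))
    (acc# ! lit 0 ≔ℚ sub (varℚ acc#) (sub (varℚ after#) (varℚ before#)))
integrate =
  acc# ! lit 0 ≔ℚ lit 0ℚ ⨾
  before# ! lit 0 ≔ℚ lit 0ℚ ⨾
  j# ! lit 0 ≔ℕ lit 0 ⨾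
  forUp j# (var layer#) (rightEnd ⨾ leftEnd ⨾ addCell ⨾ before# ! lit 0 ≔ℚ varℚ after#)

verdict checkBlocks : Program
verdict =
  ifte (andᵇ (leqℚ (mul (3 ! var i#) (varℚ acc#)) (varℚ 0))
             (leqℚ (sub (lit 0ℚ) (varℚ 0)) (mul (3 ! var i#) (varℚ acc#))))
    skip
    (viol# ! lit 0 ≔ℕ add (var viol#) (lit 1))
checkBlocks =
  viol# ! lit 0 ≔ℕ lit 0 ⨾
  i# ! lit 0 ≔ℕ lit 0 ⨾
  forUp i# (var 0) (ifte (leqℚ (2 ! var i#) (grid# ! var layer#)) (integrate ⨾ verdict) skip)

cutCell listCuts : Program
cutCell =
  ifte (andᵇ (leqℕ (bits# ! var j#) (bits# ! monus (var j#) (lit 1)))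
             (leqℕ (bits# ! monus (var j#) (lit 1)) (bits# ! var j#)))
    skip
    (4 ! var 1 ≔ℚ grid# ! var j# ⨾
     1 ! lit 0 ≔ℕ add (var 1) (lit 1) ⨾
     2 ! var 1 ≔ℕ bits# ! var j#)
listCuts =
  1 ! lit 0 ≔ℕ lit 0 ⨾
  2 ! lit 0 ≔ℕ bits# ! lit 0 ⨾
  j# ! lit 0 ≔ℕ lit 1 ⨾
  forUp j# (var layer#) cutCell

-- The number of cuts is part of the cost, so `listCuts` runs for every candidate and writes
-- straight into the output arrays. The last evaluation, of an optimal code, leaves the answer
-- there.
evaluate : Program
evaluate = decode ⨾ checkBlocks ⨾ computeKey ⨾ listCuts

slot total : NExp
slot  = add (var next#) (var key#)
total = add (var 1) (mul (add (lit 1) (var 0)) (var viol#))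

remember extendEntry searchLayer : Program
remember =
  ifte (andᵇ (leqℕ (lit 1) (table# ! slot)) (leqℕ (costs# ! slot) total))
    (skip ⨾ skip)
    (table# ! slot ≔ℕ add (lit 1) (var code#) ⨾
     costs# ! slot ≔ℕ total)

step : ℕ → Program
step b =
  -- `layer#` already counts the new cell, so the weight of the new sign is the power with exponent
  -- one less.
  code# ! lit 0 ≔ℕ add (monus (table# ! var address#) (lit 1))
                       (mul (lit b) (powers# ! monus (var layer#) (lit 1))) ⨾
  evaluate ⨾
  remember

extendEntry = ifte (leqℕ (lit 1) (table# ! var address#)) (step 0 ⨾ step 1) skip

searchLayer =
  -- What matters here is the radix: it is the size of the current layer, and the next layer is
  -- stored directly behind it.
  computeKey ⨾
  next# ! lit 0 ≔ℕ add (var offset#) (var radix#) ⨾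
  layer# ! lit 0 ≔ℕ add (lit 1) (var layer#) ⨾
  address# ! lit 0 ≔ℕ var offset# ⨾
  forUp address# (var next#) extendEntry ⨾
  offset# ! lit 0 ≔ℕ var next#

-- In the last layer no cell is marked, so the key is just the last sign.
search : Program
search =
  count# ! lit 0 ≔ℕ lit 0 ⨾
  forUp count# (var cells#) searchLayer ⨾
  code# ! lit 0 ≔ℕ monus (table# ! add (lit 1) (var offset#)) (lit 1) ⨾
  evaluate

-- Without a conversion between the two kinds of numbers, `N` is counted upwards as a natural and as
-- a rational at once. `M` is not in the input, so the count is driven by the heights: it ends with
-- the least `N` for which `N * ε` exceeds twice each of them.
countStep countCells : Program
countStep =
  ifte (leqℚ (mul (varℚ cellsℚ#) (varℚ 0)) (mul (lit (fromℕ 2)) (3 ! var i#)))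
    (cells# ! lit 0 ≔ℕ add (lit 1) (var cells#) ⨾
     cellsℚ# ! lit 0 ≔ℚ add (varℚ cellsℚ#) (lit 1ℚ))
    (i# ! lit 0 ≔ℕ add (lit 1) (var i#) ⨾
     skip)
countCells =
  i# ! lit 0 ≔ℕ lit 0 ⨾
  while (leqℕ (add (lit 1) (var i#)) (var 0)) countStep

gridStep buildGrid : Program
gridStep =
  grid# ! add (lit 1) (var j#) ≔ℚ add (grid# ! var j#) (div (lit 1ℚ) (varℚ cellsℚ#)) ⨾
  powers# ! add (lit 1) (var j#) ≔ℕ mul (lit 2) (powers# ! var j#)
buildGrid =
  powers# ! lit 0 ≔ℕ lit 1 ⨾
  j# ! lit 0 ≔ℕ lit 0 ⨾
  forUp j# (var cells#) gridStep

-- If `ε` is at least 1, or if there are no blocks, the output cells still contain 0: no cuts, and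
-- one interval labelled minus, which is a solution.
consensusHalving : Program
consensusHalving =
  ifte (leqℚ (lit 1ℚ) (varℚ 0))
    skip
    (ifte (leqℕ (var 0) (lit 0))
      skip
      (countCells ⨾
       buildGrid ⨾
       table# ! lit 0 ≔ℕ lit 1 ⨾
       search))

∨-true : ∀ {a} b → a ≡ true → a ∨ b ≡ true
∨-true b refl = refl

if-true : ∀ {A : Set} {b} {x y : A} → b ≡ true → (if b then x else y) ≡ x
if-true refl = refl

if-false : ∀ {A : Set} {b} {x y : A} → b ≡ false → (if b then x else y) ≡ y
if-false refl = refl

-- Correctness and step counts of the subroutines

module Specs (n N : ℕ) (l r h : ℕ → ℚ) (δ ε : ℚ)
             (0<δ : 0ℚ < δ) (0≤l : ∀ i → i ℕ.< n → 0ℚ ≤ l i) (l<r : ∀ i → i ℕ.< n → l i < r i) where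

  open Dynamic n l r h δ ε 0<δ 0≤l l<r

  -- The parameters are the contents of cells instead of a store. An assignment to another array
  -- then preserves `Env` definitionally, since comparing literal array numbers reduces, and no
  -- proof has to be rebuilt.
  record Constants (n₀ N₀ : ℕ) (ε₀ : ℚ) (l₀ r₀ h₀ G₀ : ℕ → ℚ) (pow₀ : ℕ → ℕ) : Set where
    field
      n≡   : n₀ ≡ n
      N≡   : N₀ ≡ N
      ε≡   : ε₀ ≡ ε
      l≡   : ∀ i → l₀ i ≡ l i
      r≡   : ∀ i → r₀ i ≡ r i
      h≡   : ∀ i → h₀ i ≡ h i
      G≡   : ∀ j → j ℕ.≤ N → G₀ j ≡ G j
      pow≡ : ∀ j → j ℕ.≤ N → pow₀ j ≡ 2 ℕ.^ j

  open Constants public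

  Env : Store → Set
  Env σ = Constants (nats σ 0 0) (nats σ cells# 0) (rats σ 0 0) (rats σ 1) (rats σ 2) (rats σ 3) (rats σ grid#) (nats σ powers#)

  Keeps : Program → Set
  Keeps P = (writesℕ P 0 ≡ false × writesℕ P cells# ≡ false × writesℕ P powers# ≡ false)
          × (writesℚ P 0 ≡ false × writesℚ P 1 ≡ false × writesℚ P 2 ≡ false × writesℚ P 3 ≡ false × writesℚ P grid# ≡ false)

  env-frame : ∀ {P σ τ} → Keeps P → Frame P σ τ → Env σ → Env τ
  env-frame ((a , b , c) , (d , e , f , g , i)) fr env = record
    { n≡ = trans (frameℕ fr 0 a 0) (n≡ env)
    ; N≡ = trans (frameℕ fr cells# b 0) (N≡ env)
    ; ε≡ = trans (frameℚ fr 0 d 0) (ε≡ env)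
    ; l≡ = λ j → trans (frameℚ fr 1 e j) (l≡ env j)
    ; r≡ = λ j → trans (frameℚ fr 2 f j) (r≡ env j)
    ; h≡ = λ j → trans (frameℚ fr 3 g j) (h≡ env j)
    ; G≡ = λ j j≤N → trans (frameℚ fr grid# i j) (G≡ env j j≤N)
    ; pow≡ = λ j j≤N → trans (frameℕ fr powers# c j) (pow≡ env j j≤N)
    }

  t-mark : ℕ
  t-mark = 1 ℕ.+ (1 ℕ.+ suc (n ℕ.* 4))

  runs-markCell : ∀ {σ} k j → Env σ → k ℕ.≤ N → j ℕ.< N → nats σ layer# 0 ≡ k → nats σ j# 0 ≡ j →
                  Runs markCell σ t-mark (λ τ → nats τ flag# 0 ≡ bit (marked k j))
  runs-markCell {σ₀} k j env₀ k≤N j<N k≡₀ j≡₀ =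
    runs-ℕ⨾ (runs-ℕ⨾ (runs-post (λ { (_ , _ , _ , _ , f) → f })
      (runs-forUp i# (var 0) _ n 2 I (λ { (i≡ , env , _) → i≡ , n≡ env }) body 0 z≤n (refl , env₀ , k≡₀ , j≡₀ , refl))))
    where
    I : ℕ → Store → Set
    I i σ = nats σ i# 0 ≡ i × Env σ × nats σ layer# 0 ≡ k × nats σ j# 0 ≡ j × nats σ flag# 0 ≡ bit (any i (starts k j))
    body : ∀ {i σ} → i ℕ.< n → I i σ → Runs _ σ 2 (λ τ → I (suc i) (setℕ i# 0 (nats τ i# 0 ℕ.+ 1) τ))
    body {i} {σ} i<n (i≡ , env , k≡ , j≡ , f≡) = runs-if
      (λ t → runs-ℕ (x+1≡suc i≡ , env , k≡ , j≡ , sym (cong bit (∨-true {starts k j i} (any i (starts k j)) (trans (sym guard) t)))))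
      (λ t → runs-skip (x+1≡suc i≡ , env , k≡ , j≡ , trans f≡ (cong (λ b → bit (b ∨ any i (starts k j))) (sym (trans (sym guard) t)))))
      where
      grid≡ : ∀ {x} y → y ℕ.≤ N → x ≡ y → rats σ grid# x ≡ G y
      grid≡ y y≤N refl = G≡ env y y≤N
      l≡′ : rats σ 1 (nats σ i# 0) ≡ l i
      l≡′ = trans (cong (rats σ 1) i≡) (l≡ env i)
      r≡′ : rats σ 2 (nats σ i# 0) ≡ r i
      r≡′ = trans (cong (rats σ 2) i≡) (r≡ env i)
      guard : leq (rats σ grid# (nats σ j# 0)) (rats σ 1 (nats σ i# 0)) ∧
              (not (leq (rats σ grid# (suc (nats σ j# 0))) (rats σ 1 (nats σ i# 0))) ∧
               not (leq (rats σ 2 (nats σ i# 0)) (rats σ grid# (nats σ layer# 0)))) ≡ starts k j i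
      guard = cong₂ _∧_ (cong₂ leq (grid≡ j (ℕ.<⇒≤ j<N) j≡) l≡′)
        (cong₂ _∧_ (cong not (cong₂ leq (grid≡ (suc j) j<N (cong suc j≡)) l≡′)) (cong not (cong₂ leq r≡′ (grid≡ k k≤N k≡))))

  t-key : ℕ → ℕ
  t-key k = 5 ℕ.+ suc (k ℕ.* (2 ℕ.+ (t-mark ℕ.+ 5)))

  -- The radix is correct even if the array of bits contains garbage.
  KeyComputed : ℕ → (ℕ → ℕ) → Store → Set
  KeyComputed k b τ = nats τ radix# 0 ≡ keys k ×
    (∀ s → (∀ c → c ℕ.< k → b c ≡ bit (s c)) → nats τ key# 0 ≡ encode (marked k) s k 0 0 (b (k ℕ.∸ 1)))

  -- `radix` and `encode` are tail recursive and have the program variables as accumulators. The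
  -- invariant says that the recursion continued from the current variables ends in the desired
  -- result.
  runs-computeKey : ∀ {σ} k → Env σ → k ℕ.≤ N → nats σ layer# 0 ≡ k → Runs computeKey σ (t-key k) (KeyComputed k (nats σ bits#))
  runs-computeKey {σ₀} k env₀ k≤N k≡₀ =
    runs-ℕ⨾ (runs-ℕ⨾ (runs-ℕ⨾ (runs-ℕ⨾ (runs-ℕ⨾ (runs-post done
      (runs-forDown j# _ (t-mark ℕ.+ 5) I (λ inv → j-value inv) body k (record
        { j-value = k≡₀ ; j≤k = ℕ.≤-refl ; env = env₀ ; k-value = k≡₀ ; same-bits = λ _ → refl ; radix-left = refl
        ; key-left = λ s _ → cong (λ x → encode (marked k) s k 0 0 (b (x ℕ.∸ 1))) k≡₀ })))))))
    where
    b : ℕ → ℕ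
    b = nats σ₀ bits#
    record I (j : ℕ) (σ : Store) : Set where
      field
        j-value    : nats σ j# 0 ≡ j
        j≤k        : j ℕ.≤ k
        env        : Env σ
        k-value    : nats σ layer# 0 ≡ k
        same-bits  : ∀ c → nats σ bits# c ≡ b c
        radix-left : radix (marked k) j (nats σ len# 0) (nats σ radix# 0) ≡ keys k
        key-left   : ∀ s → (∀ c → c ℕ.< k → b c ≡ bit (s c)) →
                     encode (marked k) s j (nats σ len# 0) (nats σ plus# 0) (nats σ key# 0) ≡ encode (marked k) s k 0 0 (b (k ℕ.∸ 1))
    open I
    done : ∀ {τ} → I 0 τ → KeyComputed k b τ
    done inv = radix-left inv , key-left inv
    body : ∀ {j σ} → I (suc j) σ → Runs _ (setℕ j# 0 (nats σ j# 0 ℕ.∸ 1) σ) (t-mark ℕ.+ 5) (I j)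
    body {j} {σ} inv = runs-frame (runs-markCell k j (env inv) k≤N (ℕ.≤-trans (j≤k inv) k≤N) (k-value inv) j≡) then after
      where
      σ′ : Store
      σ′ = setℕ j# 0 (nats σ j# 0 ℕ.∸ 1) σ
      j≡ : nats σ j# 0 ℕ.∸ 1 ≡ j
      j≡ = cong (ℕ._∸ 1) (j-value inv)
      after : ∀ {τ} → nats τ flag# 0 ≡ bit (marked k j) × Frame markCell σ′ τ → Runs _ τ 5 (I j)
      after {τ} (flag≡ , fr) = runs-if
        (λ t → runs-ℕ⨾ (runs-ℕ⨾ (runs-ℕ⨾ (runs-ℕ (record
          { j-value = j-value′ ; j≤k = ℕ.<⇒≤ (j≤k inv) ; env = env′ ; k-value = k-value′ ; same-bits = same-bits′
          ; radix-left = trans (sym (trans (if-true (is-marked t)) (cong (radix (marked k) j 0) (sym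
              (cong₂ (λ x y → x ℕ.* (2 ℕ.* suc y)) (frameℕ fr radix# refl 0) (frameℕ fr len# refl 0)))))) (radix-left inv)
          ; key-left = λ s bits → trans (sym (trans (if-true (is-marked t)) (cong (encode (marked k) s j 0 0) (sym
              (cong₂ ℕ._+_ (cong₂ (λ x y → x ℕ.* (2 ℕ.* suc y)) (frameℕ fr key# refl 0) (frameℕ fr len# refl 0))
                           (cong₂ (λ x y → x ℕ.+ 2 ℕ.* y) (bit-value s bits) (frameℕ fr plus# refl 0))))))) (key-left inv s bits) })))))
        (λ f → runs-ℕ⨾ (runs-ℕ⨾ (runs-seq (runs-skip (runs-skip (record
          { j-value = j-value′ ; j≤k = ℕ.<⇒≤ (j≤k inv) ; env = env′ ; k-value = k-value′ ; same-bits = same-bits′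
          ; radix-left = trans (sym (trans (if-false (is-unmarked f)) (sym
              (cong₂ (λ x y → radix (marked k) j (suc x) y) (frameℕ fr len# refl 0) (frameℕ fr radix# refl 0))))) (radix-left inv)
          ; key-left = λ s bits → trans (sym (trans (if-false (is-unmarked f)) (sym
              (trans (cong₂ (λ x y → encode (marked k) s j (suc x) y (nats τ key# 0)) (frameℕ fr len# refl 0)
                        (cong₂ ℕ._+_ (frameℕ fr plus# refl 0) (bit-value s bits)))
                     (cong (encode (marked k) s j (suc (nats σ len# 0)) (nats σ plus# 0 ℕ.+ bit (s j))) (frameℕ fr key# refl 0))))))
              (key-left inv s bits) }))))))
        where
        j-value′ : nats τ j# 0 ≡ j
        j-value′ = trans (frameℕ fr j# refl 0) j≡
        env′ : Env τ
        env′ = env-frame {markCell} ((refl , refl , refl) , (refl , refl , refl , refl , refl)) fr (env inv)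
        k-value′ : nats τ layer# 0 ≡ k
        k-value′ = trans (frameℕ fr layer# refl 0) (k-value inv)
        same-bits′ : ∀ c → nats τ bits# c ≡ b c
        same-bits′ c = trans (frameℕ fr bits# refl c) (same-bits inv c)
        bit-value : ∀ s → (∀ c → c ℕ.< k → b c ≡ bit (s c)) → nats τ bits# (nats τ j# 0) ≡ bit (s j)
        bit-value s bits = trans (same-bits′ (nats τ j# 0)) (trans (cong b j-value′) (bits j (j≤k inv)))
        is-marked : does (1 ℕ.≤? nats τ flag# 0) ≡ true → marked k j ≡ true
        is-marked t = go (marked k j) (trans (sym (cong (λ x → does (1 ℕ.≤? x)) flag≡)) t)
          where
          go : ∀ m → does (1 ℕ.≤? bit m) ≡ true → m ≡ true
          go true _ = refl
        is-unmarked : does (1 ℕ.≤? nats τ flag# 0) ≡ false → marked k j ≡ false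
        is-unmarked t = go (marked k j) (trans (sym (cong (λ x → does (1 ℕ.≤? x)) flag≡)) t)
          where
          go : ∀ m → does (1 ℕ.≤? bit m) ≡ false → m ≡ false
          go false _ = refl

  codeOf : (ℕ → Bool) → ℕ → ℕ
  codeOf s k = ∑ℕ k (λ j → bit (s j) ℕ.* 2 ℕ.^ j)

  codeOf< : ∀ s k → codeOf s k ℕ.< 2 ℕ.^ k
  codeOf< s zero    = s≤s z≤n
  codeOf< s (suc k) = ℕ.+-mono-≤ (codeOf< s k) (ℕ.*-monoˡ-≤ (2 ℕ.^ k) (bit≤1 (s k)))

  Bits : ℕ → (ℕ → Bool) → Store → Set
  Bits k s σ = ∀ c → c ℕ.< k → nats σ bits# c ≡ bit (s c)

  t-decode : ℕ → ℕ
  t-decode k = 2 ℕ.+ suc (k ℕ.* (2 ℕ.+ 3))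

  -- Greedy subtraction finds the bits because the lower `j` bits together stay below the power of
  -- two with exponent `j`.
  runs-decode : ∀ {σ} k s → Env σ → k ℕ.≤ N → nats σ layer# 0 ≡ k → nats σ code# 0 ≡ codeOf s k →
                Runs decode σ (t-decode k) (Bits k s)
  runs-decode {σ₀} k s env₀ k≤N k≡₀ code≡ = runs-ℕ⨾ (runs-ℕ⨾ (runs-post (λ inv c c<k → bits-done inv c z≤n c<k)
    (runs-forDown j# _ 3 I (λ inv → j-value inv) body k (record
      { j-value = k≡₀ ; j≤k = ℕ.≤-refl ; env = env₀ ; rest = code≡ ; bits-done = λ c k≤c c<k → ⊥-elim (ℕ.<⇒≱ c<k k≤c) }))))
    where
    record I (j : ℕ) (σ : Store) : Set where
      field
        j-value   : nats σ j# 0 ≡ j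
        j≤k       : j ℕ.≤ k
        env       : Env σ
        rest      : nats σ plus# 0 ≡ codeOf s j
        bits-done : ∀ c → j ℕ.≤ c → c ℕ.< k → nats σ bits# c ≡ bit (s c)
    open I
    body : ∀ {j σ} → I (suc j) σ → Runs _ (setℕ j# 0 (nats σ j# 0 ℕ.∸ 1) σ) 3 (I j)
    body {j} {σ} inv = runs-if
      (λ t → runs-ℕ⨾ (runs-ℕ (record
        { j-value = j≡ ; j≤k = ℕ.<⇒≤ (j≤k inv) ; env = env inv
        ; rest = trans (cong₂ ℕ._∸_ (rest inv) pow≡′) (trans (cong (λ b → codeOf s j ℕ.+ bit b ℕ.* 2 ℕ.^ j ℕ.∸ 2 ℕ.^ j) (plus t))
                   (trans (cong (λ x → codeOf s j ℕ.+ x ℕ.∸ 2 ℕ.^ j) (ℕ.*-identityˡ (2 ℕ.^ j))) (ℕ.m+n∸n≡m (codeOf s j) (2 ℕ.^ j))))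
        ; bits-done = bits-done′ 1 (cong bit (sym (plus t))) })))
      (λ f → runs-ℕ⨾ (runs-skip (record
        { j-value = j≡ ; j≤k = ℕ.<⇒≤ (j≤k inv) ; env = env inv
        ; rest = trans (rest inv) (trans (cong (λ b → codeOf s j ℕ.+ bit b ℕ.* 2 ℕ.^ j) (minus f)) (ℕ.+-identityʳ (codeOf s j)))
        ; bits-done = bits-done′ 0 (cong bit (sym (minus f))) })))
      where
      j≡ : nats σ j# 0 ℕ.∸ 1 ≡ j
      j≡ = cong (ℕ._∸ 1) (j-value inv)
      pow≡′ : nats σ powers# (nats σ j# 0 ℕ.∸ 1) ≡ 2 ℕ.^ j
      pow≡′ = trans (cong (nats σ powers#) j≡) (pow≡ (env inv) j (ℕ.≤-trans (ℕ.<⇒≤ (j≤k inv)) k≤N))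
      test : does (nats σ powers# (nats σ j# 0 ℕ.∸ 1) ℕ.≤? nats σ plus# 0) ≡ does (2 ℕ.^ j ℕ.≤? codeOf s (suc j))
      test = cong₂ (λ x y → does (x ℕ.≤? y)) pow≡′ (rest inv)
      plus : does (nats σ powers# (nats σ j# 0 ℕ.∸ 1) ℕ.≤? nats σ plus# 0) ≡ true → s j ≡ true
      plus t = go (s j) (does-true (2 ℕ.^ j ℕ.≤? codeOf s (suc j)) (trans (sym test) t))
        where
        go : ∀ b → 2 ℕ.^ j ℕ.≤ codeOf s j ℕ.+ bit b ℕ.* 2 ℕ.^ j → b ≡ true
        go true  _  = refl
        go false le = ⊥-elim (ℕ.<⇒≱ (codeOf< s j) (subst (2 ℕ.^ j ℕ.≤_) (ℕ.+-identityʳ (codeOf s j)) le))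
      minus : does (nats σ powers# (nats σ j# 0 ℕ.∸ 1) ℕ.≤? nats σ plus# 0) ≡ false → s j ≡ false
      minus f = go (s j) (does-false (2 ℕ.^ j ℕ.≤? codeOf s (suc j)) (trans (sym test) f))
        where
        go : ∀ b → ¬ 2 ℕ.^ j ℕ.≤ codeOf s j ℕ.+ bit b ℕ.* 2 ℕ.^ j → b ≡ false
        go false _  = refl
        go true  ¬le = ⊥-elim (¬le (ℕ.≤-trans (ℕ.≤-reflexive (sym (ℕ.*-identityˡ (2 ℕ.^ j)))) (ℕ.m≤n+m (1 ℕ.* 2 ℕ.^ j) (codeOf s j))))
      bits-done′ : ∀ x → x ≡ bit (s j) → ∀ c → j ℕ.≤ c → c ℕ.< k →
                   update (nats σ) bits# (nats σ j# 0 ℕ.∸ 1) x bits# c ≡ bit (s c)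
      bits-done′ x x≡ c j≤c c<k with ℕ.m≤n⇒m<n∨m≡n j≤c
      ... | inj₂ refl = trans (update-at (nats σ) bits# (nats σ j# 0 ℕ.∸ 1) x j≡) x≡
      ... | inj₁ j<c  = trans (update-other (nats σ) bits# (nats σ j# 0 ℕ.∸ 1) x c (λ eq → ℕ.<⇒≢ j<c (trans (sym j≡) eq))) (bits-done inv c j<c c<k)

  is-true : ∀ {x b} → x ≡ bit b → does (1 ℕ.≤? x) ≡ true → b ≡ true
  is-true {b = true}  refl t = refl

  is-false : ∀ {x b} → x ≡ bit b → does (1 ℕ.≤? x) ≡ false → b ≡ false
  is-false {b = false} refl t = refl

  t-integrate : ℕ → ℕ
  t-integrate k = 3 ℕ.+ suc (k ℕ.* (2 ℕ.+ 7))

  runs-integrate : ∀ {σ} k s i → i ℕ.< n → Env σ → k ℕ.≤ N → nats σ layer# 0 ≡ k → nats σ i# 0 ≡ i → Bits k s σ →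
                   Runs integrate σ (t-integrate k) (λ τ → rats τ acc# 0 ≡ imb i s k)
  runs-integrate {σ₀} k s i i<n env₀ k≤N k≡₀ i≡₀ bits₀ = runs-ℚ⨾ (runs-ℚ⨾ (runs-ℕ⨾ (runs-post (λ { (_ , acc≡ , _) → acc≡ })
    (runs-forUp j# (var layer#) _ k 7 I (λ { ((_ , k≡ , _ , _ , j≡) , _) → j≡ , k≡ }) body 0 z≤n
      ((env₀ , k≡₀ , i≡₀ , bits₀ , refl) , refl , sym start)))))
    where
    start : coverage (l i) (r i) (G 0) ≡ 0ℚ
    start = trans (cong₂ _-_ (p≥q⇒p⊓q≡q (≤-trans G0≤ (<⇒≤ (l<r i i<n)))) (p≥q⇒p⊓q≡q G0≤)) (+-inverseʳ (G 0))
      where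
      G0≤ : G 0 ≤ l i
      G0≤ = subst (_≤ l i) (sym (grid-zero δ)) (0≤l i i<n)
    Fixed : ℕ → Store → Set
    Fixed j σ = Env σ × nats σ layer# 0 ≡ k × nats σ i# 0 ≡ i × Bits k s σ × nats σ j# 0 ≡ j
    I : ℕ → Store → Set
    I j σ = Fixed j σ × rats σ acc# 0 ≡ imb i s j × rats σ before# 0 ≡ coverage (l i) (r i) (G j)
    r≡′ : ∀ {j σ} → Fixed j σ → rats σ 2 (nats σ i# 0) ≡ r i
    r≡′ {σ = σ} (env , _ , i≡ , _) = trans (cong (rats σ 2) i≡) (r≡ env i)
    l≡′ : ∀ {j σ} → Fixed j σ → rats σ 1 (nats σ i# 0) ≡ l i
    l≡′ {σ = σ} (env , _ , i≡ , _) = trans (cong (rats σ 1) i≡) (l≡ env i)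
    G≡′ : ∀ {j σ} → j ℕ.< k → Fixed j σ → rats σ grid# (suc (nats σ j# 0)) ≡ G (suc j)
    G≡′ {j} {σ} j<k (env , _ , _ , _ , j≡) = trans (cong (λ x → rats σ grid# (suc x)) j≡) (G≡ env (suc j) (ℕ.≤-trans j<k k≤N))
    min-left : ∀ {x y p q} → x ≡ p → y ≡ q → leq x y ≡ true → x ≡ p ⊓ q
    min-left {p = p} {q} refl refl t = sym (p≤q⇒p⊓q≡p (leq-true⁻¹ p q t))
    min-right : ∀ {x y p q} → x ≡ p → y ≡ q → leq x y ≡ false → y ≡ p ⊓ q
    min-right {p = p} {q} refl refl f = sym (p≥q⇒p⊓q≡q (<⇒≤ (leq-false⁻¹ p q f)))
    After : ℚ → ℕ → Store → Set
    After x j σ = I j σ × rats σ after# 0 ≡ x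
    runs-rightEnd : ∀ {j σ} → j ℕ.< k → I j σ → Runs rightEnd σ 2 (After (r i ⊓ G (suc j)) j)
    runs-rightEnd {j} {σ} j<k inv@(fixed , _) = runs-if
      (λ t → runs-ℚ (inv , min-left (r≡′ {j} {σ} fixed) (G≡′ {j} {σ} j<k fixed) t))
      (λ f → runs-ℚ (inv , min-right (r≡′ {j} {σ} fixed) (G≡′ {j} {σ} j<k fixed) f))
    runs-leftEnd : ∀ {j σ} → j ℕ.< k → After (r i ⊓ G (suc j)) j σ → Runs leftEnd σ 2 (After (coverage (l i) (r i) (G (suc j))) j)
    runs-leftEnd {j} {σ} j<k (inv@(fixed , _) , after≡) = runs-if
      (λ t → runs-ℚ (inv , cong₂ _-_ after≡ (min-left (l≡′ {j} {σ} fixed) (G≡′ {j} {σ} j<k fixed) t)))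
      (λ f → runs-ℚ (inv , cong₂ _-_ after≡ (min-right (l≡′ {j} {σ} fixed) (G≡′ {j} {σ} j<k fixed) f)))
    runs-addCell : ∀ {j σ} → j ℕ.< k → After (coverage (l i) (r i) (G (suc j))) j σ → Runs addCell σ 2
      (λ τ → Fixed j τ × rats τ acc# 0 ≡ imb i s (suc j) × rats τ after# 0 ≡ coverage (l i) (r i) (G (suc j)))
    runs-addCell {j} {σ} j<k ((fixed , acc≡ , before≡) , after≡) = runs-if
      (λ t → runs-ℚ (fixed , trans (cong₂ _+_ acc≡ (cong₂ _-_ after≡ before≡)) (cong (imb i s j +_) (positive-sign (is-true bit≡ t))) , after≡))
      (λ f → runs-ℚ (fixed , trans (cong₂ _-_ acc≡ (cong₂ _-_ after≡ before≡)) (cong (imb i s j +_) (negative-sign (is-false bit≡ f))) , after≡))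
      where
      bit≡ : nats σ bits# (nats σ j# 0) ≡ bit (s j)
      bit≡ = trans (cong (nats σ bits#) (proj₂ (proj₂ (proj₂ (proj₂ fixed))))) (proj₁ (proj₂ (proj₂ (proj₂ fixed))) j j<k)
      positive-sign : s j ≡ true → gain i j ≡ sgn (s j) * gain i j
      positive-sign eq = trans (sym (*-identityˡ (gain i j))) (cong (λ b → sgn b * gain i j) (sym eq))
      negative-sign : s j ≡ false → - gain i j ≡ sgn (s j) * gain i j
      negative-sign eq = trans (trans (cong -_ (sym (*-identityˡ (gain i j)))) (neg-distribˡ-* 1ℚ (gain i j)))
                               (cong (λ b → sgn b * gain i j) (sym eq))
    body : ∀ {j σ} → j ℕ.< k → I j σ →
           Runs (rightEnd ⨾ leftEnd ⨾ addCell ⨾ before# ! lit 0 ≔ℚ varℚ after#) σ 7 (λ τ → I (suc j) (setℕ j# 0 (nats τ j# 0 ℕ.+ 1) τ))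
    body {j} {σ} j<k inv =
      runs-rightEnd {j} {σ} j<k inv then λ {τ} p → runs-leftEnd {j} {τ} j<k p then λ {τ} p → runs-addCell {j} {τ} j<k p then
      λ { ((env , k≡ , i≡ , bits , j≡) , acc≡ , after≡) → runs-ℚ ((env , k≡ , i≡ , bits , x+1≡suc j≡) , acc≡ , after≡) }

  t-check : ℕ → ℕ
  t-check k = 2 ℕ.+ suc (n ℕ.* (2 ℕ.+ suc (t-integrate k ℕ.+ 2)))

  runs-checkBlocks : ∀ {σ} k s → Env σ → k ℕ.≤ N → nats σ layer# 0 ≡ k → Bits k s σ →
                     Runs checkBlocks σ (t-check k) (λ τ → nats τ viol# 0 ≡ ∑ℕ n (violation k s))
  runs-checkBlocks {σ₀} k s env₀ k≤N k≡₀ bits₀ = runs-ℕ⨾ (runs-ℕ⨾ (runs-post (λ { (_ , _ , _ , _ , v) → v })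
    (runs-forUp i# (var 0) (ifte (leqℚ (2 ! var i#) (grid# ! var layer#)) (integrate ⨾ verdict) skip) n (suc (t-integrate k ℕ.+ 2)) I (λ { (i≡ , env , _) → i≡ , n≡ env }) body 0 z≤n (refl , env₀ , k≡₀ , bits₀ , refl))))
    where
    I : ℕ → Store → Set
    I i σ = nats σ i# 0 ≡ i × Env σ × nats σ layer# 0 ≡ k × Bits k s σ × nats σ viol# 0 ≡ ∑ℕ i (violation k s)
    outcome : ℕ → ℚ → ℕ
    outcome i x = if leq (h i * x) ε ∧ leq (- ε) (h i * x) then 0 else 1
    runs-verdict : ∀ {i σ} → i ℕ.< n → I i σ → rats σ acc# 0 ≡ imb i s k → violation k s i ≡ outcome i (imb i s k) →
                   Runs verdict σ 2 (λ τ → I (suc i) (setℕ i# 0 (nats τ i# 0 ℕ.+ 1) τ))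
    runs-verdict {i} {σ} i<n (i≡ , env , k≡ , bits , viol≡) acc≡ vi = runs-if
      (λ t → runs-skip (x+1≡suc i≡ , env , k≡ , bits , trans viol≡ (sym (trans
        (cong (∑ℕ i (violation k s) ℕ.+_) (trans vi (if-true (trans (sym fair) t)))) (ℕ.+-identityʳ (∑ℕ i (violation k s)))))))
      (λ f → runs-ℕ (x+1≡suc i≡ , env , k≡ , bits , trans (cong (ℕ._+ 1) viol≡) (sym
        (cong (∑ℕ i (violation k s) ℕ.+_) (trans vi (if-false (trans (sym fair) f)))))))
      where
      product : rats σ 3 (nats σ i# 0) * rats σ acc# 0 ≡ h i * imb i s k
      product = cong₂ _*_ (trans (cong (rats σ 3) i≡) (h≡ env i)) acc≡
      fair : leq (rats σ 3 (nats σ i# 0) * rats σ acc# 0) (rats σ 0 0) ∧ leq (0ℚ - rats σ 0 0) (rats σ 3 (nats σ i# 0) * rats σ acc# 0)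
             ≡ leq (h i * imb i s k) ε ∧ leq (- ε) (h i * imb i s k)
      fair = cong₂ _∧_ (cong₂ leq product (ε≡ env)) (cong₂ leq (trans (+-identityˡ (- rats σ 0 0)) (cong -_ (ε≡ env))) product)
    I-frame : ∀ {i σ τ} → Frame integrate σ τ → I i σ → I i τ
    I-frame fr (i≡ , env , k≡ , bits , viol≡) =
        trans (frameℕ fr i# refl 0) i≡
      , env-frame {integrate} ((refl , refl , refl) , (refl , refl , refl , refl , refl)) fr env
      , trans (frameℕ fr layer# refl 0) k≡
      , (λ c c<k → trans (frameℕ fr bits# refl c) (bits c c<k))
      , trans (frameℕ fr viol# refl 0) viol≡
    body : ∀ {i σ} → i ℕ.< n → I i σ → Runs (ifte (leqℚ (2 ! var i#) (grid# ! var layer#)) (integrate ⨾ verdict) skip) σ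
             (suc (t-integrate k ℕ.+ 2)) (λ τ → I (suc i) (setℕ i# 0 (nats τ i# 0 ℕ.+ 1) τ))
    body {i} {σ} i<n inv@(i≡ , env , k≡ , bits , viol≡) = runs-if
      (λ t → runs-frame (runs-integrate k s i i<n env k≤N k≡ i≡ bits) then
             λ { {τ} (acc≡ , fr) → runs-verdict {i} {τ} i<n (I-frame {i} {σ} {τ} fr inv) acc≡ (if-true (trans (sym closed) t)) })
      (λ f → runs-weaken (s≤s z≤n) (λ x → x) (runs-skip (x+1≡suc i≡ , env , k≡ , bits , trans viol≡ (sym (trans
        (cong (∑ℕ i (violation k s) ℕ.+_) (if-false (trans (sym closed) f))) (ℕ.+-identityʳ (∑ℕ i (violation k s))))))))
      where
      closed : leq (rats σ 2 (nats σ i# 0)) (rats σ grid# (nats σ layer# 0)) ≡ leq (r i) (G k)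
      closed = cong₂ leq (trans (cong (rats σ 2) i≡) (r≡ env i)) (trans (cong (rats σ grid#) k≡) (G≡ env k k≤N))

  -- The grid point `G k` stands in for the right end 1 until all cells are read. Quantifying over
  -- all `F` handles every block at once; later `F` is a height times a coverage.
  record Listed (k : ℕ) (s : ℕ → Bool) (m : ℕ) (x : ℕ → ℚ) (b : ℕ → ℕ) : Set where
    field
      increasing : Increasing m 0ℚ x (G k)
      signed     : ∀ F → signedSum F m 0ℚ x b (G k) ≡ ∑ k (λ j → sgn (s j) * (F (G (suc j)) - F (G j)))
      last-label : b m ≡ bit (s (k ℕ.∸ 1))

  open Listed public

  listed-one : ∀ s x b → b 0 ≡ bit (s 0) → Listed 1 s 0 x b
  listed-one s x b b≡ = record
    { increasing = subst (_< G 1) (grid-zero δ) (grid-strict {δ} {0} {1} 0<δ (s≤s z≤n))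
    ; signed = λ F → trans (cong₂ (λ y z → y * (F (G 1) - F z)) (trans (cong labelSign b≡) (labelSign-bit (s 0))) (sym (grid-zero δ)))
                           (sym (+-identityˡ (sgn (s 0) * (F (G 1) - F (G 0)))))
    ; last-label = b≡
    }

  listed-same : ∀ {j s m x b} → s (suc j) ≡ s j → Listed (suc j) s m x b → Listed (suc (suc j)) s m x b
  listed-same {j} {s} {m} {x} {b} eq L = record
    { increasing = increasing-extend m (grid-strict 0<δ (ℕ.n<1+n (suc j))) (increasing L)
    ; signed = λ F → trans (signedSum-extend F m 0ℚ x b (G (suc j)) (G (suc (suc j))))
        (cong₂ _+_ (signed L F) (cong (_* (F (G (suc (suc j))) - F (G (suc j))))
          (trans (cong labelSign (last-label L)) (trans (labelSign-bit (s j)) (cong sgn (sym eq))))))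
    ; last-label = trans (last-label L) (cong bit (sym eq))
    }

  listed-cut : ∀ {j s m x b x′ b′} → (∀ c → c ℕ.< m → x c ≡ x′ c) → x′ m ≡ G (suc j) → (∀ c → c ℕ.≤ m → b c ≡ b′ c) →
               b′ (suc m) ≡ bit (s (suc j)) → Listed (suc j) s m x b → Listed (suc (suc j)) s (suc m) x′ b′
  listed-cut {j} {s} {m} {x} {b} {x′} {b′} eqx xm eqb bm L = record
    { increasing = increasing-snoc m refl eqx xm (grid-strict 0<δ (ℕ.n<1+n (suc j))) (increasing L)
    ; signed = λ F → trans (signedSum-snoc F m x x′ b b′ (G (suc (suc j))) refl eqx xm eqb)
        (cong₂ _+_ (signed L F) (cong (_* (F (G (suc (suc j))) - F (G (suc j))))
          (trans (cong labelSign bm) (labelSign-bit (s (suc j))))))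
    ; last-label = bm
    }

  t-cuts : ℕ → ℕ
  t-cuts k = 3 ℕ.+ suc ((k ℕ.∸ 1) ℕ.* (2 ℕ.+ 4))

  Cuts : ℕ → (ℕ → Bool) → Store → Set
  Cuts k s τ = nats τ 1 0 ≡ changes s k × Listed k s (nats τ 1 0) (rats τ 4) (nats τ 2)

  runs-listCuts : ∀ {σ} k s → 1 ℕ.≤ k → Env σ → k ℕ.≤ N → nats σ layer# 0 ≡ k → Bits k s σ → Runs listCuts σ (t-cuts k) (Cuts k s)
  runs-listCuts {σ₀} k s 1≤k env₀ k≤N k≡₀ bits₀ = runs-ℕ⨾ (runs-ℕ⨾ (runs-ℕ⨾ (runs-post (λ { (_ , _ , _ , _ , _ , c) → c })
    (runs-forUp j# (var layer#) cutCell k 4 I (λ { (_ , j≡ , _ , k≡ , _) → j≡ , k≡ }) body 1 1≤k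
      (s≤s z≤n , refl , env₀ , k≡₀ , bits₀ , refl , listed-one s (rats σ₀ 4) _ (bits₀ 0 1≤k))))))
    where
    I : ℕ → Store → Set
    I j σ = 1 ℕ.≤ j × nats σ j# 0 ≡ j × Env σ × nats σ layer# 0 ≡ k × Bits k s σ × Cuts j s σ
    body : ∀ {j σ} → j ℕ.< k → I j σ → Runs cutCell σ 4 (λ τ → I (suc j) (setℕ j# 0 (nats τ j# 0 ℕ.+ 1) τ))
    body {suc j} {σ} j<k (_ , j≡ , env , k≡ , bits , count≡ , L) = runs-if
      (λ t → runs-weaken (s≤s z≤n) (λ p → p) (runs-skip (s≤s z≤n , x+1≡suc j≡ , env , k≡ , bits ,
        trans count≡ (sym (trans (cong (changes s (suc j) ℕ.+_) (same-differs (equal t))) (ℕ.+-identityʳ (changes s (suc j)))))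
        , listed-same (equal t) L)))
      (λ f → runs-ℚ⨾ (runs-ℕ⨾ (runs-ℕ (s≤s z≤n , x+1≡suc j≡ , env , k≡ , bits ,
        trans (cong (ℕ._+ 1) count≡) (cong (changes s (suc j) ℕ.+_) (sym (different-differs (different f)))) ,
        subst (λ m → Listed (suc (suc j)) s m (update (rats σ) 4 (nats σ 1 0) (rats σ grid# (nats σ j# 0)) 4)
                        (update (nats σ) 2 (nats σ 1 0 ℕ.+ 1) (nats σ bits# (nats σ j# 0)) 2))
          (ℕ.+-comm 1 (nats σ 1 0))
          (listed-cut {x = rats σ 4} {b = nats σ 2}
            (λ c c<m → sym (update-other (rats σ) 4 (nats σ 1 0) _ c (λ eq → ℕ.<⇒≢ c<m (sym eq))))
            (trans (update-same (rats σ) 4 (nats σ 1 0) _) (trans (cong (rats σ grid#) j≡) (G≡ env (suc j) (ℕ.≤-trans (ℕ.<⇒≤ j<k) k≤N))))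
            (λ c c≤m → sym (update-other (nats σ) 2 (nats σ 1 0 ℕ.+ 1) _ c
              (λ eq → ℕ.<⇒≢ (ℕ.≤-trans (s≤s c≤m) (ℕ.≤-reflexive (ℕ.+-comm 1 (nats σ 1 0)))) (sym eq))))
            (trans (update-at (nats σ) 2 (nats σ 1 0 ℕ.+ 1) _ (ℕ.+-comm (nats σ 1 0) 1)) this)
            L)))))
      where
      this : nats σ bits# (nats σ j# 0) ≡ bit (s (suc j))
      this = trans (cong (nats σ bits#) j≡) (bits (suc j) j<k)
      previous : nats σ bits# (nats σ j# 0 ℕ.∸ 1) ≡ bit (s j)
      previous = trans (cong (λ x → nats σ bits# (x ℕ.∸ 1)) j≡) (bits j (ℕ.<⇒≤ j<k))
      test : does (nats σ bits# (nats σ j# 0) ℕ.≤? nats σ bits# (nats σ j# 0 ℕ.∸ 1)) ∧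
             does (nats σ bits# (nats σ j# 0 ℕ.∸ 1) ℕ.≤? nats σ bits# (nats σ j# 0))
             ≡ does (bit (s (suc j)) ℕ.≤? bit (s j)) ∧ does (bit (s j) ℕ.≤? bit (s (suc j)))
      test = cong₂ (λ x y → does (x ℕ.≤? y) ∧ does (y ℕ.≤? x)) this previous
      compare : ∀ a b → does (bit a ℕ.≤? bit b) ∧ does (bit b ℕ.≤? bit a) ≡ true → a ≡ b
      compare true  true  t = refl
      compare false false t = refl
      compare′ : ∀ a b → does (bit a ℕ.≤? bit b) ∧ does (bit b ℕ.≤? bit a) ≡ false → a ≢ b
      compare′ true  .true  () refl
      compare′ false .false () refl
      equal : _ ≡ true → s (suc j) ≡ s j
      equal t = compare (s (suc j)) (s j) (trans (sym test) t)
      different : _ ≡ false → s (suc j) ≢ s j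
      different f = compare′ (s (suc j)) (s j) (trans (sym test) f)
      same-differs : ∀ {a b} → a ≡ b → differs a b ≡ 0
      same-differs {a} refl = differs-refl a
      different-differs : ∀ {a b} → a ≢ b → differs a b ≡ 1
      different-differs {true}  {true}  a≢b = ⊥-elim (a≢b refl)
      different-differs {true}  {false} a≢b = refl
      different-differs {false} {true}  a≢b = refl
      different-differs {false} {false} a≢b = ⊥-elim (a≢b refl)

  t-evaluate : ℕ → ℕ
  t-evaluate k = t-decode k ℕ.+ (t-check k ℕ.+ (t-key k ℕ.+ t-cuts k))

  record Evaluated (k : ℕ) (s : ℕ → Bool) (τ : Store) : Set where
    field
      viol≡  : nats τ viol# 0 ≡ ∑ℕ n (violation k s)
      key≡   : nats τ key# 0 ≡ key k s
      cuts≡  : Cuts k s τ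

  open Evaluated public

  runs-evaluate : ∀ {σ} k s → 1 ℕ.≤ k → Env σ → k ℕ.≤ N → nats σ layer# 0 ≡ k → nats σ code# 0 ≡ codeOf s k →
                  Runs evaluate σ (t-evaluate k) (Evaluated k s)
  runs-evaluate {σ} k@(suc k′) s 1≤k env k≤N k≡ code≡ =
    runs-frame (runs-decode k s env k≤N k≡ code≡) then λ { {τ} (bits , fr) → check (env-frame {decode} keeps fr env) (trans (frameℕ fr layer# refl 0) k≡) bits }
    where
    keeps : (false ≡ false × false ≡ false × false ≡ false) × (false ≡ false × false ≡ false × false ≡ false × false ≡ false × false ≡ false)
    keeps = (refl , refl , refl) , (refl , refl , refl , refl , refl)
    list : ∀ {σ} → Env σ → nats σ layer# 0 ≡ k → Bits k s σ → nats σ viol# 0 ≡ ∑ℕ n (violation k s) → nats σ key# 0 ≡ key k s →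
           Runs listCuts σ (t-cuts k) (Evaluated k s)
    list env k≡ bits v≡ κ≡ = runs-post (λ { (cuts , fr) → record
      { viol≡ = trans (frameℕ fr viol# refl 0) v≡ ; key≡ = trans (frameℕ fr key# refl 0) κ≡ ; cuts≡ = cuts } })
      (runs-frame (runs-listCuts k s 1≤k env k≤N k≡ bits))
    keyed : ∀ {σ} → Env σ → nats σ layer# 0 ≡ k → Bits k s σ → nats σ viol# 0 ≡ ∑ℕ n (violation k s) →
            Runs (computeKey ⨾ listCuts) σ (t-key k ℕ.+ t-cuts k) (Evaluated k s)
    keyed {σ} env k≡ bits v≡ = runs-frame (runs-computeKey k env k≤N k≡) then λ { {τ} ((_ , κ) , fr) →
      list (env-frame {computeKey} keeps fr env) (trans (frameℕ fr layer# refl 0) k≡)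
        (λ c c<k → trans (frameℕ fr bits# refl c) (bits c c<k)) (trans (frameℕ fr viol# refl 0) v≡)
        (trans (κ s bits) (cong (encode (marked k) s k 0 0) (bits k′ ℕ.≤-refl))) }
    check : ∀ {σ} → Env σ → nats σ layer# 0 ≡ k → Bits k s σ →
            Runs (checkBlocks ⨾ computeKey ⨾ listCuts) σ (t-check k ℕ.+ (t-key k ℕ.+ t-cuts k)) (Evaluated k s)
    check {σ} env k≡ bits = runs-frame (runs-checkBlocks k s env k≤N k≡ bits) then λ { {τ} (v≡ , fr) →
      keyed (env-frame {checkBlocks} keeps fr env) (trans (frameℕ fr layer# refl 0) k≡)
        (λ c c<k → trans (frameℕ fr bits# refl c) (bits c c<k)) v≡ }

-- The table of the dynamic program

module Search (n N : ℕ) (l r h : ℕ → ℚ) (δ ε : ℚ)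
              (0<δ : 0ℚ < δ) (0≤l : ∀ i → i ℕ.< n → 0ℚ ≤ l i) (l<r : ∀ i → i ℕ.< n → l i < r i) where

  open Dynamic n l r h δ ε 0<δ 0≤l l<r
  open Specs n N l r h δ ε 0<δ 0≤l l<r

  -- T and C hold the codes (plus one) and the costs of the table entries.
  Better : ℕ → (ℕ → Bool) → ℕ → (T C : ℕ → ℕ) → Set
  Better k s a T C = 1 ℕ.≤ T a × C a ℕ.≤ cost k s

  Sound : ℕ → ℕ → (T C : ℕ → ℕ) → Set
  Sound k o T C = ∀ κ → κ ℕ.< keys k → 1 ℕ.≤ T (o ℕ.+ κ) →
    ∃[ s ] T (o ℕ.+ κ) ≡ suc (codeOf s k) × C (o ℕ.+ κ) ≡ cost k s × key k s ≡ κ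

  -- Entries may stay empty if no sequence has their key. `fresh` provides the cleared space in
  -- which the next layer is built.
  record Complete (k o : ℕ) (T C : ℕ → ℕ) : Set where
    field
      sound    : Sound k o T C
      complete : ∀ s → Better k s (o ℕ.+ key k s) T C
      fresh    : ∀ a → o ℕ.+ keys k ℕ.≤ a → T a ≡ 0

  open Complete public

  -- The entries o, …, A - 1 of layer k have been extended to layer k + 1.
  record Partial (k o A : ℕ) (T C : ℕ → ℕ) : Set where
    field
      source-sound    : Sound k o T C
      source-complete : ∀ s → Better k s (o ℕ.+ key k s) T C
      target-sound    : Sound (suc k) (o ℕ.+ keys k) T C
      target-fresh    : ∀ a → o ℕ.+ keys k ℕ.+ keys (suc k) ℕ.≤ a → T a ≡ 0
      progress        : ∀ s → o ℕ.+ key k s ℕ.< A → Better (suc k) s (o ℕ.+ keys k ℕ.+ key (suc k) s) T C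

  open Partial public

  better-cong : ∀ k s a (T C T′ C′ : ℕ → ℕ) → T′ a ≡ T a → C′ a ≡ C a → Better k s a T C → Better k s a T′ C′
  better-cong k s a T C T′ C′ eqT eqC (p , q) = subst (1 ℕ.≤_) (sym eqT) p , subst (ℕ._≤ cost k s) (sym eqC) q

  sound-cong : ∀ k o (T C T′ C′ : ℕ → ℕ) → (∀ κ → κ ℕ.< keys k → T′ (o ℕ.+ κ) ≡ T (o ℕ.+ κ)) → (∀ κ → κ ℕ.< keys k → C′ (o ℕ.+ κ) ≡ C (o ℕ.+ κ)) →
               Sound k o T C → Sound k o T′ C′
  sound-cong k o T C T′ C′ eqT eqC S κ κ< T>0 = transport (S κ κ< (subst (1 ℕ.≤_) (eqT κ κ<) T>0))
    where
    transport : ∃[ s ] T (o ℕ.+ κ) ≡ suc (codeOf s k) × C (o ℕ.+ κ) ≡ cost k s × key k s ≡ κ →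
                ∃[ s ] T′ (o ℕ.+ κ) ≡ suc (codeOf s k) × C′ (o ℕ.+ κ) ≡ cost k s × key k s ≡ κ
    transport (s , a , b , c) = s , trans (eqT κ κ<) a , trans (eqC κ κ<) b , c

  partial-cong : ∀ {k o A T C T′ C′} → (∀ a → T′ a ≡ T a) → (∀ a → C′ a ≡ C a) → Partial k o A T C → Partial k o A T′ C′
  partial-cong {k} {o} {T = T} {C} {T′} {C′} eqT eqC P = record
    { source-sound    = sound-cong k o T C T′ C′ (λ κ _ → eqT (o ℕ.+ κ)) (λ κ _ → eqC (o ℕ.+ κ)) (source-sound P)
    ; source-complete = λ s → better-cong k s (o ℕ.+ key k s) T C T′ C′ (eqT (o ℕ.+ key k s)) (eqC (o ℕ.+ key k s)) (source-complete P s)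
    ; target-sound    = sound-cong (suc k) (o ℕ.+ keys k) T C T′ C′ (λ κ _ → eqT (o ℕ.+ keys k ℕ.+ κ)) (λ κ _ → eqC (o ℕ.+ keys k ℕ.+ κ)) (target-sound P)
    ; target-fresh    = λ a le → trans (eqT a) (target-fresh P a le)
    ; progress        = λ s lt → better-cong (suc k) s (o ℕ.+ keys k ℕ.+ key (suc k) s) T C T′ C′
                          (eqT (o ℕ.+ keys k ℕ.+ key (suc k) s)) (eqC (o ℕ.+ keys k ℕ.+ key (suc k) s)) (progress P s lt)
    }

  -- Writing a sequence s into its entry a, unless the entry is already as good.
  record Written (k : ℕ) (s : ℕ → Bool) (a : ℕ) (T C T′ C′ : ℕ → ℕ) : Set where
    field
      written-T   : T′ a ≡ suc (codeOf s k)
      written-C   : C′ a ≡ cost k s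
      elsewhere-T : ∀ c → a ≢ c → T′ c ≡ T c
      elsewhere-C : ∀ c → a ≢ c → C′ c ≡ C c
      improvement : 1 ℕ.≤ T a → cost k s ℕ.≤ C a

  open Written public

  better-written : ∀ {k s a T C T′ C′ t} c → Written k s a T C T′ C′ → Better k t c T C → Better k t c T′ C′
  better-written {k} {s} {a} {T} {C} {T′} {C′} {t} c w b@(T>0 , C≤) = decide (a ℕ.≟ c)
    where
    decide : Dec (a ≡ c) → Better k t c T′ C′
    decide (yes refl) = subst (1 ℕ.≤_) (sym (written-T w)) (s≤s z≤n)
                      , subst (ℕ._≤ cost k t) (sym (written-C w)) (ℕ.≤-trans (improvement w T>0) C≤)
    decide (no  a≢c)  = better-cong k t c T C T′ C′ (elsewhere-T w c a≢c) (elsewhere-C w c a≢c) b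

  -- The slot lies behind the entries of layer `k` and within those of layer `suc k`, so the sources
  -- and the space behind are untouched. Entries of the new layer under other keys survive, and the
  -- one overwritten only becomes cheaper.
  partial-written : ∀ {k o A s T C T′ C′} → Written (suc k) s (o ℕ.+ keys k ℕ.+ key (suc k) s) T C T′ C′ →
                    Partial k o A T C → Partial k o A T′ C′
  partial-written {k} {o} {A} {s} {T} {C} {T′} {C′} w P = record
    { source-sound    = sound-cong k o T C T′ C′ (λ κ κ< → elsewhere-T w (o ℕ.+ κ) (source≢ κ κ<)) (λ κ κ< → elsewhere-C w (o ℕ.+ κ) (source≢ κ κ<)) (source-sound P)
    ; source-complete = λ t → better-cong k t (o ℕ.+ key k t) T C T′ C′ (elsewhere-T w (o ℕ.+ key k t) (source≢ (key k t) (key<keys k t)))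
                                                  (elsewhere-C w (o ℕ.+ key k t) (source≢ (key k t) (key<keys k t))) (source-complete P t)
    ; target-sound    = target
    ; target-fresh    = λ c le → trans (elsewhere-T w c (λ eq → ℕ.<⇒≱ (ℕ.+-monoʳ-< (o ℕ.+ keys k) (key<keys (suc k) s)) (ℕ.≤-trans le (ℕ.≤-reflexive (sym eq))))) (target-fresh P c le)
    ; progress        = λ t lt → better-written (o ℕ.+ keys k ℕ.+ key (suc k) t) w (progress P t lt)
    }
    where
    a : ℕ
    a = o ℕ.+ keys k ℕ.+ key (suc k) s
    source≢ : ∀ κ → κ ℕ.< keys k → a ≢ o ℕ.+ κ
    source≢ κ κ< eq = ℕ.<⇒≱ (ℕ.+-monoʳ-< o κ<) (ℕ.≤-trans (ℕ.m≤m+n (o ℕ.+ keys k) (key (suc k) s)) (ℕ.≤-reflexive eq))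
    target : Sound (suc k) (o ℕ.+ keys k) T′ C′
    target κ κ< T>0 = decide (key (suc k) s ℕ.≟ κ)
      where
      Entry : (T C : ℕ → ℕ) → Set
      Entry T C = ∃[ t ] T (o ℕ.+ keys k ℕ.+ κ) ≡ suc (codeOf t (suc k)) × C (o ℕ.+ keys k ℕ.+ κ) ≡ cost (suc k) t × key (suc k) t ≡ κ
      decide : Dec (key (suc k) s ≡ κ) → Entry T′ C′
      decide (yes refl) = s , written-T w , written-C w , refl
      decide (no  ≢κ)   = through (target-sound P κ κ< (subst (1 ℕ.≤_) (elsewhere-T w (o ℕ.+ keys k ℕ.+ κ) a≢) T>0))
        where
        a≢ : a ≢ o ℕ.+ keys k ℕ.+ κ
        a≢ eq = ≢κ (ℕ.+-cancelˡ-≡ (o ℕ.+ keys k) (key (suc k) s) κ eq)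
        through : Entry T C → Entry T′ C′
        through (t , x , y , z) = t , trans (elsewhere-T w (o ℕ.+ keys k ℕ.+ κ) a≢) x , trans (elsewhere-C w (o ℕ.+ keys k ℕ.+ κ) a≢) y , z

  partial-start : ∀ {k o T C} → Complete k o T C → Partial k o o T C
  partial-start {k} {o} L = record
    { source-sound = sound L ; source-complete = complete L
    ; target-sound = λ κ _ T>0 → ⊥-elim (ℕ.<⇒≢ T>0 (sym (fresh L (o ℕ.+ keys k ℕ.+ κ) (ℕ.m≤m+n (o ℕ.+ keys k) κ))))
    ; target-fresh = λ a le → fresh L a (ℕ.≤-trans (ℕ.m≤m+n (o ℕ.+ keys k) (keys (suc k))) le)
    ; progress = λ s lt → ⊥-elim (ℕ.<⇒≱ lt (ℕ.m≤m+n o (key k s))) }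

  partial-end : ∀ {k o T C} → Partial k o (o ℕ.+ keys k) T C → Complete (suc k) (o ℕ.+ keys k) T C
  partial-end {k} {o} P = record
    { sound = target-sound P ; complete = λ s → progress P s (ℕ.+-monoʳ-< o (key<keys k s)) ; fresh = target-fresh P }

  extend : (ℕ → Bool) → ℕ → Bool → ℕ → Bool
  extend s k b j with j ℕ.≟ k
  ... | yes _ = b
  ... | no  _ = s j

  extend-last : ∀ s k b → extend s k b k ≡ b
  extend-last s k b with k ℕ.≟ k
  ... | yes _   = refl
  ... | no  k≢k = ⊥-elim (k≢k refl)

  extend-init : ∀ s k b j → j ℕ.< k → extend s k b j ≡ s j
  extend-init s k b j j<k with j ℕ.≟ k
  ... | yes refl = ⊥-elim (ℕ.<-irrefl refl j<k)
  ... | no  _    = refl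

  extend-code : ∀ s k b → codeOf s k ℕ.+ bit b ℕ.* 2 ℕ.^ k ≡ codeOf (extend s k b) (suc k)
  extend-code s k b = cong₂ ℕ._+_ (∑ℕ-cong k (λ j j<k → cong (λ b → bit b ℕ.* 2 ℕ.^ j) (sym (extend-init s k b j j<k))))
                                  (cong (λ b → bit b ℕ.* 2 ℕ.^ k) (sym (extend-last s k b)))

  -- Bellman's principle: it suffices to extend the remembered sequence s.
  extend-better : ∀ {k s t a T C} → key k s ≡ key k t → cost k s ℕ.≤ cost k t →
                  Better (suc k) (extend s k (t k)) (a ℕ.+ key (suc k) (extend s k (t k))) T C →
                  Better (suc k) t (a ℕ.+ key (suc k) t) T C
  extend-better {k} {s} {t} {a} {T} {C} eqk le B =
    subst (λ κ → Better (suc k) t (a ℕ.+ κ) T C) (key-suc k e t eqk′ (extend-last s k (t k)))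
      (proj₁ B , ℕ.≤-trans (proj₂ B) (bellman k e t eqk′ (extend-last s k (t k)) (ℕ.≤-trans (ℕ.≤-reflexive cost≡) le)))
    where
    e : ℕ → Bool
    e = extend s k (t k)
    eqk′ : key k e ≡ key k t
    eqk′ = trans (key-cong k (extend-init s k (t k))) eqk
    cost≡ : cost k e ≡ cost k s
    cost≡ = cost-cong k (extend-init s k (t k))

  t-step : ℕ → ℕ
  t-step k = 1 ℕ.+ (t-evaluate (suc k) ℕ.+ 3)

  module Layer (k o : ℕ) (k<N : k ℕ.< N) where

    o′ : ℕ
    o′ = o ℕ.+ keys k

    Ready : ℕ → Store → Set
    Ready A σ = Env σ × nats σ layer# 0 ≡ suc k × nats σ next# 0 ≡ o′ × nats σ address# 0 ≡ A ×
                Partial k o A (nats σ table#) (nats σ costs#)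

    Good : (ℕ → Bool) → Store → Set
    Good s σ = Better (suc k) s (o′ ℕ.+ key (suc k) s) (nats σ table#) (nats σ costs#)

    Stepped : ℕ → (ℕ → Bool) → Store → Store → Set
    Stepped A s σ τ = Ready A τ × nats τ table# A ≡ nats σ table# A × Good s τ × (∀ t → Good t σ → Good t τ)

    runs-remember : ∀ {A σ} s → A ℕ.< o′ → Ready A σ → Evaluated (suc k) s σ → nats σ code# 0 ≡ codeOf s (suc k) →
                    Runs remember σ 3 (Stepped A s σ)
    runs-remember {A} {σ} s A<o′ (env , k≡ , next≡ , A≡ , P) ev code≡ = runs-if
      (λ t → runs-seq (runs-skip (runs-skip ((env , k≡ , next≡ , A≡ , P) , refl , kept t , λ t g → g))))
      (λ f → runs-ℕ⨾ (runs-ℕ (overwritten (written f))))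
      where
      T C : ℕ → ℕ
      T = nats σ table#
      C = nats σ costs#
      a : ℕ
      a = o′ ℕ.+ key (suc k) s
      slot≡ : nats σ next# 0 ℕ.+ nats σ key# 0 ≡ a
      slot≡ = cong₂ ℕ._+_ next≡ (key≡ ev)
      total≡ : nats σ 1 0 ℕ.+ (1 ℕ.+ nats σ 0 0) ℕ.* nats σ viol# 0 ≡ cost (suc k) s
      total≡ = cong₂ ℕ._+_ (proj₁ (cuts≡ ev)) (cong₂ (λ x y → suc x ℕ.* y) (n≡ env) (viol≡ ev))
      test : does (1 ℕ.≤? T (nats σ next# 0 ℕ.+ nats σ key# 0)) ∧
             does (C (nats σ next# 0 ℕ.+ nats σ key# 0) ℕ.≤? nats σ 1 0 ℕ.+ (1 ℕ.+ nats σ 0 0) ℕ.* nats σ viol# 0)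
             ≡ does (1 ℕ.≤? T a) ∧ does (C a ℕ.≤? cost (suc k) s)
      test = cong₂ (λ x y → does (1 ℕ.≤? T x) ∧ does (C x ℕ.≤? y)) slot≡ total≡
      kept : _ ≡ true → Better (suc k) s a T C
      kept t = does-true (1 ℕ.≤? T a) (proj₁ (∧-true (trans (sym test) t)))
             , does-true (C a ℕ.≤? cost (suc k) s) (proj₂ (∧-true {does (1 ℕ.≤? T a)} (trans (sym test) t)))
      T′ C′ : ℕ → ℕ
      T′ = update (nats σ) table# (nats σ next# 0 ℕ.+ nats σ key# 0) (1 ℕ.+ nats σ code# 0) table#
      C′ = update (nats σ) costs# (nats σ next# 0 ℕ.+ nats σ key# 0) (nats σ 1 0 ℕ.+ (1 ℕ.+ nats σ 0 0) ℕ.* nats σ viol# 0) costs#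
      written : _ ≡ false → Written (suc k) s a T C T′ C′
      written f = record
        { written-T = trans (update-at (nats σ) table# (nats σ next# 0 ℕ.+ nats σ key# 0) (1 ℕ.+ nats σ code# 0) slot≡) (cong suc code≡)
        ; written-C = trans (update-at (nats σ) costs# (nats σ next# 0 ℕ.+ nats σ key# 0) (nats σ 1 0 ℕ.+ (1 ℕ.+ nats σ 0 0) ℕ.* nats σ viol# 0) slot≡) total≡
        ; elsewhere-T = λ c a≢c → update-other (nats σ) table# (nats σ next# 0 ℕ.+ nats σ key# 0) (1 ℕ.+ nats σ code# 0) c (λ eq → a≢c (trans (sym slot≡) eq))
        ; elsewhere-C = λ c a≢c → update-other (nats σ) costs# (nats σ next# 0 ℕ.+ nats σ key# 0) (nats σ 1 0 ℕ.+ (1 ℕ.+ nats σ 0 0) ℕ.* nats σ viol# 0) c (λ eq → a≢c (trans (sym slot≡) eq))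
        ; improvement = λ T>0 → ℕ.<⇒≤ (ℕ.≰⇒> λ le → contradict (trans (sym test) f) T>0 le)
        }
        where
        contradict : does (1 ℕ.≤? T a) ∧ does (C a ℕ.≤? cost (suc k) s) ≡ false → 1 ℕ.≤ T a → C a ℕ.≤ cost (suc k) s → ⊥
        contradict eq p q = absurd (trans (sym eq) (cong₂ _∧_ (dec-true (1 ℕ.≤? T a) p) (dec-true (C a ℕ.≤? cost (suc k) s) q)))
          where
          absurd : false ≡ true → ⊥
          absurd ()
      overwritten : Written (suc k) s a T C T′ C′ → Stepped A s σ (setℕ costs# (nats σ next# 0 ℕ.+ nats σ key# 0) (nats σ 1 0 ℕ.+ (1 ℕ.+ nats σ 0 0) ℕ.* nats σ viol# 0)
                            (setℕ table# (nats σ next# 0 ℕ.+ nats σ key# 0) (1 ℕ.+ nats σ code# 0) σ))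
      overwritten w = (env , k≡ , next≡ , A≡ , partial-written w P)
        , elsewhere-T w A (λ eq → ℕ.<⇒≱ A<o′ (ℕ.≤-trans (ℕ.m≤m+n o′ (key (suc k) s)) (ℕ.≤-reflexive eq)))
        , (subst (1 ℕ.≤_) (sym (written-T w)) (s≤s z≤n) , ℕ.≤-reflexive (written-C w))
        , λ t g → better-written (o′ ℕ.+ key (suc k) t) w g

    runs-step : ∀ {A σ} b s → A ℕ.< o′ → Ready A σ → nats σ table# A ≡ suc (codeOf s k) →
                Runs (step (bit b)) σ (t-step k) (Stepped A (extend s k b) σ)
    runs-step {A} {σ} b s A<o′ (env , k≡ , next≡ , A≡ , P) T≡ = runs-ℕ⨾
      (runs-frame (runs-evaluate (suc k) (extend s k b) (s≤s z≤n) env k<N k≡ code≡) then λ { {τ} (ev , fr) →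
        runs-post (λ { (R , same , good , mono) → R , trans same (frameℕ fr table# refl A) , good ,
                       λ t g → mono t (better-cong (suc k) t (o′ ℕ.+ key (suc k) t) (nats σ table#) (nats σ costs#) (nats τ table#) (nats τ costs#)
                                         (frameℕ fr table# refl (o′ ℕ.+ key (suc k) t)) (frameℕ fr costs# refl (o′ ℕ.+ key (suc k) t)) g) })
          (runs-remember {A} {τ} (extend s k b) A<o′
            ( env-frame {evaluate} ((refl , refl , refl) , (refl , refl , refl , refl , refl)) fr env
            , trans (frameℕ fr layer# refl 0) k≡ , trans (frameℕ fr next# refl 0) next≡ , trans (frameℕ fr address# refl 0) A≡
            , partial-cong (frameℕ fr table# refl) (frameℕ fr costs# refl) P)
            ev (trans (frameℕ fr code# refl 0) code≡)) })
      where
      code≡ : nats σ table# (nats σ address# 0) ℕ.∸ 1 ℕ.+ bit b ℕ.* nats σ powers# (nats σ layer# 0 ℕ.∸ 1) ≡ codeOf (extend s k b) (suc k)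
      code≡ = trans (cong₂ (λ x y → x ℕ.∸ 1 ℕ.+ bit b ℕ.* y) (trans (cong (nats σ table#) A≡) T≡)
                (trans (cong (λ x → nats σ powers# (x ℕ.∸ 1)) k≡) (pow≡ env k (ℕ.<⇒≤ k<N)))) (extend-code s k b)

    runs-extendEntry : ∀ {A σ} → o ℕ.≤ A → A ℕ.< o′ → Ready A σ →
                       Runs extendEntry σ (suc (t-step k ℕ.+ t-step k)) (λ τ → Ready (suc A) (setℕ address# 0 (nats τ address# 0 ℕ.+ 1) τ))
    runs-extendEntry {A} {σ} o≤A A<o′ R@(env , k≡ , next≡ , A≡ , P) = runs-if
      (λ t → occupied (does-true (1 ℕ.≤? nats σ table# A) (trans (sym test) t)))
      -- By completeness of the source layer, an empty entry is the key of no sequence, so nothing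
      -- has to be extended.
      (λ f → runs-weaken (s≤s z≤n) (λ p → p) (runs-skip (advance {σ} R λ s κ≡ →
        ⊥-elim (does-false (1 ℕ.≤? nats σ table# A) (trans (sym test) f)
          (subst (λ a → 1 ℕ.≤ nats σ table# a) κ≡ (proj₁ (source-complete P s)))))))
      where
      test : does (1 ℕ.≤? nats σ table# (nats σ address# 0)) ≡ does (1 ℕ.≤? nats σ table# A)
      test = cong (λ x → does (1 ℕ.≤? nats σ table# x)) A≡
      advance : ∀ {τ} → Ready A τ → (∀ s → o ℕ.+ key k s ≡ A → Good s τ) → Ready (suc A) (setℕ address# 0 (nats τ address# 0 ℕ.+ 1) τ)
      advance (env , k≡ , next≡ , A≡ , P) good = env , k≡ , next≡ , x+1≡suc A≡ , record
        { source-sound = source-sound P ; source-complete = source-complete P ; target-sound = target-sound P ; target-fresh = target-fresh P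
        ; progress = λ s lt → by-cases s (ℕ.m<1+n⇒m<n∨m≡n lt) }
        where
        by-cases : ∀ s → o ℕ.+ key k s ℕ.< A ⊎ o ℕ.+ key k s ≡ A → _
        by-cases s (inj₁ lt) = progress P s lt
        by-cases s (inj₂ eq) = good s eq
      A-split : o ℕ.+ (A ℕ.∸ o) ≡ A
      A-split = ℕ.m+[n∸m]≡n o≤A
      occupied : 1 ℕ.≤ nats σ table# A → Runs (step 0 ⨾ step 1) σ (t-step k ℕ.+ t-step k) (λ τ → Ready (suc A) (setℕ address# 0 (nats τ address# 0 ℕ.+ 1) τ))
      occupied T>0 = extendBy (source-sound P (A ℕ.∸ o) (ℕ.+-cancelˡ-< o (A ℕ.∸ o) (keys k) (subst (ℕ._< o′) (sym A-split) A<o′))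
                                 (subst (λ a → 1 ℕ.≤ nats σ table# a) (sym A-split) T>0))
       where
       extendBy : ∃[ s ] nats σ table# (o ℕ.+ (A ℕ.∸ o)) ≡ suc (codeOf s k) × nats σ costs# (o ℕ.+ (A ℕ.∸ o)) ≡ cost k s × key k s ≡ A ℕ.∸ o →
                  Runs (step 0 ⨾ step 1) σ (t-step k ℕ.+ t-step k) (λ τ → Ready (suc A) (setℕ address# 0 (nats τ address# 0 ℕ.+ 1) τ))
       -- `same₁` keeps the source entry for the extension by plus, and `mono` carries the result of
       -- the extension by minus across it.
       extendBy (s , T≡ , C≡ , κ≡) = runs-step {A} {σ} false s A<o′ R T≡′ then λ { {τ} (R₁ , same₁ , good₁ , _) →
            runs-post (λ { {τ′} (R₂ , _ , good₂ , mono) →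
              advance {τ′} R₂ λ t eq → best {τ′} t eq (both {τ′} t (mono (extend s k false) good₁) good₂) })
              (runs-step {A} {τ} true s A<o′ R₁ (trans same₁ T≡′)) }
        where
        T≡′ : nats σ table# A ≡ suc (codeOf s k)
        T≡′ = trans (cong (nats σ table#) (sym A-split)) T≡
        both : ∀ {τ} t → Good (extend s k false) τ → Good (extend s k true) τ → Good (extend s k (t k)) τ
        both {τ} t g₀ g₁ = go (t k)
          where
          go : ∀ b → Good (extend s k b) τ
          go false = g₀
          go true  = g₁
        best : ∀ {τ} t → o ℕ.+ key k t ≡ A → Good (extend s k (t k)) τ → Good t τ
        best {τ} t eq = extend-better {k} {s} {t} {o′} {nats τ table#} {nats τ costs#}
          (trans κ≡ (ℕ.+-cancelˡ-≡ o (A ℕ.∸ o) (key k t) (trans A-split (sym eq))))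
          (subst (ℕ._≤ cost k t) (trans (cong (nats σ costs#) (trans eq (sym A-split))) C≡) (proj₂ (source-complete P t)))

  t-layer : ℕ → ℕ
  t-layer k = t-key k ℕ.+ (3 ℕ.+ (suc (keys k ℕ.* (2 ℕ.+ suc (t-step k ℕ.+ t-step k))) ℕ.+ 1))

  record AtLayer (k : ℕ) (σ : Store) : Set where
    field
      constants : Env σ
      layer≡    : nats σ layer# 0 ≡ k
      tables    : Complete k (nats σ offset# 0) (nats σ table#) (nats σ costs#)

  open AtLayer public

  complete-cong : ∀ {k o o″ T C T′ C′} → o″ ≡ o → (∀ a → T′ a ≡ T a) → (∀ a → C′ a ≡ C a) → Complete k o T C → Complete k o″ T′ C′
  complete-cong {k} {o} {T = T} {C} {T′} {C′} refl eqT eqC L = record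
    { sound    = sound-cong k o T C T′ C′ (λ κ _ → eqT (o ℕ.+ κ)) (λ κ _ → eqC (o ℕ.+ κ)) (sound L)
    ; complete = λ s → better-cong k s (o ℕ.+ key k s) T C T′ C′ (eqT (o ℕ.+ key k s)) (eqC (o ℕ.+ key k s)) (complete L s)
    ; fresh    = λ a le → trans (eqT a) (fresh L a le)
    }

  runs-searchLayer : ∀ {σ} k → k ℕ.< N → AtLayer k σ → Runs searchLayer σ (t-layer k) (AtLayer (suc k))
  runs-searchLayer {σ} k k<N L =
    runs-frame (runs-computeKey k (constants L) (ℕ.<⇒≤ k<N) (layer≡ L)) then λ { {τ} ((R≡ , _) , fr) →
      runs-ℕ⨾ (runs-ℕ⨾ (runs-ℕ⨾ (extend-all τ R≡ fr))) }
    where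
    o : ℕ
    o = nats σ offset# 0
    open Layer k o k<N
    extend-all : ∀ τ → nats τ radix# 0 ≡ keys k → Frame computeKey σ τ →
                 Runs (forUp address# (var next#) extendEntry ⨾ offset# ! lit 0 ≔ℕ var next#)
                   (setℕ address# 0 (nats τ offset# 0) (setℕ layer# 0 (1 ℕ.+ nats τ layer# 0) (setℕ next# 0 (nats τ offset# 0 ℕ.+ nats τ radix# 0) τ)))
                   (suc (keys k ℕ.* (2 ℕ.+ suc (t-step k ℕ.+ t-step k))) ℕ.+ 1) (AtLayer (suc k))
    extend-all τ R≡ fr = all then λ { {τ} (_ , env , k≡ , next≡ , A≡ , P) → runs-ℕ (record
        { constants = env ; layer≡ = k≡ ; tables = complete-cong {suc k} next≡ (λ _ → refl) (λ _ → refl) (partial-end P) }) }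
      where
      I : ℕ → Store → Set
      I A σ = o ℕ.≤ A × Ready A σ
      start : Store
      start = setℕ address# 0 (nats τ offset# 0) (setℕ layer# 0 (1 ℕ.+ nats τ layer# 0) (setℕ next# 0 (nats τ offset# 0 ℕ.+ nats τ radix# 0) τ))
      ready : Ready o start
      ready = env-frame {computeKey} ((refl , refl , refl) , (refl , refl , refl , refl , refl)) fr (constants L)
            , cong suc (trans (frameℕ fr layer# refl 0) (layer≡ L))
            , cong₂ ℕ._+_ (frameℕ fr offset# refl 0) R≡
            , frameℕ fr offset# refl 0
            , partial-start (complete-cong {k} refl (frameℕ fr table# refl) (frameℕ fr costs# refl) (tables L))
      all : Runs (forUp address# (var next#) extendEntry) start (suc (keys k ℕ.* (2 ℕ.+ suc (t-step k ℕ.+ t-step k)))) (I o′)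
      all = runs-weaken (ℕ.≤-reflexive (cong (λ x → suc (x ℕ.* (2 ℕ.+ suc (t-step k ℕ.+ t-step k)))) (ℕ.m+n∸m≡n o (keys k)))) (λ i → i)
        (runs-forUp address# (var next#) extendEntry o′ (suc (t-step k ℕ.+ t-step k)) I
          (λ { (_ , _ , _ , next≡ , A≡ , _) → A≡ , next≡ })
          (λ { {A} {σ} A<o′ (o≤A , R) → runs-post (λ r → ℕ.m≤n⇒m≤1+n o≤A , r) (runs-extendEntry {A} {σ} o≤A A<o′ R) })
          o (ℕ.m≤m+n o (keys k)) (ℕ.≤-refl , ready))

  module _ (r≤G : ∀ i → i ℕ.< n → r i ≤ G N) (0<N : 1 ℕ.≤ N) (W : ℕ) (t-layer≤ : ∀ k → k ℕ.< N → t-layer k ℕ.≤ W) where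

    t-search : ℕ
    t-search = 1 ℕ.+ (suc (N ℕ.* (2 ℕ.+ W)) ℕ.+ (1 ℕ.+ t-evaluate N))

    -- The competitors are restricted to sequences ending in plus, because entry 1 of the last layer
    -- is the one that is read.
    Optimal : Store → Set
    Optimal τ = ∃[ s ] Cuts N s τ × (∀ t → t (N ℕ.∸ 1) ≡ true → cost N s ℕ.≤ cost N t)

    runs-search : ∀ {σ} → AtLayer 0 σ → Runs search σ t-search Optimal
    runs-search {σ₀} L₀ = runs-ℕ⨾ (layers then λ { {τ} (_ , L) → read {τ} L })
      where
      I : ℕ → Store → Set
      I k σ = nats σ count# 0 ≡ k × AtLayer k σ
      start : Store
      start = setℕ count# 0 0 σ₀
      started : AtLayer 0 start
      started = record { constants = constants L₀ ; layer≡ = layer≡ L₀ ; tables = tables L₀ }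
      layers : Runs (forUp count# (var cells#) searchLayer) start (suc (N ℕ.* (2 ℕ.+ W))) (I N)
      layers = runs-forUp count# (var cells#) searchLayer N W I
        (λ { (c≡ , L) → c≡ , N≡ (constants L) })
        (λ { {k} {σ} k<N (c≡ , L) → runs-weaken (t-layer≤ k k<N)
             (λ { {τ} (L′ , fr) → x+1≡suc (trans (frameℕ fr count# refl 0) c≡)
                                , record { constants = constants L′ ; layer≡ = layer≡ L′ ; tables = tables L′ } })
             (runs-frame (runs-searchLayer {σ} k k<N L)) })
        0 z≤n (refl , started)
      plus-key : ∀ s → s (N ℕ.∸ 1) ≡ true → key N s ≡ 1
      plus-key s eq = trans (key-final N r≤G s) (go N 0<N eq)
        where
        go : ∀ N → 1 ℕ.≤ N → s (N ℕ.∸ 1) ≡ true → lastBit N s ≡ 1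
        go (suc k) _ eq = cong bit eq
      read : ∀ {τ} → AtLayer N τ → Runs (code# ! lit 0 ≔ℕ monus (table# ! add (lit 1) (var offset#)) (lit 1) ⨾ evaluate) τ (1 ℕ.+ t-evaluate N) Optimal
      -- The sequence of plus signs only shows that key 1 is a legitimate key and that its entry is
      -- occupied.
      read {τ} L = from (sound (tables L) 1 (subst (ℕ._< keys N) (plus-key (λ _ → true) refl) (key<keys N (λ _ → true)))
                          (subst (λ κ → 1 ℕ.≤ T (o ℕ.+ κ)) (plus-key (λ _ → true) refl) (proj₁ (complete (tables L) (λ _ → true)))))
        where
        o : ℕ
        o = nats τ offset# 0
        T C : ℕ → ℕ
        T = nats τ table#
        C = nats τ costs#
        from : ∃[ s ] T (o ℕ.+ 1) ≡ suc (codeOf s N) × C (o ℕ.+ 1) ≡ cost N s × key N s ≡ 1 →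
               Runs (code# ! lit 0 ≔ℕ monus (table# ! add (lit 1) (var offset#)) (lit 1) ⨾ evaluate) τ (1 ℕ.+ t-evaluate N) Optimal
        from (s , T≡ , C≡ , _) = runs-ℕ⨾ (runs-post (λ ev → s , cuts≡ ev , λ t eq →
            subst (ℕ._≤ cost N t) (trans (cong (λ κ → C (o ℕ.+ κ)) (plus-key t eq)) C≡) (proj₂ (complete (tables L) t)))
          (runs-evaluate N s 0<N (constants L) ℕ.≤-refl (layer≡ L)
            (cong (ℕ._∸ 1) (trans (cong T (ℕ.+-comm 1 o)) T≡))))

-- Counting the cells and building the grid

quotient-1 : ∀ p → 0ℚ < p → 0ℚ < quotient 1ℚ p × p * quotient 1ℚ p ≡ 1ℚ
quotient-1 p 0<p with p ≟ 0ℚ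
... | yes p≡0 = ⊥-elim (<-irrefl (sym p≡0) 0<p)
... | no  p≢0 = 0<p*q (positive⁻¹ 1ℚ) (positive⁻¹ ((1/ p) {{≢-nonZero p≢0}}) {{1/pos⇒pos p {{positive 0<p}}}})
              , trans (cong (p *_) (*-identityˡ ((1/ p) {{≢-nonZero p≢0}}))) (*-inverseʳ p {{≢-nonZero p≢0}})

module Setup (n : ℕ) (h : ℕ → ℚ) (ε : ℚ) (0<ε : 0ℚ < ε) where

  -- `u` is known to the proof only. Each iteration of the count advances the block index or `N`,
  -- and `h<u` keeps `N` from passing `u`, so there are at most `n + u` iterations.
  module _ (u : ℕ) (h<u : ∀ i → i ℕ.< n → fromℕ 2 * h i < fromℕ u * ε) where

    t-count : ℕ
    t-count = 1 ℕ.+ suc ((n ℕ.+ u) ℕ.* 4)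

    record Counted (σ : Store) : Set where
      field
        N        : ℕ
        N≤u      : N ℕ.≤ u
        cells≡   : nats σ cells# 0 ≡ N
        cellsℚ≡  : rats σ cellsℚ# 0 ≡ fromℕ N
        h<N      : ∀ i → i ℕ.< n → fromℕ 2 * h i < fromℕ N * ε

    runs-countCells : ∀ {σ} → nats σ 0 0 ≡ n → rats σ 0 0 ≡ ε → (∀ i → rats σ 3 i ≡ h i) →
                      nats σ cells# 0 ≡ 0 → rats σ cellsℚ# 0 ≡ 0ℚ → Runs countCells σ t-count Counted
    runs-countCells {σ₀} n≡₀ ε≡₀ h≡₀ c≡₀ q≡₀ = runs-ℕ⨾ (runs-post done (runs-while b countStep 3 I iterate (n ℕ.+ u)
      (record { i = 0 ; N = 0 ; measure = refl ; i≤n = z≤n ; N≤u = z≤n ; i≡ = refl ; cells≡ = c≡₀ ; cellsℚ≡ = q≡₀ ; n≡ = n≡₀ ; ε≡ = ε≡₀ ; h≡ = h≡₀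
              ; h<N = λ _ () })))
      where
      b : BExp
      b = leqℕ (add (lit 1) (var i#)) (var 0)
      record I (m : ℕ) (σ : Store) : Set where
        field
          i N      : ℕ
          measure  : i ℕ.+ N ℕ.+ m ≡ n ℕ.+ u
          i≤n      : i ℕ.≤ n
          N≤u      : N ℕ.≤ u
          i≡       : nats σ i# 0 ≡ i
          cells≡   : nats σ cells# 0 ≡ N
          cellsℚ≡  : rats σ cellsℚ# 0 ≡ fromℕ N
          n≡       : nats σ 0 0 ≡ n
          ε≡       : rats σ 0 0 ≡ ε
          h≡       : ∀ i → rats σ 3 i ≡ h i
          h<N      : ∀ j → j ℕ.< i → fromℕ 2 * h j < fromℕ N * ε
      guard : ∀ {m σ} (inv : I m σ) → ⟦ b ⟧ᵇ σ ≡ does (suc (I.i inv) ℕ.≤? n)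
      guard inv = cong₂ (λ x y → does (suc x ℕ.≤? y)) (I.i≡ inv) (I.n≡ inv)
      positive-measure : ∀ {a m k} → a ℕ.+ m ≡ k → a ℕ.< k → ∃[ m′ ] m ≡ suc m′
      positive-measure {a} {zero}  eq lt = ⊥-elim (ℕ.<-irrefl (trans (sym (ℕ.+-identityʳ a)) eq) lt)
      positive-measure {a} {suc m} eq lt = m , refl
      iterate : ∀ {m σ} → I m σ → ⟦ b ⟧ᵇ σ ≡ true → ∃[ m′ ] m ≡ suc m′ × Runs countStep σ 3 (I m′)
      iterate {m} {σ} inv t = conclude (positive-measure (I.measure inv) (ℕ.+-mono-<-≤ i<n (I.N≤u inv)))
        where
        open I inv
        i<n : i ℕ.< n
        i<n = does-true (suc i ℕ.≤? n) (trans (sym (guard inv)) t)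
        test : leq (rats σ cellsℚ# 0 * rats σ 0 0) (fromℕ 2 * rats σ 3 (nats σ i# 0)) ≡ leq (fromℕ N * ε) (fromℕ 2 * h i)
        test = cong₂ leq (cong₂ _*_ cellsℚ≡ ε≡) (cong (fromℕ 2 *_) (trans (cong (rats σ 3) i≡) (h≡ i)))
        more : fromℕ N * ε ≤ fromℕ 2 * h i → suc N ℕ.≤ u
        more le = ℕ.≰⇒> λ u≤N → <-irrefl refl (<-≤-trans (h<u i i<n)
          (≤-trans (*-monoʳ-≤-nonNeg ε {{nonNegative (<⇒≤ 0<ε)}} (fromℕ-mono-≤ u≤N)) le))
        grow : ∀ j → j ℕ.< i → fromℕ 2 * h j < fromℕ (suc N) * ε
        grow j j<i = <-≤-trans (h<N j j<i) (*-monoʳ-≤-nonNeg ε {{nonNegative (<⇒≤ 0<ε)}} (fromℕ-mono-≤ (ℕ.n≤1+n N)))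
        conclude : ∃[ m′ ] m ≡ suc m′ → ∃[ m′ ] m ≡ suc m′ × Runs countStep σ 3 (I m′)
        conclude (m′ , refl) = m′ , refl , runs-if
          (λ t → runs-ℕ⨾ (runs-ℚ (record
            { i = i ; N = suc N ; measure = trans (shift i N m′) measure ; i≤n = i≤n
            ; N≤u = more (leq-true⁻¹ (fromℕ N * ε) (fromℕ 2 * h i) (trans (sym test) t))
            ; i≡ = i≡ ; cells≡ = cong suc cells≡ ; cellsℚ≡ = trans (cong (_+ 1ℚ) cellsℚ≡) (sym (fromℕ-suc′ N)) ; n≡ = n≡ ; ε≡ = ε≡ ; h≡ = h≡
            ; h<N = grow })))
          (λ f → runs-ℕ⨾ (runs-skip (record
            { i = suc i ; N = N ; measure = trans (sym (ℕ.+-suc (i ℕ.+ N) m′)) measure ; i≤n = i<n ; N≤u = N≤u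
            ; i≡ = cong suc i≡ ; cells≡ = cells≡ ; cellsℚ≡ = cellsℚ≡ ; n≡ = n≡ ; ε≡ = ε≡ ; h≡ = h≡
            ; h<N = λ j j<1+i → next j (ℕ.m<1+n⇒m<n∨m≡n j<1+i) (leq-false⁻¹ (fromℕ N * ε) (fromℕ 2 * h i) (trans (sym test) f)) })))
          where
          shift : ∀ i N m → i ℕ.+ suc N ℕ.+ m ≡ i ℕ.+ N ℕ.+ suc m
          shift = ℕ-Solver.solve-∀
          next : ∀ j → j ℕ.< i ⊎ j ≡ i → fromℕ 2 * h i < fromℕ N * ε → fromℕ 2 * h j < fromℕ N * ε
          next j (inj₁ j<i)  _  = h<N j j<i
          next j (inj₂ refl) lt = lt
      done : ∀ {τ} → (∃[ m ] I m τ) × ⟦ b ⟧ᵇ τ ≡ false → Counted τ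
      done {τ} ((m , inv) , f) = record { N = N ; N≤u = N≤u ; cells≡ = cells≡ ; cellsℚ≡ = cellsℚ≡ ; h<N = λ j j<n → h<N j (ℕ.<-≤-trans j<n n≤i) }
        where
        open I inv
        n≤i : n ℕ.≤ i
        n≤i = ℕ.≮⇒≥ (does-false (suc i ℕ.≤? n) (trans (sym (guard inv)) f))

  t-grid : ℕ → ℕ
  t-grid N = 2 ℕ.+ suc (N ℕ.* 4)

  runs-buildGrid : ∀ {σ} N δ → nats σ cells# 0 ≡ N → quotient 1ℚ (rats σ cellsℚ# 0) ≡ δ → rats σ grid# 0 ≡ 0ℚ →
                   Runs buildGrid σ (t-grid N) (λ τ → ∀ j → j ℕ.≤ N → rats τ grid# j ≡ grid δ j × nats τ powers# j ≡ 2 ℕ.^ j)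
  runs-buildGrid {σ₀} N δ N≡ δ≡ 0≡ = runs-ℕ⨾ (runs-ℕ⨾ (runs-post (λ inv j j≤N → built inv j j≤N)
    (runs-forUp j# (var cells#) gridStep N 2 I (λ inv → j-value inv , cells inv) body 0 z≤n
      (record { j-value = refl ; cells = N≡ ; step≡ = δ≡ ; built = λ { zero z≤n → trans 0≡ (sym (grid-zero δ)) , refl } }))))
    where
    record I (j : ℕ) (σ : Store) : Set where
      field
        j-value : nats σ j# 0 ≡ j
        cells   : nats σ cells# 0 ≡ N
        step≡   : quotient 1ℚ (rats σ cellsℚ# 0) ≡ δ
        built   : ∀ i → i ℕ.≤ j → rats σ grid# i ≡ grid δ i × nats σ powers# i ≡ 2 ℕ.^ i
    open I
    body : ∀ {j σ} → j ℕ.< N → I j σ → Runs gridStep σ 2 (λ τ → I (suc j) (setℕ j# 0 (nats τ j# 0 ℕ.+ 1) τ))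
    body {j} {σ} j<N inv = runs-ℚ⨾ (runs-ℕ (record
      { j-value = x+1≡suc (j-value inv) ; cells = cells inv ; step≡ = step≡ inv ; built = λ i i≤1+j → extended i (ℕ.m≤n⇒m<n∨m≡n i≤1+j) }))
      where
      j≡ : nats σ j# 0 ≡ j
      j≡ = j-value inv
      newG : ℚ
      newG = rats σ grid# (nats σ j# 0) + quotient 1ℚ (rats σ cellsℚ# 0)
      newP : ℕ
      newP = 2 ℕ.* nats σ powers# (nats σ j# 0)
      extended : ∀ i → i ℕ.< suc j ⊎ i ≡ suc j →
                 update (rats σ) grid# (suc (nats σ j# 0)) newG grid# i ≡ grid δ i × update (nats σ) powers# (suc (nats σ j# 0)) newP powers# i ≡ 2 ℕ.^ i
      extended i (inj₁ (s≤s i≤j)) =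
          trans (update-other (rats σ) grid# (suc (nats σ j# 0)) newG i different) (proj₁ (built inv i i≤j))
        , trans (update-other (nats σ) powers# (suc (nats σ j# 0)) newP i different) (proj₂ (built inv i i≤j))
        where
        different : suc (nats σ j# 0) ≢ i
        different eq = ℕ.<⇒≢ (s≤s i≤j) (trans (sym eq) (cong suc j≡))
      extended i (inj₂ refl) =
          trans (update-at (rats σ) grid# (suc (nats σ j# 0)) newG (cong suc j≡))
            (trans (cong₂ _+_ (trans (cong (rats σ grid#) j≡) (proj₁ (built inv j ℕ.≤-refl))) (step≡ inv)) (sym (grid-suc δ j)))
        , trans (update-at (nats σ) powers# (suc (nats σ j# 0)) newP (cong suc j≡))
            (cong (2 ℕ.*_) (trans (cong (nats σ powers#) j≡) (proj₂ (built inv j ℕ.≤-refl))))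

-- Running time

count : ℕ → (ℕ → Bool) → ℕ
count k p = ∑ℕ k (bit ∘ p)

∑ℕ-front : ∀ k f → ∑ℕ (suc k) f ≡ f 0 ℕ.+ ∑ℕ k (f ∘ suc)
∑ℕ-front zero    f = sym (ℕ.+-identityʳ (f 0))
∑ℕ-front (suc k) f = trans (cong (ℕ._+ f (suc k)) (∑ℕ-front k f)) (ℕ.+-assoc (f 0) (∑ℕ k (f ∘ suc)) (f (suc k)))

count≤card : ∀ n (p : ℕ → Bool) (q : Fin n → Bool) → (∀ i → p (toℕ i) ≡ true → q i ≡ true) → count n p ℕ.≤ card (tabulate q)
count≤card zero    p q imp = z≤n
count≤card (suc n) p q imp = subst (ℕ._≤ card (tabulate q)) (sym (∑ℕ-front n (bit ∘ p)))
  (head (p 0) (q zero) (imp zero) {v = tabulate (q ∘ suc)} (count≤card n (p ∘ suc) (q ∘ suc) (λ i → imp (suc i))))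
  where
  head : ∀ a b → (a ≡ true → b ≡ true) → ∀ {k} {v : Vec Bool n} → k ℕ.≤ card v → bit a ℕ.+ k ℕ.≤ card (b ∷ v)
  head true  true  _ le = s≤s le
  head true  false f le with () ← f refl
  head false true  _ le = ℕ.m≤n⇒m≤1+n le
  head false false _ le = le

-- One step of charging marked cells to blocks: `r` selects the blocks starting in the next cell,
-- `p` and `q` the unfinished ones that start before and up to it. A new mark brings in at least one
-- new block.
count-any : ∀ n (p q r : ℕ → Bool) → (∀ i → p i ≡ true → q i ≡ true) → (∀ i → r i ≡ true → p i ≡ false × q i ≡ true) →
            bit (any n r) ℕ.+ count n p ℕ.≤ count n q
count-any zero    p q r p⇒q r⇒ = z≤n
count-any (suc n) p q r p⇒q r⇒ = by-cases (r n) refl (p n) refl (q n) refl (any n r) (count-any n p q r p⇒q r⇒)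
  where
  by-cases : ∀ a → r n ≡ a → ∀ b → p n ≡ b → ∀ c → q n ≡ c → ∀ x → bit x ℕ.+ count n p ℕ.≤ count n q →
             bit (a ∨ x) ℕ.+ (count n p ℕ.+ bit b) ℕ.≤ count n q ℕ.+ bit c
  by-cases true ra b pb c qc x le with trans (sym pb) (proj₁ (r⇒ n ra)) | trans (sym qc) (proj₂ (r⇒ n ra))
  ... | refl | refl = subst₂ ℕ._≤_ (cong suc (sym (ℕ.+-identityʳ (count n p)))) (ℕ.+-comm 1 (count n q))
                        (s≤s (ℕ.≤-trans (ℕ.m≤n+m (count n p) (bit x)) le))
  by-cases false ra true pb c qc x le with trans (sym qc) (p⇒q n pb)
  ... | refl = ℕ.≤-trans (ℕ.≤-reflexive (sym (ℕ.+-assoc (bit x) (count n p) 1))) (ℕ.+-monoˡ-≤ 1 le)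
  by-cases false ra false pb c qc x le =
    ℕ.≤-trans (ℕ.≤-reflexive (cong (bit x ℕ.+_) (ℕ.+-identityʳ (count n p)))) (ℕ.≤-trans le (ℕ.m≤m+n (count n q) (bit c)))

-- The left side is one term of the binomial expansion of the right side.
bernoulli : ∀ r a b → suc r ℕ.* (b ℕ.* a ℕ.^ r) ℕ.≤ (a ℕ.+ b) ℕ.^ suc r
bernoulli zero    a b = ℕ.≤-trans (ℕ.m≤n+m (1 ℕ.* (b ℕ.* 1)) a) (ℕ.≤-reflexive (identity a b))
  where
  identity : ∀ a b → a ℕ.+ 1 ℕ.* (b ℕ.* 1) ≡ (a ℕ.+ b) ℕ.* 1
  identity = ℕ-Solver.solve-∀
bernoulli (suc r) a b = begin
  suc (suc r) ℕ.* (b ℕ.* (a ℕ.* a ℕ.^ r))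
    ≡⟨ regroup r a b (a ℕ.^ r) ⟩
  a ℕ.* (suc r ℕ.* (b ℕ.* a ℕ.^ r)) ℕ.+ b ℕ.* (a ℕ.^ suc r)
    ≤⟨ ℕ.+-mono-≤ (ℕ.*-monoʳ-≤ a (bernoulli r a b)) (ℕ.*-monoʳ-≤ b (ℕ.^-monoˡ-≤ (suc r) (ℕ.m≤m+n a b))) ⟩
  a ℕ.* (a ℕ.+ b) ℕ.^ suc r ℕ.+ b ℕ.* (a ℕ.+ b) ℕ.^ suc r
    ≡⟨ sym (ℕ.*-distribʳ-+ ((a ℕ.+ b) ℕ.^ suc r) a b) ⟩
  (a ℕ.+ b) ℕ.^ suc (suc r) ∎
  where
  open ℕ.≤-Reasoning
  regroup : ∀ r a b p → suc (suc r) ℕ.* (b ℕ.* (a ℕ.* p)) ≡ a ℕ.* (suc r ℕ.* (b ℕ.* p)) ℕ.+ b ℕ.* (a ℕ.* p)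
  regroup = ℕ-Solver.solve-∀

-- The digits have sizes 2 g for gaps g with sum at most j + len, so by AM-GM
-- (in the weaker form with r ! instead of r ^ r) the number of codes is small.
radix-bound : ∀ mark j len R → radix mark j len R ℕ.* count j mark ! ℕ.≤ R ℕ.* (2 ℕ.* (j ℕ.+ len)) ℕ.^ count j mark
radix-bound mark zero    len R = ℕ.≤-refl
radix-bound mark (suc j) len R with mark j
... | false = subst₂ (λ c x → radix mark j (suc len) R ℕ.* c ! ℕ.≤ R ℕ.* (2 ℕ.* x) ℕ.^ c)
  (sym (ℕ.+-identityʳ (count j mark))) (ℕ.+-suc j len) (radix-bound mark j (suc len) R)
... | true  = subst (λ c → radix mark j 0 (R ℕ.* (2 ℕ.* suc len)) ℕ.* c ! ℕ.≤ R ℕ.* (2 ℕ.* (suc j ℕ.+ len)) ℕ.^ c)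
  (ℕ.+-comm 1 (count j mark)) (begin
  radix mark j 0 (R ℕ.* (2 ℕ.* suc len)) ℕ.* (suc r ℕ.* r !)
    ≡⟨ swap (radix mark j 0 (R ℕ.* (2 ℕ.* suc len))) (suc r) (r !) ⟩
  suc r ℕ.* (radix mark j 0 (R ℕ.* (2 ℕ.* suc len)) ℕ.* r !)
    ≤⟨ ℕ.*-monoʳ-≤ (suc r) (radix-bound mark j 0 (R ℕ.* (2 ℕ.* suc len))) ⟩
  suc r ℕ.* (R ℕ.* (2 ℕ.* suc len) ℕ.* (2 ℕ.* (j ℕ.+ 0)) ℕ.^ r)
    ≡⟨ regroup (suc r) R (2 ℕ.* suc len) ((2 ℕ.* (j ℕ.+ 0)) ℕ.^ r) ⟩
  R ℕ.* (suc r ℕ.* (2 ℕ.* suc len ℕ.* (2 ℕ.* (j ℕ.+ 0)) ℕ.^ r))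
    ≤⟨ ℕ.*-monoʳ-≤ R (bernoulli r (2 ℕ.* (j ℕ.+ 0)) (2 ℕ.* suc len)) ⟩
  R ℕ.* (2 ℕ.* (j ℕ.+ 0) ℕ.+ 2 ℕ.* suc len) ℕ.^ suc r
    ≡⟨ cong (λ x → R ℕ.* x ℕ.^ suc r) (double j len) ⟩
  R ℕ.* (2 ℕ.* (suc j ℕ.+ len)) ℕ.^ suc r ∎)
  where
  open ℕ.≤-Reasoning
  r : ℕ
  r = count j mark
  swap : ∀ a b c → a ℕ.* (b ℕ.* c) ≡ b ℕ.* (a ℕ.* c)
  swap = ℕ-Solver.solve-∀
  regroup : ∀ a b c d → a ℕ.* (b ℕ.* c ℕ.* d) ≡ b ℕ.* (a ℕ.* (c ℕ.* d))
  regroup = ℕ-Solver.solve-∀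
  double : ∀ j l → 2 ℕ.* (j ℕ.+ 0) ℕ.+ 2 ℕ.* suc l ≡ 2 ℕ.* (suc j ℕ.+ l)
  double = ℕ-Solver.solve-∀

-- The quotient of the two powers is largest for `r` equal to 2 and 3, where it is 9/2; every
-- further factor of the factorial is more than 3.
3^r≤5r! : ∀ r → 3 ℕ.^ r ℕ.≤ 5 ℕ.* r !
3^r≤5r! 0 = s≤s z≤n
3^r≤5r! 1 = ℕ.m≤m+n 3 2
3^r≤5r! 2 = ℕ.m≤m+n 9 1
3^r≤5r! (suc (suc (suc r))) = go r
  where
  go : ∀ r → 3 ℕ.^ (3 ℕ.+ r) ℕ.≤ 5 ℕ.* (3 ℕ.+ r) !
  go zero    = ℕ.m≤m+n 27 3
  go (suc r) = ℕ.≤-trans (ℕ.*-monoʳ-≤ 3 (go r)) (ℕ.≤-trans (ℕ.*-monoˡ-≤ (5 ℕ.* (3 ℕ.+ r) !) (ℕ.m≤m+n 3 (suc r)))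
    (ℕ.≤-reflexive (swap (3 ℕ.+ suc r) ((3 ℕ.+ r) !))))
    where
    swap : ∀ a b → a ℕ.* (5 ℕ.* b) ≡ 5 ℕ.* (a ℕ.* b)
    swap = ℕ-Solver.solve-∀

module Marks (n : ℕ) (l r h : ℕ → ℚ) (δ ε : ℚ)
             (0<δ : 0ℚ < δ) (0≤l : ∀ i → i ℕ.< n → 0ℚ ≤ l i) (l<r : ∀ i → i ℕ.< n → l i < r i) where

  open Dynamic n l r h δ ε 0<δ 0≤l l<r

  active : ℕ → ℕ → ℕ → Bool
  active k j i = not (leq (G j) (l i)) ∧ not (leq (r i) (G k))

  -- Every marked cell contains the left end of some unfinished block, and a block has its left end
  -- in one cell only.
  count-marked : ∀ k j → count j (marked k) ℕ.≤ count n (active k j)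
  count-marked k zero    = z≤n
  count-marked k (suc j) = ℕ.≤-trans (ℕ.≤-trans (ℕ.≤-reflexive (ℕ.+-comm (count j (marked k)) (bit (marked k j)))) (ℕ.+-monoʳ-≤ (bit (marked k j)) (count-marked k j)))
    (count-any n (active k j) (active k (suc j)) (starts k j) earlier new)
    where
    earlier : ∀ i → active k j i ≡ true → active k (suc j) i ≡ true
    earlier i eq = cong₂ (λ a b → not a ∧ b) (leq-false (<-≤-trans (leq-false⁻¹ (G j) (l i) (not-true (proj₁ (∧-true eq)))) (G-step j)))
                                         (proj₂ (∧-true {not (leq (G j) (l i))} eq))
    new : ∀ i → starts k j i ≡ true → active k j i ≡ false × active k (suc j) i ≡ true
    new i eq = cong (λ a → not a ∧ not (leq (r i) (G k))) (leq-true (proj₁ (starts⁻¹ k j i eq)))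
             , cong₂ (λ a b → not a ∧ not b) (leq-false (proj₁ (proj₂ (starts⁻¹ k j i eq)))) (leq-false (proj₂ (proj₂ (starts⁻¹ k j i eq))))

  keys-bound : ∀ k → keys k ℕ.* count k (marked k) ! ℕ.≤ 2 ℕ.* (2 ℕ.* k) ℕ.^ count k (marked k)
  keys-bound k = subst (λ x → keys k ℕ.* count k (marked k) ! ℕ.≤ 2 ℕ.* (2 ℕ.* x) ℕ.^ count k (marked k)) (ℕ.+-identityʳ k)
    (radix-bound (marked k) k 0 2)

fromℕ-^ : ∀ m r → fromℕ (m ℕ.^ r) ≡ fromℕ m ^ r
fromℕ-^ m zero    = refl
fromℕ-^ m (suc r) = trans (fromℕ-* m (m ℕ.^ r)) (cong (fromℕ m *_) (fromℕ-^ m r))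

0≤^ : ∀ {x} r → 0ℚ ≤ x → 0ℚ ≤ x ^ r
0≤^ zero    0≤x = nonNegative⁻¹ 1ℚ
0≤^ (suc r) 0≤x = 0≤p*q 0≤x (0≤^ r 0≤x)

^-monoˡ-≤ : ∀ {x y} r → 0ℚ ≤ x → x ≤ y → x ^ r ≤ y ^ r
^-monoˡ-≤ zero    0≤x x≤y = ≤-refl
^-monoˡ-≤ {x} {y} (suc r) 0≤x x≤y = *-mono-≤-nonNeg {x} {y} {x ^ r} {y ^ r} 0≤x (0≤^ r (≤-trans 0≤x x≤y)) x≤y (^-monoˡ-≤ r 0≤x x≤y)

1≤^ : ∀ {x} r → 1ℚ ≤ x → 1ℚ ≤ x ^ r
1≤^ zero    1≤x = ≤-refl
1≤^ {x} (suc r) 1≤x = *-mono-≤-nonNeg {1ℚ} {x} {1ℚ} {x ^ r} (nonNegative⁻¹ 1ℚ) (≤-trans (nonNegative⁻¹ 1ℚ) (1≤^ r 1≤x)) 1≤x (1≤^ r 1≤x)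

^-monoʳ-≤ : ∀ {x r d} → 1ℚ ≤ x → r ℕ.≤ d → x ^ r ≤ x ^ d
^-monoʳ-≤ {d = d} 1≤x z≤n       = 1≤^ d 1≤x
^-monoʳ-≤ {x}     1≤x (s≤s r≤d) = *-monoˡ-≤-nonNeg x {{nonNegative (≤-trans (nonNegative⁻¹ 1ℚ) 1≤x)}} (^-monoʳ-≤ 1≤x r≤d)

^-distrib-* : ∀ x y r → (x * y) ^ r ≡ x ^ r * y ^ r
^-distrib-* x y zero    = refl
^-distrib-* x y (suc r) = trans (cong (x * y *_) (^-distrib-* x y r)) (interchange x y (x ^ r) (y ^ r))
  where
  interchange : ∀ a b c d → (a * b) * (c * d) ≡ (a * c) * (b * d)
  interchange = solve-∀ ℚ-ring

^-+2 : ∀ x d → x ^ (d ℕ.+ 2) ≡ x ^ d * (x * x)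
^-+2 x zero    = identity x
  where
  identity : ∀ x → x * (x * 1ℚ) ≡ 1ℚ * (x * x)
  identity = solve-∀ ℚ-ring
^-+2 x (suc d) = trans (cong (x *_) (^-+2 x d)) (sym (*-assoc x (x ^ d) (x * x)))

-- Since `2u ≤ 3x`, the numerator is at most `2 * (3x)^r`, and `3^r` is at most five factorials, so
-- `r !` cancels. The constant 10 is this 5 times the radix 2 of the last sign.
factorial-cancel : ∀ K r k u x d → K ℕ.* r ! ℕ.≤ 2 ℕ.* (2 ℕ.* k) ℕ.^ r → k ℕ.≤ u → fromℕ 2 * fromℕ u ≤ fromℕ 3 * x → 1ℚ ≤ x → r ℕ.≤ d →
                   fromℕ K ≤ fromℕ 10 * x ^ d
factorial-cancel K r k u x d K≤ k≤u 2u≤3x 1≤x r≤d = p*q≤r⇒q≤r÷p {fromℕ (r !)} {fromℕ K} {fromℕ 10 * x ^ d} 0<r! (begin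
  fromℕ (r !) * fromℕ K                        ≡⟨ trans (*-comm (fromℕ (r !)) (fromℕ K)) (sym (fromℕ-* K (r !))) ⟩
  fromℕ (K ℕ.* r !)                            ≤⟨ fromℕ-mono-≤ (ℕ.≤-trans K≤ (ℕ.*-monoʳ-≤ 2 (ℕ.^-monoˡ-≤ r (ℕ.*-monoʳ-≤ 2 k≤u)))) ⟩
  fromℕ (2 ℕ.* (2 ℕ.* u) ℕ.^ r)                ≡⟨ trans (fromℕ-* 2 ((2 ℕ.* u) ℕ.^ r)) (cong (fromℕ 2 *_) (fromℕ-^ (2 ℕ.* u) r)) ⟩
  fromℕ 2 * fromℕ (2 ℕ.* u) ^ r                ≤⟨ *-monoˡ-≤-nonNeg (fromℕ 2) (^-monoˡ-≤ r (0≤fromℕ (2 ℕ.* u)) (subst (_≤ fromℕ 3 * x) (sym (fromℕ-* 2 u)) 2u≤3x)) ⟩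
  fromℕ 2 * (fromℕ 3 * x) ^ r                  ≡⟨ cong (fromℕ 2 *_) (trans (^-distrib-* (fromℕ 3) x r) (cong (_* x ^ r) (sym (fromℕ-^ 3 r)))) ⟩
  fromℕ 2 * (fromℕ (3 ℕ.^ r) * x ^ r)          ≤⟨ *-monoˡ-≤-nonNeg (fromℕ 2) (*-monoʳ-≤-nonNeg (x ^ r) {{nonNegative (0≤^ r 0≤x)}} (fromℕ-mono-≤ (3^r≤5r! r))) ⟩
  fromℕ 2 * (fromℕ (5 ℕ.* r !) * x ^ r)        ≤⟨ *-monoˡ-≤-nonNeg (fromℕ 2) (*-monoˡ-≤-nonNeg (fromℕ (5 ℕ.* r !)) {{nonNegative (0≤fromℕ (5 ℕ.* r !))}} (^-monoʳ-≤ {x} 1≤x r≤d)) ⟩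
  fromℕ 2 * (fromℕ (5 ℕ.* r !) * x ^ d)        ≡⟨ cong (λ y → fromℕ 2 * (y * x ^ d)) (fromℕ-* 5 (r !)) ⟩
  fromℕ 2 * (fromℕ 5 * fromℕ (r !) * x ^ d)    ≡⟨ regroup (fromℕ (r !)) (x ^ d) ⟩
  fromℕ (r !) * (fromℕ 10 * x ^ d)             ∎)
  where
  open ≤-Reasoning
  0≤x : 0ℚ ≤ x
  0≤x = ≤-trans (nonNegative⁻¹ 1ℚ) 1≤x
  0<r! : 0ℚ < fromℕ (r !)
  0<r! = <-≤-trans (positive⁻¹ 1ℚ) (fromℕ-mono-≤ {1} {r !} (1≤! r))
    where
    1≤! : ∀ r → 1 ℕ.≤ r !
    1≤! zero    = s≤s z≤n
    1≤! (suc r) = ℕ.≤-trans (1≤! r) (ℕ.m≤m+n (r !) (r ℕ.* r !))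
  regroup : ∀ f p → fromℕ 2 * (fromℕ 5 * f * p) ≡ f * (fromℕ 10 * p)
  regroup = solve-∀ ℚ-ring

-- The estimate `B` is rational while step counts are natural numbers, so an integral maximum has to
-- come in between.
common-bound : ∀ N (f : ℕ → ℕ) B → 1ℚ ≤ B → (∀ k → k ℕ.< N → fromℕ (f k) ≤ B) →
               ∃[ K ] 1 ℕ.≤ K × (∀ k → k ℕ.< N → f k ℕ.≤ K) × fromℕ K ≤ B
common-bound zero    f B 1≤B f≤B = 1 , s≤s z≤n , (λ _ ()) , 1≤B
common-bound (suc N) f B 1≤B f≤B = enlarge (common-bound N f B 1≤B (λ k k<N → f≤B k (ℕ.m<n⇒m<1+n k<N)))
  where
  enlarge : ∃[ K ] 1 ℕ.≤ K × (∀ k → k ℕ.< N → f k ℕ.≤ K) × fromℕ K ≤ B → ∃[ K ] 1 ℕ.≤ K × (∀ k → k ℕ.< suc N → f k ℕ.≤ K) × fromℕ K ≤ B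
  enlarge (K , 1≤K , f≤K , K≤B) = by-cases (ℕ.≤-total (f N) K)
    where
    by-cases : f N ℕ.≤ K ⊎ K ℕ.≤ f N → _
    by-cases (inj₁ le) = K , 1≤K , (λ k k<1+N → below k (ℕ.m<1+n⇒m<n∨m≡n k<1+N)) , K≤B
      where
      below : ∀ k → k ℕ.< N ⊎ k ≡ N → f k ℕ.≤ K
      below k (inj₁ k<N)  = f≤K k k<N
      below k (inj₂ refl) = le
    by-cases (inj₂ le) = f N , ℕ.≤-trans 1≤K le , (λ k k<1+N → below k (ℕ.m<1+n⇒m<n∨m≡n k<1+N)) , f≤B N ℕ.≤-refl
      where
      below : ∀ k → k ℕ.< N ⊎ k ≡ N → f k ℕ.≤ f N
      below k (inj₁ k<N)  = ℕ.≤-trans (f≤K k k<N) le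
      below k (inj₂ refl) = ℕ.≤-refl

bilinear-bound : ∀ {k N n} a b c d → k ℕ.≤ N → 1 ℕ.≤ N → 1 ℕ.≤ n →
                 a ℕ.+ b ℕ.* k ℕ.+ c ℕ.* n ℕ.+ d ℕ.* (n ℕ.* k) ℕ.≤ (a ℕ.+ b ℕ.+ c ℕ.+ d) ℕ.* (N ℕ.* n)
bilinear-bound {k} {N} {n} a b c d k≤N 1≤N 1≤n = begin
  a ℕ.+ b ℕ.* k ℕ.+ c ℕ.* n ℕ.+ d ℕ.* (n ℕ.* k)
    ≤⟨ ℕ.+-mono-≤ (ℕ.+-mono-≤ (ℕ.+-mono-≤ a≤ (ℕ.*-monoʳ-≤ b k≤X)) (ℕ.*-monoʳ-≤ c n≤X)) (ℕ.*-monoʳ-≤ d nk≤X) ⟩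
  a ℕ.* X ℕ.+ b ℕ.* X ℕ.+ c ℕ.* X ℕ.+ d ℕ.* X
    ≡⟨ collect a b c d X ⟩
  (a ℕ.+ b ℕ.+ c ℕ.+ d) ℕ.* X ∎
  where
  open ℕ.≤-Reasoning
  X : ℕ
  X = N ℕ.* n
  N≤X : N ℕ.≤ X
  N≤X = subst (ℕ._≤ X) (ℕ.*-identityʳ N) (ℕ.*-monoʳ-≤ N 1≤n)
  n≤X : n ℕ.≤ X
  n≤X = subst (ℕ._≤ X) (ℕ.*-identityˡ n) (ℕ.*-monoˡ-≤ n 1≤N)
  k≤X : k ℕ.≤ X
  k≤X = ℕ.≤-trans k≤N N≤X
  nk≤X : n ℕ.* k ℕ.≤ X
  nk≤X = ℕ.≤-trans (ℕ.≤-reflexive (ℕ.*-comm n k)) (ℕ.*-monoˡ-≤ n k≤N)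
  a≤ : a ℕ.≤ a ℕ.* X
  a≤ = subst (ℕ._≤ a ℕ.* X) (ℕ.*-identityʳ a) (ℕ.*-monoʳ-≤ a (ℕ.≤-trans 1≤N N≤X))
  collect : ∀ a b c d x → a ℕ.* x ℕ.+ b ℕ.* x ℕ.+ c ℕ.* x ℕ.+ d ℕ.* x ≡ (a ℕ.+ b ℕ.+ c ℕ.+ d) ℕ.* x
  collect = ℕ-Solver.solve-∀

module Time (n N : ℕ) (l r h : ℕ → ℚ) (δ ε : ℚ)
            (0<δ : 0ℚ < δ) (0≤l : ∀ i → i ℕ.< n → 0ℚ ≤ l i) (l<r : ∀ i → i ℕ.< n → l i < r i)
            (1≤N : 1 ℕ.≤ N) (1≤n : 1 ℕ.≤ n) where

  open Dynamic n l r h δ ε 0<δ 0≤l l<r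
  open Specs n N l r h δ ε 0<δ 0≤l l<r
  open Search n N l r h δ ε 0<δ 0≤l l<r

  X : ℕ
  X = N ℕ.* n

  1≤X : 1 ℕ.≤ X
  1≤X = ℕ.*-mono-≤ 1≤N 1≤n

  t-evaluate≤ : ∀ k → k ℕ.≤ N → t-evaluate k ℕ.≤ 59 ℕ.* X
  t-evaluate≤ k k≤N = ℕ.≤-trans
    (ℕ.+-monoʳ-≤ (t-decode k) (ℕ.+-monoʳ-≤ (t-check k) (ℕ.+-monoʳ-≤ (t-key k)
      (ℕ.+-monoʳ-≤ 3 (s≤s (ℕ.*-monoˡ-≤ 6 (ℕ.m∸n≤m k 1)))))))
    (ℕ.≤-trans (ℕ.≤-reflexive (expand k n)) (bilinear-bound 16 21 9 13 k≤N 1≤N 1≤n))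
    where
    expand : ∀ k n → (2 ℕ.+ suc (k ℕ.* 5)) ℕ.+ ((2 ℕ.+ suc (n ℕ.* (2 ℕ.+ suc (3 ℕ.+ suc (k ℕ.* 9) ℕ.+ 2)))) ℕ.+
                     ((5 ℕ.+ suc (k ℕ.* (2 ℕ.+ (1 ℕ.+ (1 ℕ.+ suc (n ℕ.* 4)) ℕ.+ 5)))) ℕ.+ (3 ℕ.+ suc (k ℕ.* 6))))
                     ≡ 16 ℕ.+ 21 ℕ.* k ℕ.+ 9 ℕ.* n ℕ.+ 13 ℕ.* (n ℕ.* k)
    expand = ℕ-Solver.solve-∀

  t-key≤ : ∀ k → k ℕ.≤ N → t-key k ℕ.≤ 20 ℕ.* X
  t-key≤ k k≤N = ℕ.≤-trans (ℕ.≤-reflexive (expand k n)) (bilinear-bound 6 10 0 4 k≤N 1≤N 1≤n)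
    where
    expand : ∀ k n → 5 ℕ.+ suc (k ℕ.* (2 ℕ.+ (1 ℕ.+ (1 ℕ.+ suc (n ℕ.* 4)) ℕ.+ 5))) ≡ 6 ℕ.+ 10 ℕ.* k ℕ.+ 0 ℕ.* n ℕ.+ 4 ℕ.* (n ℕ.* k)
    expand = ℕ-Solver.solve-∀

  t-layer≤ : ∀ K → 1 ℕ.≤ K → (∀ k → k ℕ.< N → keys k ℕ.≤ K) → ∀ k → k ℕ.< N → t-layer k ℕ.≤ 154 ℕ.* (K ℕ.* X)
  t-layer≤ K 1≤K keys≤K k k<N = ℕ.≤-trans
    (ℕ.+-mono-≤ (t-key≤ k (ℕ.<⇒≤ k<N)) (ℕ.+-monoʳ-≤ 3 (ℕ.+-monoˡ-≤ 1 (s≤s (ℕ.*-mono-≤ (keys≤K k k<N)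
      (ℕ.+-monoʳ-≤ 2 (s≤s (ℕ.+-mono-≤ step≤ step≤))))))))
    (polynomial K X 1≤K 1≤X)
    where
    step≤ : t-step k ℕ.≤ 4 ℕ.+ 59 ℕ.* X
    step≤ = ℕ.≤-trans (s≤s (ℕ.+-monoˡ-≤ 3 (t-evaluate≤ (suc k) k<N))) (ℕ.≤-reflexive (cong suc (ℕ.+-comm (59 ℕ.* X) 3)))
    polynomial : ∀ K X → 1 ℕ.≤ K → 1 ℕ.≤ X →
      20 ℕ.* X ℕ.+ (3 ℕ.+ (suc (K ℕ.* (2 ℕ.+ suc ((4 ℕ.+ 59 ℕ.* X) ℕ.+ (4 ℕ.+ 59 ℕ.* X)))) ℕ.+ 1)) ℕ.≤ 154 ℕ.* (K ℕ.* X)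
    -- 154 is the exact value at `K = X = 1`; the added polynomial is the slack in the two variables
    -- shifted by one.
    polynomial (suc K) (suc X) _ _ = ℕ.≤-trans (ℕ.m≤m+n _ (25 ℕ.* K ℕ.+ 16 ℕ.* X ℕ.+ 36 ℕ.* (K ℕ.* X))) (ℕ.≤-reflexive (identity K X))
      where
      identity : ∀ K X → 20 ℕ.* suc X ℕ.+ (3 ℕ.+ (suc (suc K ℕ.* (2 ℕ.+ suc ((4 ℕ.+ 59 ℕ.* suc X) ℕ.+ (4 ℕ.+ 59 ℕ.* suc X)))) ℕ.+ 1))
                         ℕ.+ (25 ℕ.* K ℕ.+ 16 ℕ.* X ℕ.+ 36 ℕ.* (K ℕ.* X)) ≡ 154 ℕ.* (suc K ℕ.* suc X)
      identity = ℕ-Solver.solve-∀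

  -- Every term is at most its coefficient times `Z`, and 238 is the sum of the coefficients 11, 4,
  -- 4, 6, 59 and 154.
  total≤ : ∀ K u → 1 ℕ.≤ K → N ℕ.≤ u →
    suc (suc ((1 ℕ.+ suc ((n ℕ.+ u) ℕ.* 4)) ℕ.+ ((2 ℕ.+ suc (N ℕ.* 4)) ℕ.+ (1 ℕ.+
      (1 ℕ.+ (suc (N ℕ.* (2 ℕ.+ 154 ℕ.* (K ℕ.* X))) ℕ.+ (1 ℕ.+ t-evaluate N))))))) ℕ.≤ 238 ℕ.* (K ℕ.* (u ℕ.* (u ℕ.* n)))
  total≤ K u 1≤K N≤u = begin
    suc (suc ((1 ℕ.+ suc ((n ℕ.+ u) ℕ.* 4)) ℕ.+ ((2 ℕ.+ suc (N ℕ.* 4)) ℕ.+ (1 ℕ.+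
      (1 ℕ.+ (suc (N ℕ.* (2 ℕ.+ 154 ℕ.* (K ℕ.* X))) ℕ.+ (1 ℕ.+ t-evaluate N)))))))
      ≤⟨ s≤s (s≤s (ℕ.+-monoʳ-≤ (1 ℕ.+ suc ((n ℕ.+ u) ℕ.* 4)) (ℕ.+-monoʳ-≤ (2 ℕ.+ suc (N ℕ.* 4)) (s≤s (s≤s
           (ℕ.+-monoʳ-≤ (suc (N ℕ.* (2 ℕ.+ 154 ℕ.* (K ℕ.* X)))) (s≤s (t-evaluate≤ N ℕ.≤-refl)))))))) ⟩
    suc (suc ((1 ℕ.+ suc ((n ℕ.+ u) ℕ.* 4)) ℕ.+ ((2 ℕ.+ suc (N ℕ.* 4)) ℕ.+ (1 ℕ.+
      (1 ℕ.+ (suc (N ℕ.* (2 ℕ.+ 154 ℕ.* (K ℕ.* X))) ℕ.+ (1 ℕ.+ 59 ℕ.* X)))))))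
      ≡⟨ expand n u N K X ⟩
    11 ℕ.+ 4 ℕ.* n ℕ.+ 4 ℕ.* u ℕ.+ 6 ℕ.* N ℕ.+ 59 ℕ.* X ℕ.+ 154 ℕ.* (K ℕ.* (N ℕ.* X))
      ≤⟨ ℕ.+-mono-≤ (ℕ.+-mono-≤ (ℕ.+-mono-≤ (ℕ.+-mono-≤ (ℕ.+-mono-≤ (ℕ.*-monoʳ-≤ 11 1≤Z) (ℕ.*-monoʳ-≤ 4 n≤Z)) (ℕ.*-monoʳ-≤ 4 u≤Z))
           (ℕ.*-monoʳ-≤ 6 (ℕ.≤-trans N≤u u≤Z))) (ℕ.*-monoʳ-≤ 59 (ℕ.≤-trans X≤Y Y≤Z))) (ℕ.*-monoʳ-≤ 154 (ℕ.*-monoʳ-≤ K (ℕ.*-mono-≤ N≤u X≤Y))) ⟩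
    11 ℕ.* Z ℕ.+ 4 ℕ.* Z ℕ.+ 4 ℕ.* Z ℕ.+ 6 ℕ.* Z ℕ.+ 59 ℕ.* Z ℕ.+ 154 ℕ.* Z
      ≡⟨ collect Z ⟩
    238 ℕ.* Z ∎
    where
    open ℕ.≤-Reasoning
    Y Z : ℕ
    Y = u ℕ.* n
    Z = K ℕ.* (u ℕ.* Y)
    1≤u : 1 ℕ.≤ u
    1≤u = ℕ.≤-trans 1≤N N≤u
    X≤Y : X ℕ.≤ Y
    X≤Y = ℕ.*-monoˡ-≤ n N≤u
    Y≤Z : Y ℕ.≤ Z
    Y≤Z = ℕ.≤-trans (subst (ℕ._≤ u ℕ.* Y) (ℕ.*-identityˡ Y) (ℕ.*-monoˡ-≤ Y 1≤u))
                    (subst (ℕ._≤ Z) (ℕ.*-identityˡ (u ℕ.* Y)) (ℕ.*-monoˡ-≤ (u ℕ.* Y) 1≤K))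
    n≤Z : n ℕ.≤ Z
    n≤Z = ℕ.≤-trans (subst (ℕ._≤ Y) (ℕ.*-identityˡ n) (ℕ.*-monoˡ-≤ n 1≤u)) Y≤Z
    u≤Z : u ℕ.≤ Z
    u≤Z = ℕ.≤-trans (subst (ℕ._≤ Y) (ℕ.*-identityʳ u) (ℕ.*-monoʳ-≤ u 1≤n)) Y≤Z
    1≤Z : 1 ℕ.≤ Z
    1≤Z = ℕ.≤-trans 1≤n n≤Z
    expand : ∀ n u N K X → suc (suc ((1 ℕ.+ suc ((n ℕ.+ u) ℕ.* 4)) ℕ.+ ((2 ℕ.+ suc (N ℕ.* 4)) ℕ.+ (1 ℕ.+
      (1 ℕ.+ (suc (N ℕ.* (2 ℕ.+ 154 ℕ.* (K ℕ.* X))) ℕ.+ (1 ℕ.+ 59 ℕ.* X))))))) ≡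
      11 ℕ.+ 4 ℕ.* n ℕ.+ 4 ℕ.* u ℕ.+ 6 ℕ.* N ℕ.+ 59 ℕ.* X ℕ.+ 154 ℕ.* (K ℕ.* (N ℕ.* X))
    expand = ℕ-Solver.solve-∀
    collect : ∀ z → 11 ℕ.* z ℕ.+ 4 ℕ.* z ℕ.+ 4 ℕ.* z ℕ.+ 6 ℕ.* z ℕ.+ 59 ℕ.* z ℕ.+ 154 ℕ.* z ≡ 238 ℕ.* z
    collect = ℕ-Solver.solve-∀

-- Solving an instance

padded-< : ∀ {n} (f : Fin n → ℚ) i (i<n : i ℕ.< n) → padded f i ≡ f (fromℕ< i<n)
padded-< {n} f i i<n with i ℕ.<? n
... | yes _   = refl
... | no  i≮n = ⊥-elim (i≮n i<n)

padded-toℕ : ∀ {n} (f : Fin n → ℚ) i → padded f (toℕ i) ≡ f i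
padded-toℕ f i = trans (padded-< f (toℕ i) (Fin.toℕ<n i)) (cong f (Fin.fromℕ<-toℕ i (Fin.toℕ<n i)))

-- The largest height will serve as the bound `M` in `balanced-signs`; being attained, it inherits
-- the strict inequality.
below-maximum : ∀ n (f : Fin (suc n) → ℚ) c → (∀ i → f i < c) → ∃[ M ] (∀ i → f i ≤ M) × M < c
below-maximum zero    f c f<c = f zero , (λ { zero → ≤-refl }) , f<c zero
below-maximum (suc n) f c f<c = combine (below-maximum n (f ∘ suc) c (f<c ∘ suc))
  where
  combine : ∃[ M ] (∀ i → f (suc i) ≤ M) × M < c → ∃[ M ] (∀ i → f i ≤ M) × M < c
  combine (M , f≤M , M<c) = by-cases (≤-total (f zero) M)
    where
    by-cases : f zero ≤ M ⊎ M ≤ f zero → ∃[ M ] (∀ i → f i ≤ M) × M < c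
    by-cases (inj₁ le) = M , (λ { zero → le ; (suc i) → f≤M i }) , M<c
    by-cases (inj₂ le) = f zero , (λ { zero → ≤-refl ; (suc i) → ≤-trans (f≤M i) le }) , f<c zero

changes-not : ∀ s k → changes (not ∘ s) k ≡ changes s k
changes-not s zero          = refl
changes-not s (suc zero)    = refl
changes-not s (suc (suc k)) = cong₂ ℕ._+_ (changes-not s (suc k)) (differs-not (s (suc k)) (s k))
  where
  differs-not : ∀ a b → differs (not a) (not b) ≡ differs a b
  differs-not true  true  = refl
  differs-not true  false = refl
  differs-not false true  = refl
  differs-not false false = refl

imbalance-not : ∀ g l r s k → imbalance g l r (not ∘ s) k ≡ - imbalance g l r s k
imbalance-not g l r s k = trans
  (∑-cong k (λ j _ → trans (cong (_* (coverage l r (g (suc j)) - coverage l r (g j))) (sgn-not (s j)))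
                           (sym (neg-distribˡ-* (sgn (s j)) (coverage l r (g (suc j)) - coverage l r (g j))))))
  (∑-neg k (λ j → sgn (s j) * (coverage l r (g (suc j)) - coverage l r (g j))))

module _ {n : ℕ} (C : SingleBlock n) where

  length : Fin n → ℚ
  length i = right C i - left C i

  0<height : ∀ i → 0ℚ < height C i
  0<height i = positive⁻¹ (height C i) {{1/pos⇒pos (length i) {{length-positive C i}}}}

  height*length : ∀ i → height C i * length i ≡ 1ℚ
  height*length i = *-inverseˡ (length i) {{pos⇒nonZero (length i) {{length-positive C i}}}}

  density-inside : ∀ i x → left C i < x → x < right C i → density C i x ≡ height C i
  density-inside i x l<x x<r = if-true (cong₂ _∧_ (dec-true (left C i <? x) l<x) (dec-true (x <? right C i) x<r))

  height≤ : ∀ {M} → MaximumValue C M → ∀ i → height C i ≤ M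
  height≤ {M} max i = use (<-dense (left<right C i))
    where
    use : ∃[ x ] left C i < x × x < right C i → height C i ≤ M
    use (x , l<x , x<r) = subst (_≤ M) (density-inside i x l<x x<r)
      (max i x (≤-trans (0≤left C i) (<⇒≤ l<x) , ≤-trans (<⇒≤ x<r) (right≤1 C i)))

  1≤height : ∀ i → 1ℚ ≤ height C i
  1≤height i = subst₂ _≤_ (height*length i) (*-identityʳ (height C i))
    (*-monoˡ-≤-nonNeg (height C i) {{nonNegative (<⇒≤ (0<height i))}} length≤1)
    where
    cancel : ∀ l r → (r - l) + ((1ℚ - r) + (l - 0ℚ)) ≡ 1ℚ
    cancel = solve-∀ ℚ-ring
    length≤1 : length i ≤ 1ℚ
    length≤1 = ≤-from-difference ((1ℚ - right C i) + (left C i - 0ℚ)) (0≤p+q (0≤q-p (right≤1 C i)) (0≤q-p (0≤left C i))) (cancel (left C i) (right C i))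

  measure-difference : ∀ i m (x : ℕ → ℚ) (b : ℕ → ℕ) → Increasing m 0ℚ x 1ℚ →
    let Y = cutting (tabulate {n = m} (λ j → x (toℕ j))) (tabulate (λ j → toSign (b (toℕ j)))) in
    μ C i Sign.+ Y - μ C i Sign.- Y ≡ signedSum (λ q → height C i * coverage (left C i) (right C i) q) m 0ℚ x b 1ℚ
  measure-difference i m x b inc = sumLabelled-difference (mass C i) (λ q → height C i * coverage (left C i) (right C i) q)
    (mass-coverage C i) m 0ℚ x b inc

  uncut : ∀ i (x : ℕ → ℚ) (b : ℕ → ℕ) → b 0 ≡ 0 →
          signedSum (λ q → height C i * coverage (left C i) (right C i) q) 0 0ℚ x b 1ℚ ≡ - 1ℚ
  uncut i x b b≡ = trans (cong (λ y → labelSign y * (F 1ℚ - F 0ℚ)) b≡) (cong (- 1ℚ *_) F≡1)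
    where
    F : ℚ → ℚ
    F q = height C i * coverage (left C i) (right C i) q
    0≤r : 0ℚ ≤ right C i
    0≤r = ≤-trans (0≤left C i) (<⇒≤ (left<right C i))
    identity : ∀ h r l → h * (r - l) - h * (0ℚ - 0ℚ) ≡ h * (r - l)
    identity = solve-∀ ℚ-ring
    F≡1 : F 1ℚ - F 0ℚ ≡ 1ℚ
    F≡1 = trans (cong₂ (λ p q → height C i * p - height C i * q)
        (cong₂ _-_ (p≤q⇒p⊓q≡p (right≤1 C i)) (p≤q⇒p⊓q≡p (≤-trans (<⇒≤ (left<right C i)) (right≤1 C i))))
        (cong₂ _-_ (p≥q⇒p⊓q≡q 0≤r) (p≥q⇒p⊓q≡q (0≤left C i))))
      (trans (identity (height C i) (right C i) (left C i)) (height*length i))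

≤O-intro : ∀ {t c g} → fromℕ t ≤ fromℕ c * g → t ≤O[ c ] g
≤O-intro {t} {c} {g} t≤ = ≤-trans t≤ (*-monoˡ-≤-nonNeg (fromℕ c) {{nonNegative (0≤fromℕ c)}} (p≤q⊔p 1ℚ g))

constant-time : ∀ {t c g} → t ℕ.≤ c → t ≤O[ c ] g
constant-time {t} {c} {g} t≤c = ≤-trans (fromℕ-mono-≤ t≤c)
  (subst (_≤ fromℕ c * (1ℚ ⊔ g)) (*-identityʳ (fromℕ c)) (*-monoˡ-≤-nonNeg (fromℕ c) {{nonNegative (0≤fromℕ c)}} (p≤p⊔q 1ℚ g)))

-- K and u bound the numbers of table entries per layer and of grid cells; the
-- constant 6000 is at least 238 · 10 · (3/2)².
product-bound : ∀ K u n d x → fromℕ K ≤ fromℕ 10 * x ^ d → fromℕ 2 * fromℕ u ≤ fromℕ 3 * x → 1ℚ ≤ x → 1 ℕ.≤ n →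
                fromℕ (238 ℕ.* (K ℕ.* (u ℕ.* (u ℕ.* n)))) ≤ fromℕ 6000 * (x ^ (d ℕ.+ 2) * fromℕ (n ℕ.* (n ℕ.+ d)))
product-bound K u n d x K≤ 2u≤ 1≤x 1≤n = p*q≤r⇒q≤r÷p {fromℕ 4} {_} {fromℕ 6000 * (x ^ (d ℕ.+ 2) * fromℕ (n ℕ.* (n ℕ.+ d)))} (positive⁻¹ (fromℕ 4)) (begin
  fromℕ 4 * fromℕ (238 ℕ.* (K ℕ.* (u ℕ.* (u ℕ.* n))))
    ≡⟨ cong (fromℕ 4 *_) (trans (fromℕ-* 238 (K ℕ.* (u ℕ.* (u ℕ.* n)))) (cong (fromℕ 238 *_) (trans (fromℕ-* K (u ℕ.* (u ℕ.* n)))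
         (cong (fromℕ K *_) (trans (fromℕ-* u (u ℕ.* n)) (cong (fromℕ u *_) (fromℕ-* u n))))))) ⟩
  fromℕ 4 * (fromℕ 238 * (fromℕ K * (fromℕ u * (fromℕ u * fromℕ n))))
    ≡⟨ arrange (fromℕ K) (fromℕ u) (fromℕ n) ⟩
  fromℕ 238 * (fromℕ K * ((fromℕ 2 * fromℕ u) * (fromℕ 2 * fromℕ u)) * fromℕ n)
    ≤⟨ *-monoˡ-≤-nonNeg (fromℕ 238) (*-mono-≤-nonNeg {a} {a′} {fromℕ n} {w} 0≤a 0≤w a≤a′ n≤w) ⟩
  fromℕ 238 * (fromℕ 10 * x ^ d * ((fromℕ 3 * x) * (fromℕ 3 * x)) * w)
    ≡⟨ collect (x ^ d) x w ⟩
  fromℕ 21420 * (x ^ d * (x * x) * w)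
    ≤⟨ *-monoʳ-≤-nonNeg (x ^ d * (x * x) * w) {{nonNegative (0≤p*q (0≤p*q (0≤^ d 0≤x) (0≤p*q 0≤x 0≤x)) 0≤w)}} (fromℕ-mono-≤ {21420} {24000} (ℕ.m≤m+n 21420 2580)) ⟩
  fromℕ 24000 * (x ^ d * (x * x) * w)
    ≡⟨ factor (x ^ d * (x * x) * w) ⟩
  fromℕ 4 * (fromℕ 6000 * (x ^ d * (x * x) * w))
    ≡⟨ cong (λ y → fromℕ 4 * (fromℕ 6000 * (y * w))) (sym (^-+2 x d)) ⟩
  fromℕ 4 * (fromℕ 6000 * (x ^ (d ℕ.+ 2) * w)) ∎)
  where
  open ≤-Reasoning
  w a a′ : ℚ
  w = fromℕ (n ℕ.* (n ℕ.+ d))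
  a = fromℕ K * ((fromℕ 2 * fromℕ u) * (fromℕ 2 * fromℕ u))
  a′ = fromℕ 10 * x ^ d * ((fromℕ 3 * x) * (fromℕ 3 * x))
  0≤x : 0ℚ ≤ x
  0≤x = ≤-trans (nonNegative⁻¹ 1ℚ) 1≤x
  0≤w : 0ℚ ≤ w
  0≤w = 0≤fromℕ (n ℕ.* (n ℕ.+ d))
  0≤2u : 0ℚ ≤ fromℕ 2 * fromℕ u
  0≤2u = 0≤p*q (0≤fromℕ 2) (0≤fromℕ u)
  0≤3x : 0ℚ ≤ fromℕ 3 * x
  0≤3x = 0≤p*q (0≤fromℕ 3) 0≤x
  0≤a : 0ℚ ≤ a
  0≤a = 0≤p*q (0≤fromℕ K) (0≤p*q 0≤2u 0≤2u)
  a≤a′ : a ≤ a′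
  a≤a′ = *-mono-≤-nonNeg {fromℕ K} {fromℕ 10 * x ^ d} {(fromℕ 2 * fromℕ u) * (fromℕ 2 * fromℕ u)} {(fromℕ 3 * x) * (fromℕ 3 * x)}
    (0≤fromℕ K) (0≤p*q 0≤3x 0≤3x) K≤
    (*-mono-≤-nonNeg {fromℕ 2 * fromℕ u} {fromℕ 3 * x} {fromℕ 2 * fromℕ u} {fromℕ 3 * x} 0≤2u 0≤3x 2u≤ 2u≤)
  n≤w : fromℕ n ≤ w
  n≤w = fromℕ-mono-≤ (subst (ℕ._≤ n ℕ.* (n ℕ.+ d)) (ℕ.*-identityʳ n) (ℕ.*-monoʳ-≤ n (ℕ.≤-trans 1≤n (ℕ.m≤m+n n d))))
  arrange : ∀ k u n → fromℕ 4 * (fromℕ 238 * (k * (u * (u * n)))) ≡ fromℕ 238 * (k * ((fromℕ 2 * u) * (fromℕ 2 * u)) * n)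
  arrange = solve-∀ ℚ-ring
  collect : ∀ p x w → fromℕ 238 * (fromℕ 10 * p * ((fromℕ 3 * x) * (fromℕ 3 * x)) * w) ≡ fromℕ 21420 * (p * (x * x) * w)
  collect = solve-∀ ℚ-ring
  factor : ∀ z → fromℕ 24000 * z ≡ fromℕ 4 * (fromℕ 6000 * z)
  factor = solve-∀ ℚ-ring

scaled-imbalance : ∀ c l r g s N →
  ∑ N (λ j → sgn (s j) * (c * coverage l r (g (suc j)) - c * coverage l r (g j))) ≡ c * imbalance g l r s N
scaled-imbalance c l r g s N = trans
  (∑-cong N (λ j _ → factor (sgn (s j)) c (coverage l r (g (suc j))) (coverage l r (g j))))
  (∑-*ˡ N c (λ j → sgn (s j) * (coverage l r (g (suc j)) - coverage l r (g j))))
  where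
  factor : ∀ a c p q → a * (c * p - c * q) ≡ c * (a * (p - q))
  factor = solve-∀ ℚ-ring

module Solve {n : ℕ} (C : SingleBlock (suc n)) (ε : ℚ) (0<ε : 0ℚ < ε) where

  l r h : ℕ → ℚ
  l = padded (left C)
  r = padded (right C)
  h = padded (height C)

  0≤l : ∀ i → i ℕ.< suc n → 0ℚ ≤ l i
  0≤l i i<n = subst (0ℚ ≤_) (sym (padded-< (left C) i i<n)) (0≤left C (fromℕ< i<n))

  l<r : ∀ i → i ℕ.< suc n → l i < r i
  l<r i i<n = subst₂ _<_ (sym (padded-< (left C) i i<n)) (sym (padded-< (right C) i i<n)) (left<right C (fromℕ< i<n))

  r≤1 : ∀ i → i ℕ.< suc n → r i ≤ 1ℚ
  r≤1 i i<n = subst (_≤ 1ℚ) (sym (padded-< (right C) i i<n)) (right≤1 C (fromℕ< i<n))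

  module Grid (N : ℕ) (h<N : ∀ i → i ℕ.< suc n → fromℕ 2 * h i < fromℕ N * ε)
              (δ : ℚ) (0<δ : 0ℚ < δ) (Nδ≡1 : fromℕ N * δ ≡ 1ℚ) (1≤N : 1 ℕ.≤ N) where

    open Dynamic (suc n) l r h δ ε 0<δ 0≤l l<r
    open Specs (suc n) N l r h δ ε 0<δ 0≤l l<r
    open Search (suc n) N l r h δ ε 0<δ 0≤l l<r
    open Marks (suc n) l r h δ ε 0<δ 0≤l l<r
    open Time (suc n) N l r h δ ε 0<δ 0≤l l<r 1≤N (s≤s z≤n)

    r≤G : ∀ i → i ℕ.< suc n → r i ≤ G N
    r≤G i i<n = subst (r i ≤_) (sym Nδ≡1) (r≤1 i i<n)

    -- A larger minimum would exclude every balanced sequence with few changes: one ending in plus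
    -- is itself a competitor, and one ending in minus becomes a competitor when all signs are
    -- flipped. This contradicts `balanced-signs`.
    optimal-cost : ∀ s → (∀ t → t (N ℕ.∸ 1) ≡ true → cost N s ℕ.≤ cost N t) → cost N s ℕ.≤ suc n
    optimal-cost s optimal = decide (cost N s ℕ.≤? suc n)
      where
      maximum : ∃[ M ] (∀ i → height C i ≤ M) × M < ½ * (fromℕ N * ε)
      maximum = below-maximum n (height C) (½ * (fromℕ N * ε)) λ i →
        subst (_< ½ * (fromℕ N * ε)) (trans (cong (λ y → ½ * (fromℕ 2 * y)) (padded-toℕ (height C) i)) (halve (height C i)))
          (*-monoʳ-<-pos ½ (h<N (toℕ i) (Fin.toℕ<n i)))
        where
        halve : ∀ a → ½ * (fromℕ 2 * a) ≡ a
        halve = solve-∀ ℚ-ring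
      cost≤ : ∀ t → changes t N ℕ.≤ suc n → (∀ i → Within ε (height C i * imbalance (grid δ) (left C i) (right C i) t N)) →
              cost N t ℕ.≤ suc n
      cost≤ t few balanced = cost-balanced N r≤G t few λ i i<n → subst (Within ε)
        (sym (cong₂ (λ x y → x * y) (padded-< (height C) i i<n)
          (cong₂ (λ x y → imbalance (grid δ) x y t N) (padded-< (left C) i i<n) (padded-< (right C) i i<n)))) (balanced (fromℕ< i<n))
      impossible : ¬ cost N s ℕ.≤ suc n → ∃[ M ] (∀ i → height C i ≤ M) × M < ½ * (fromℕ N * ε) → ⊥
      impossible large (M , h≤M , M<) = balanced-signs N (height C) (left C) (right C) M δ ε (λ i → <⇒≤ (0<height C i)) h≤M
        (λ i → <⇒≤ (left<right C i)) 0<δ small none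
        where
        small : fromℕ 2 * (M * δ) < ε
        small = subst (fromℕ 2 * (M * δ) <_) (trans (regroup (fromℕ N) ε δ) (trans (cong (ε *_) Nδ≡1) (*-identityʳ ε)))
          (*-monoʳ-<-pos (fromℕ 2) (*-monoˡ-<-pos δ {{positive 0<δ}} M<))
          where
          regroup : ∀ N ε δ → fromℕ 2 * (½ * (N * ε) * δ) ≡ ε * (N * δ)
          regroup = solve-∀ ℚ-ring
        none : ∀ t → changes t N ℕ.≤ suc n → ¬ (∀ i → Within ε (height C i * imbalance (grid δ) (left C i) (right C i) t N))
        none t few balanced = by-last (t (N ℕ.∸ 1)) refl
          where
          flipped : ∀ i → Within ε (height C i * imbalance (grid δ) (left C i) (right C i) (not ∘ t) N)
          flipped i = subst (Within ε) (trans (neg-distribʳ-* (height C i) (imbalance (grid δ) (left C i) (right C i) t N))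
            (cong (height C i *_) (sym (imbalance-not (grid δ) (left C i) (right C i) t N)))) (Within-neg (balanced i))
          by-last : ∀ b → t (N ℕ.∸ 1) ≡ b → ⊥
          by-last true  eq = large (ℕ.≤-trans (optimal t eq) (cost≤ t few balanced))
          by-last false eq = large (ℕ.≤-trans (optimal (not ∘ t) (cong not eq))
            (cost≤ (not ∘ t) (subst (ℕ._≤ suc n) (sym (changes-not t N)) few) flipped))
      decide : Dec (cost N s ℕ.≤ suc n) → cost N s ℕ.≤ suc n
      decide (yes le)  = le
      decide (no ¬le) = ⊥-elim (impossible ¬le maximum)

    solution : ∀ {τ} s → Cuts N s τ → cost N s ℕ.≤ suc n → IsSolution C ε (output τ)
    solution {τ} s (count≡ , L) cost≤ = record
      { at-most-n  = subst (ℕ._≤ suc n) (sym count≡) (proj₁ balance)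
      ; inUnit     = increasing-inUnit (nats τ 1 0) ≤-refl inc
      ; increasing = increasing-linked (nats τ 1 0) inc
      ; balanced   = λ i → Within⇒∣∣≤ (subst (Within ε) (sym (difference i)) (within i))
      }
      where
      balance : changes s N ℕ.≤ suc n × (∀ i → i ℕ.< suc n → Within ε (h i * imb i s N))
      balance = cost-balanced⁻¹ N r≤G s cost≤
      inc : Increasing (nats τ 1 0) 0ℚ (rats τ 4) 1ℚ
      inc = subst (Increasing (nats τ 1 0) 0ℚ (rats τ 4)) Nδ≡1 (increasing L)
      F : Fin (suc n) → ℚ → ℚ
      F i q = height C i * coverage (left C i) (right C i) q
      difference : ∀ i → μ C i Sign.+ (output τ) - μ C i Sign.- (output τ) ≡ height C i * imbalance G (left C i) (right C i) s N
      difference i = trans (measure-difference C i (nats τ 1 0) (rats τ 4) (nats τ 2) inc)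
        (trans (cong (signedSum (F i) (nats τ 1 0) 0ℚ (rats τ 4) (nats τ 2)) (sym Nδ≡1))
          (trans (signed L (F i)) (scaled-imbalance (height C i) (left C i) (right C i) G s N)))
      within : ∀ i → Within ε (height C i * imbalance G (left C i) (right C i) s N)
      within i = subst (Within ε) (cong₂ (λ x y → x * y) (padded-toℕ (height C) i)
        (cong₂ (λ x y → imbalance G x y s N) (padded-toℕ (left C) i) (padded-toℕ (right C) i))) (proj₂ balance (toℕ i) (Fin.toℕ<n i))

    G-inUnit : ∀ k → k ℕ.≤ N → InUnit (G k)
    G-inUnit k k≤N = 0≤p*q (0≤fromℕ k) (<⇒≤ 0<δ) , subst (G k ≤_) Nδ≡1 (grid-mono (<⇒≤ 0<δ) k≤N)

    -- Blocks active at time `k` contain the grid point `G k` in their interior, so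
    -- `MaximumIntersection` applied at that point bounds their number.
    few-marked : ∀ d → MaximumIntersection C d → ∀ k → k ℕ.≤ N → count k (marked k) ℕ.≤ d
    few-marked d inter k k≤N = ℕ.≤-trans (count-marked k k) (ℕ.≤-trans
      (count≤card (suc n) (active k k) (λ i → does (0ℚ <? density C i (G k))) supported) (inter (G k) (G-inUnit k k≤N)))
      where
      supported : ∀ i → active k k (toℕ i) ≡ true → does (0ℚ <? density C i (G k)) ≡ true
      supported i eq = dec-true (0ℚ <? density C i (G k)) (subst (0ℚ <_) (sym (density-inside C i (G k)
        (subst (_< G k) (padded-toℕ (left C) i) (leq-false⁻¹ (G k) (l (toℕ i)) (not-true (proj₁ (∧-true eq)))))
        (subst (G k <_) (padded-toℕ (right C) i) (leq-false⁻¹ (r (toℕ i)) (G k) (not-true (proj₂ (∧-true {not (leq (G k) (l (toℕ i)))} eq)))))))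
        (0<height C i))

    few-keys : ∀ u x d → N ℕ.≤ u → fromℕ 2 * fromℕ u ≤ fromℕ 3 * x → 1ℚ ≤ x → MaximumIntersection C d →
               ∃[ K ] 1 ℕ.≤ K × (∀ k → k ℕ.< N → keys k ℕ.≤ K) × fromℕ K ≤ fromℕ 10 * x ^ d
    few-keys u x d N≤u 2u≤3x 1≤x inter = common-bound N keys (fromℕ 10 * x ^ d)
      (*-mono-≤-nonNeg {1ℚ} {fromℕ 10} {1ℚ} {x ^ d} (nonNegative⁻¹ 1ℚ) (≤-trans (nonNegative⁻¹ 1ℚ) (1≤^ d 1≤x)) (fromℕ-mono-≤ {1} {10} (s≤s z≤n)) (1≤^ d 1≤x))
      λ k k<N → factorial-cancel (keys k) (count k (marked k)) k u x d (keys-bound k) (ℕ.≤-trans (ℕ.<⇒≤ k<N) N≤u) 2u≤3x 1≤x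
                  (few-marked d inter k (ℕ.<⇒≤ k<N))

    -- The empty sequence has code 0, stored as 1, and key 0. The layer formally has two entries,
    -- for the two values of the last sign, and the second stays empty.
    initial-layer : ∀ {o T C} → o ≡ 0 → T 0 ≡ 1 → (∀ a → 0 ≢ a → T a ≡ 0) → (∀ a → C a ≡ 0) → Complete 0 o T C
    initial-layer {T = T} {C} refl T0 T≢0 C0 = record
      { sound = λ { zero _ _ → (λ _ → true) , T0 , trans (C0 0) (sym (cost-zero (λ _ → true))) , refl
                  ; (suc κ) _ T>0 → ⊥-elim (ℕ.<⇒≢ T>0 (sym (T≢0 (suc κ) λ ()))) }
      ; complete = λ s → subst (1 ℕ.≤_) (sym T0) ℕ.≤-refl , subst (ℕ._≤ cost 0 s) (sym (C0 0)) z≤n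
      ; fresh = λ { zero () ; (suc a) _ → T≢0 (suc a) λ () }
      }

    Solved : Store → Set
    Solved τ = IsSolution C ε (output τ)

    finish : ∀ K {σ} → 1 ℕ.≤ K → (∀ k → k ℕ.< N → keys k ℕ.≤ K) → AtLayer 0 σ →
             Runs search σ (1 ℕ.+ (suc (N ℕ.* (2 ℕ.+ 154 ℕ.* (K ℕ.* (N ℕ.* suc n)))) ℕ.+ (1 ℕ.+ t-evaluate N))) Solved
    finish K 1≤K keys≤K L = runs-post (λ { {τ} (s , cuts , optimal) → solution {τ} s cuts (optimal-cost s optimal) })
      (runs-search r≤G 1≤N (154 ℕ.* (K ℕ.* (N ℕ.* suc n))) (t-layer≤ K 1≤K keys≤K) L)

    afterCounting : Program
    afterCounting = buildGrid ⨾ table# ! lit 0 ≔ℕ lit 1 ⨾ search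

    record Prepared (σ : Store) : Set where
      field
        n≡      : nats σ 0 0 ≡ suc n
        N≡      : nats σ cells# 0 ≡ N
        step≡   : quotient 1ℚ (rats σ cellsℚ# 0) ≡ δ
        ε≡      : rats σ 0 0 ≡ ε
        l≡      : ∀ i → rats σ 1 i ≡ l i
        r≡      : ∀ i → rats σ 2 i ≡ r i
        h≡      : ∀ i → rats σ 3 i ≡ h i
        grid0   : rats σ grid# 0 ≡ 0ℚ
        layer0  : nats σ layer# 0 ≡ 0
        offset0 : nats σ offset# 0 ≡ 0
        table0  : ∀ a → nats σ table# a ≡ 0
        costs0  : ∀ a → nats σ costs# a ≡ 0

    runs-afterCounting : ∀ K {σ} → 1 ℕ.≤ K → (∀ k → k ℕ.< N → keys k ℕ.≤ K) → Prepared σ →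
      Runs afterCounting σ ((2 ℕ.+ suc (N ℕ.* 4)) ℕ.+ (1 ℕ.+
        (1 ℕ.+ (suc (N ℕ.* (2 ℕ.+ 154 ℕ.* (K ℕ.* (N ℕ.* suc n)))) ℕ.+ (1 ℕ.+ t-evaluate N))))) Solved
    runs-afterCounting K {σ} 1≤K keys≤K c = runs-frame (Setup.runs-buildGrid (suc n) h ε 0<ε N δ (Prepared.N≡ c) (Prepared.step≡ c) (Prepared.grid0 c)) then
      λ { {τ} (built , fr) → runs-ℕ⨾ (finish K 1≤K keys≤K (record
        { constants = record
          { n≡ = trans (frameℕ fr 0 refl 0) (Prepared.n≡ c) ; N≡ = trans (frameℕ fr cells# refl 0) (Prepared.N≡ c) ; ε≡ = trans (frameℚ fr 0 refl 0) (Prepared.ε≡ c)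
          ; l≡ = λ i → trans (frameℚ fr 1 refl i) (Prepared.l≡ c i) ; r≡ = λ i → trans (frameℚ fr 2 refl i) (Prepared.r≡ c i) ; h≡ = λ i → trans (frameℚ fr 3 refl i) (Prepared.h≡ c i)
          ; G≡ = λ j j≤N → proj₁ (built j j≤N) ; pow≡ = λ j j≤N → proj₂ (built j j≤N) }
        ; layer≡ = trans (frameℕ fr layer# refl 0) (Prepared.layer0 c)
        ; tables = initial-layer (trans (frameℕ fr offset# refl 0) (Prepared.offset0 c)) (update-same (nats τ) table# 0 1)
            (λ a 0≢a → trans (update-other (nats τ) table# 0 1 a 0≢a) (trans (frameℕ fr table# refl a) (Prepared.table0 c a)))
            (λ a → trans (frameℕ fr costs# refl a) (Prepared.costs0 c a)) })) }

module Main {n : ℕ} (C : SingleBlock (suc n)) (ε : ℚ) (0<ε : 0ℚ < ε) (M : ℚ) (d : ℕ)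
         (max : MaximumValue C M) (inter : MaximumIntersection C d) (ε<1 : leq 1ℚ ε ≡ false) where

  ε≢0 : NonZero ε
  ε≢0 = pos⇒nonZero ε {{positive 0<ε}}

  open Solve C ε 0<ε

  x : ℚ
  x = (fromℕ 2 * M ÷ ε) {{ε≢0}}

  Outcome : Set
  Outcome = ∃[ t ] ∃[ σ ] (consensusHalving , input C ε ⇓[ t ] σ) × IsSolution C ε (output σ)
                          × t ≤O[ 6000 ] bound M ε {{positive 0<ε}} d (suc n)

  xε≡2M : x * ε ≡ fromℕ 2 * M
  xε≡2M = trans (*-assoc (fromℕ 2 * M) ((1/ ε) {{ε≢0}}) ε)
    (trans (cong (fromℕ 2 * M *_) (*-inverseˡ ε {{ε≢0}})) (*-identityʳ (fromℕ 2 * M)))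

  -- Blocks inside the unit interval have height at least 1, hence `M` is at least 1, while `ε` is
  -- less than 1.
  2≤x : fromℕ 2 ≤ x
  2≤x = *-cancelʳ-≤-pos ε {{positive 0<ε}} (subst (fromℕ 2 * ε ≤_) (sym xε≡2M)
    (*-monoˡ-≤-nonNeg (fromℕ 2) (≤-trans (<⇒≤ (leq-false⁻¹ 1ℚ ε ε<1)) (≤-trans (1≤height C zero) (height≤ C max zero)))))

  0≤x : 0ℚ ≤ x
  0≤x = ≤-trans (0≤fromℕ 2) 2≤x

  1≤x : 1ℚ ≤ x
  1≤x = ≤-trans (fromℕ-mono-≤ {1} {2} (s≤s z≤n)) 2≤x

  counting : ∃[ u ] x < fromℕ u × fromℕ u ≤ x + 1ℚ → Outcome
  counting (u , x<u , u≤x+1) = counted (runs-frame (Setup.runs-countCells (suc n) h ε 0<ε u h<u {input C ε} refl refl (λ _ → refl) refl refl))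
    where
    h<u : ∀ i → i ℕ.< suc n → fromℕ 2 * h i < fromℕ u * ε
    h<u i i<n = ≤-<-trans (*-monoˡ-≤-nonNeg (fromℕ 2) (subst (_≤ M) (sym (padded-< (height C) i i<n)) (height≤ C max (fromℕ< i<n))))
      (subst (_< fromℕ u * ε) xε≡2M (*-monoˡ-<-pos ε {{positive 0<ε}} x<u))
    -- `u` is at most `x + 1`, and `x ≥ 2` absorbs the 1 into half of `x`.
    2u≤3x : fromℕ 2 * fromℕ u ≤ fromℕ 3 * x
    2u≤3x = ≤-trans (*-monoˡ-≤-nonNeg (fromℕ 2) u≤x+1) (≤-from-difference (x - fromℕ 2) (0≤q-p 2≤x) (identity x))
      where
      identity : ∀ x → fromℕ 2 * (x + 1ℚ) + (x - fromℕ 2) ≡ fromℕ 3 * x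
      identity = solve-∀ ℚ-ring
    T₁ : ℕ
    T₁ = 1 ℕ.+ suc ((suc n ℕ.+ u) ℕ.* 4)
    counted : Runs countCells (input C ε) T₁ (λ τ → Setup.Counted (suc n) h ε 0<ε u h<u τ × Frame countCells (input C ε) τ) → Outcome
    counted (runs {_} {τ₁} e t≤ (c , fr)) = search-from (few-keys u x d N≤u 2u≤3x 1≤x inter)
      where
      open Setup.Counted c
      0<2h : 0ℚ < fromℕ 2 * h 0
      0<2h = 0<p*q (positive⁻¹ (fromℕ 2)) (0<height C zero)
      positive-N : ∀ N → (∀ i → i ℕ.< suc n → fromℕ 2 * h i < fromℕ N * ε) → 1 ℕ.≤ N
      positive-N zero    lt = ⊥-elim (<-irrefl refl (<-trans 0<2h (subst (fromℕ 2 * h 0 <_) (*-zeroˡ ε) (lt 0 (s≤s z≤n)))))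
      positive-N (suc _) _  = s≤s z≤n
      1≤N : 1 ℕ.≤ N
      1≤N = positive-N N h<N
      0<N : 0ℚ < fromℕ N
      0<N = <-≤-trans (positive⁻¹ 1ℚ) (fromℕ-mono-≤ {1} {N} 1≤N)
      1/N : ℚ
      1/N = quotient 1ℚ (fromℕ N)
      open Grid N h<N 1/N (proj₁ (quotient-1 (fromℕ N) 0<N)) (proj₂ (quotient-1 (fromℕ N) 0<N)) 1≤N
      prepared : Prepared τ₁
      prepared = record
        { n≡ = frameℕ fr 0 refl 0 ; N≡ = cells≡ ; step≡ = cong (quotient 1ℚ) cellsℚ≡ ; ε≡ = frameℚ fr 0 refl 0
        ; l≡ = frameℚ fr 1 refl ; r≡ = frameℚ fr 2 refl ; h≡ = frameℚ fr 3 refl ; grid0 = frameℚ fr grid# refl 0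
        ; layer0 = frameℕ fr layer# refl 0 ; offset0 = frameℕ fr offset# refl 0 ; table0 = frameℕ fr table# refl ; costs0 = frameℕ fr costs# refl }
      search-from : ∃[ K ] 1 ℕ.≤ K × _ × fromℕ K ≤ fromℕ 10 * x ^ d → Outcome
      search-from (K , 1≤K , keys≤K , K≤) = conclude (runs-seq (runs e t≤ (runs-afterCounting K 1≤K keys≤K prepared)))
        where
        conclude : Runs (countCells ⨾ afterCounting) (input C ε) _ Solved → Outcome
        -- The two additional steps are the tests of `ε` and of the number of blocks.
        conclude (runs {t} {τ} e t≤ solved) = suc (suc t) , τ , ⇓ifFalse ε<1 (⇓ifFalse refl e) , solved
          , ≤O-intro {suc (suc t)} {6000} {bound M ε {{positive 0<ε}} d (suc n)} (≤-trans
              (fromℕ-mono-≤ (ℕ.≤-trans (s≤s (s≤s t≤))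
                (Time.total≤ (suc n) N l r h 1/N ε (proj₁ (quotient-1 (fromℕ N) 0<N)) 0≤l l<r 1≤N (s≤s z≤n) K u 1≤K N≤u)))
              (product-bound K u (suc n) d x K≤ 2u≤3x 1≤x (s≤s z≤n)))

theorem6 : ∃[ P ] ∃[ c ]
    ((n : ℕ) (C : SingleBlock n) (ε : ℚ) .{{_ : Positive ε}} →
    (M : ℚ) (d : ℕ) → MaximumValue C M → MaximumIntersection C d →
    ∃[ t ] ∃[ σ ]
    (P , input C ε ⇓[ t ] σ)
    × IsSolution C ε (output σ)
    × t ≤O[ c ] bound M ε d n)
theorem6 = consensusHalving , 6000 , solve
  where
  Goal : ∀ n → SingleBlock n → (ε : ℚ) .{{_ : Positive ε}} → ℚ → ℕ → Set
  Goal n C ε M d = ∃[ t ] ∃[ σ ] (consensusHalving , input C ε ⇓[ t ] σ) × IsSolution C ε (output σ) × t ≤O[ 6000 ] bound M ε d n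

  -- In the input store the output cells are 0, so the whole interval is labelled minus and each
  -- difference is -1.
  trivial-solution : ∀ {n} (C : SingleBlock n) ε .{{_ : Positive ε}} → (∀ (i : Fin n) → 1ℚ ≤ ε) → IsSolution C ε (output (input C ε))
  trivial-solution C ε 1≤ε = record
    { at-most-n = z≤n ; inUnit = [] ; increasing = []
    ; balanced = λ i → subst (λ y → ∣ y ∣ ≤ ε)
        (sym (trans (measure-difference C i 0 (rats (input C ε) 4) (nats (input C ε) 2) (positive⁻¹ 1ℚ))
                    (uncut C i (rats (input C ε) 4) (nats (input C ε) 2) refl)))
        (1≤ε i) }

  large-ε : ∀ n C ε .{{_ : Positive ε}} M d → leq 1ℚ ε ≡ true → Goal n C ε M d
  large-ε n C ε M d t = 2 , input C ε , ⇓ifTrue t ⇓skip , trivial-solution C ε (λ _ → leq-true⁻¹ 1ℚ ε t)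
    , constant-time {2} {6000} {bound M ε d n} (ℕ.m≤m+n 2 5998)

  no-blocks : ∀ C ε .{{_ : Positive ε}} M d → leq 1ℚ ε ≡ false → Goal 0 C ε M d
  no-blocks C ε M d f = 3 , input C ε , ⇓ifFalse f (⇓ifTrue refl ⇓skip) , trivial-solution C ε (λ ())
    , constant-time {3} {6000} {bound M ε d 0} (ℕ.m≤m+n 3 5997)

  solve : ∀ n C ε .{{_ : Positive ε}} M d → MaximumValue C M → MaximumIntersection C d → Goal n C ε M d
  solve n C ε M d max inter = by-ε n C max inter (leq 1ℚ ε) refl
    where
    by-ε : ∀ n (C : SingleBlock n) → MaximumValue C M → MaximumIntersection C d → ∀ b → leq 1ℚ ε ≡ b → Goal n C ε M d
    by-ε n       C max inter true  eq = large-ε n C ε M d eq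
    by-ε zero    C max inter false eq = no-blocks C ε M d eq
    by-ε (suc n) C max inter false eq = Main.counting C ε (positive⁻¹ ε) M d max inter eq (next-integer (Main.0≤x C ε (positive⁻¹ ε) M d max inter eq))
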